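{- For every integer $k\ge 6$, $$\biggl\|\biggl(\frac43\biggr)^k\biggr\| > \biggl(\frac49\biggr)^k,$$ where for a real number $x$, $\|x\|$ denotes the distance from $x$ to the nearest integer.
   Context: $\|x\| = \min_{n\in\mathbb Z}|x-n|$ for real $x$. -}

module Defs where

open import Data.Integer.Base as ℤ using (ℤ)
import Data.Integer.DivMod as ℤ
import Data.Integer.Properties as ℤ
open import Data.Product.Base using (∃; _,_; proj₁)
open import Data.Rational.Base using (ℚ; mkℚ; 0ℚ; _/_; _+_; _-_; -_; ∣_∣; _≤_; floor; toℚᵘ; +-*-rawSemiring)
open import Data.Rational.Properties
open import Data.Rational.Unnormalised.Base as ℚᵘ using (mkℚᵘ)
import Data.Rational.Unnormalised.Properties as ℚᵘ
open import Data.Sum.Base using (inj₁; inj₂)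
open import Relation.Binary.PropositionalEquality using (_≡_; sym; trans; cong; subst; subst₂)
open import Relation.Nullary using (yes; no)

open import Algebra.Definitions.RawSemiring +-*-rawSemiring public using (_^_)

dist : ℚ → ℤ → ℚ
dist x n = ∣ x - n / 1 ∣

private
  p≤∣p∣ : ∀ p → p ≤ ∣ p ∣
  p≤∣p∣ p with ≤-total 0ℚ p
  ... | inj₁ 0≤p = ≤-reflexive (sym (0≤p⇒∣p∣≡p 0≤p))
  ... | inj₂ p≤0 = ≤-trans p≤0 (0≤∣p∣ p)

  -p≤∣p∣ : ∀ p → - p ≤ ∣ p ∣
  -p≤∣p∣ p = ≤-trans (p≤∣p∣ (- p)) (≤-reflexive (∣-p∣≡∣p∣ p))

  toℚᵘ-/1 : ∀ i → toℚᵘ (i / 1) ℚᵘ.≃ mkℚᵘ i 0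
  toℚᵘ-/1 i = toℚᵘ-fromℚᵘ (mkℚᵘ i 0)

  /1-mono-≤ : ∀ {i j} → i ℤ.≤ j → i / 1 ≤ j / 1
  /1-mono-≤ {i} {j} i≤j = toℚᵘ-cancel-≤
    (ℚᵘ.≤-respˡ-≃ (ℚᵘ.≃-sym (toℚᵘ-/1 i))
      (ℚᵘ.≤-respʳ-≃ (ℚᵘ.≃-sym (toℚᵘ-/1 j))
        (ℚᵘ.*≤* (ℤ.*-monoʳ-≤-nonNeg ℤ.1ℤ i≤j))))

  floor≤ : ∀ x → floor x / 1 ≤ x
  floor≤ x@(mkℚ n d-1 _) = toℚᵘ-cancel-≤
    (ℚᵘ.≤-respˡ-≃ (ℚᵘ.≃-sym (toℚᵘ-/1 (floor x)))
      (ℚᵘ.*≤* (subst (floor x ℤ.* ℤ.+[1+ d-1 ] ℤ.≤_) (sym (ℤ.*-identityʳ n))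
        (ℤ.[n/d]*d≤n n (ℤ.+[1+ d-1 ])))))

  ≤1+floor : ∀ x → x ≤ ℤ.suc (floor x) / 1
  ≤1+floor x@(mkℚ n d-1 _) = toℚᵘ-cancel-≤
    (ℚᵘ.≤-respʳ-≃ (ℚᵘ.≃-sym (toℚᵘ-/1 (ℤ.suc (floor x))))
      (ℚᵘ.*≤* (subst₂ ℤ._≤_ (sym (ℤ.*-identityʳ n))
        (cong (λ q → ℤ.suc q ℤ.* ℤ.+[1+ d-1 ]) (sym (ℤ.div-pos-is-/ℕ n _)))
        (ℤ.<⇒≤ (ℤ.n<s[n/ℕd]*d n _)))))

  neg-sub : ∀ p q → - (p - q) ≡ q - p
  neg-sub p q = trans (neg-distrib-+ p (- q))
    (trans (cong (λ r → - p + r) (⁻¹-involutive q)) (+-comm (- p) q))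
    where open import Algebra.Properties.Group +-0-group using (⁻¹-involutive)

  0≤q-p : ∀ {p q} → p ≤ q → 0ℚ ≤ q - p
  0≤q-p {p} p≤q = ≤-trans (≤-reflexive (sym (+-inverseʳ p))) (+-monoˡ-≤ (- p) p≤q)

  dist-below : ∀ x {m n} → m / 1 ≤ x → n ℤ.≤ m → dist x m ≤ dist x n
  dist-below x {m} {n} m≤x n≤m =
    ≤-trans (≤-reflexive (0≤p⇒∣p∣≡p (0≤q-p m≤x)))
      (≤-trans (+-monoʳ-≤ x (neg-antimono-≤ (/1-mono-≤ n≤m))) (p≤∣p∣ (x - n / 1)))

  dist-above : ∀ x {m n} → x ≤ m / 1 → m ℤ.≤ n → dist x m ≤ dist x n
  dist-above x {m} {n} x≤m m≤n =
    ≤-trans (≤-reflexive (trans (sym (∣-p∣≡∣p∣ (x - m / 1)))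
              (trans (cong ∣_∣ (neg-sub x (m / 1))) (0≤p⇒∣p∣≡p (0≤q-p x≤m)))))
      (≤-trans (+-monoˡ-≤ (- x) (/1-mono-≤ m≤n))
        (≤-trans (≤-reflexive (sym (neg-sub x (n / 1)))) (-p≤∣p∣ (x - n / 1))))

nearestInteger : ∀ x → ∃ λ m → ∀ n → dist x m ≤ dist x n
nearestInteger x with ≤-total (dist x (floor x)) (dist x (ℤ.suc (floor x)))
... | inj₁ f≤s = floor x , least
  where
  least : ∀ n → dist x (floor x) ≤ dist x n
  least n with n ℤ.≤? floor x
  ... | yes n≤f = dist-below x (floor≤ x) n≤f
  ... | no  n≰f = ≤-trans f≤s (dist-above x (≤1+floor x) (ℤ.i<j⇒suc[i]≤j (ℤ.≰⇒> n≰f)))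
... | inj₂ s≤f = ℤ.suc (floor x) , least
  where
  least : ∀ n → dist x (ℤ.suc (floor x)) ≤ dist x n
  least n with n ℤ.≤? floor x
  ... | yes n≤f = ≤-trans s≤f (dist-below x (floor≤ x) n≤f)
  ... | no  n≰f = dist-above x (≤1+floor x) (ℤ.i<j⇒suc[i]≤j (ℤ.≰⇒> n≰f))

-- min over n ∈ ℤ of ∣ x - n ∣; the type of nearestInteger says that the
-- minimum is attained at the chosen integer.
‖_‖ : ℚ → ℚ
‖ x ‖ = dist x (proj₁ (nearestInteger x))

{-# OPTIONS --safe #-}
-- Write 4^k = 3^k m + r; the claim is 4^k < 3^k |r|.  For k = 42 t + j the residue theorem applied to
-- (1 + u)^(37t) / (u^(9t+1) (1 - 8u)^(16t+1)) gives a Padé identity 16^(21t) A + V = 9^(21t) P with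
-- explicit positive A, V.  Hence A r + 4^j V is a multiple of 9^(21t), and even of 9^(21t) G, where G is a
-- common factor of the coefficients of A and P coming from the primes p that carry twice in
-- (37t)! / ((9t)! (16t)! (12t)!).  If 2 · 4^j V ≤ 9^(21t) G, then |A r| ≥ 4^j V, whether or not that
-- multiple vanishes, and V / A is large enough.
-- The lower bound for G is a Chebyshev-type certificate: a product of factorials ⌊q t / m⌋! with positive
-- and negative exponents whose order at each prime power d is at most the order of G there, up to an
-- excess at the small d, which costs a power of lcm (1, …, ⌊t / X⌋).  Since its exponents are balanced, its
-- size follows from Stirling's formula, with (1 + 1/H)^H in place of e.
-- This settles k ≥ 42 · 32768.  Below that bound a single remainder 4^K mod 3^w with 4^K < 9^w takes
-- care of all k between w and K, so that 28 remainders suffice.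

module Submission where

-- The factor G cannot be dispensed with: V is about 2^(70.98 t), whereas 9^(21 t) is only 2^(66.57
-- t), so G has to contribute more than 4.41 bits per unit of t. The other condition, 16^(21 t) A <
-- 9^(21 t) V, has room to spare: V / A has at least 18.1 bits per unit of t, and 17.44 are enough.
-- No information on the distribution of primes enters. Legendre's formula in the form n! = ∏
-- Λ(d)^⌊n/d⌋ turns each comparison of products into an inequality between exponents at every
-- modulus d. For the certificate this inequality depends only on the position of t / d among the
-- multiples of 1/37, 1/16, 1/12 and 1/9, and it is bounded for large t / d because the exponents
-- are balanced; so finitely many positions decide it. All estimates are inequalities between
-- natural numbers. Roots and logarithms are avoided by raising both sides to a power that makes
-- every exponent integral.

module Prelude where

  open import Data.Nat.Base public
  open import Data.Nat.Properties public
  open import Data.Nat.DivMod public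
  open import Data.Nat.Tactic.RingSolver using (solve-∀) public
  open import Data.Product.Base using (∃; ∃₂; _×_; _,_; proj₁; proj₂) public
  open import Data.Sum.Base using (_⊎_; inj₁; inj₂) public
  open import Data.Unit.Base using (⊤; tt) public
  open import Relation.Nullary using (¬_; Dec; yes; no; contradiction) public
  open import Relation.Binary.PropositionalEquality hiding (J) public

-- The von Mangoldt function and Legendre's formula.

module VonMangoldt where

  open Prelude
  open import Data.Nat.Divisibility
  open import Data.Nat.Primality
  open import Data.Nat.Primality.Factorisation using (factorise; PrimeFactorisation)
  open import Data.Nat.Coprimality as Coprimality using (Coprime; coprime-divisor)
  open import Data.Nat.Induction using (<-wellFounded)
  open import Induction.WellFounded using (Acc; acc)
  open import Relation.Nullary.Decidable using (map′; _×-dec_)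

  open import Algebra.Properties.CommutativeSemigroup *-commutativeSemigroup using () renaming (interchange to *-interchange) public

  ∏ : (ℕ → ℕ) → ℕ → ℕ
  ∏ f zero    = 1
  ∏ f (suc n) = ∏ f n * f n

  ∏-cong : ∀ {f g : ℕ → ℕ} n → (∀ i → i < n → f i ≡ g i) → ∏ f n ≡ ∏ g n
  ∏-cong zero    f≡g = refl
  ∏-cong (suc n) f≡g = cong₂ _*_ (∏-cong n (λ i i<n → f≡g i (m<n⇒m<1+n i<n))) (f≡g n (n<1+n n))

  ∏-* : ∀ f g n → ∏ (λ i → f i * g i) n ≡ ∏ f n * ∏ g n
  ∏-* f g zero    = refl
  ∏-* f g (suc n) = trans (cong (_* (f n * g n)) (∏-* f g n)) (*-interchange (∏ f n) (∏ g n) (f n) (g n))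

  ∏-1 : ∀ {f : ℕ → ℕ} n → (∀ i → i < n → f i ≡ 1) → ∏ f n ≡ 1
  ∏-1 zero    f≡1 = refl
  ∏-1 (suc n) f≡1 = cong₂ _*_ (∏-1 n (λ i i<n → f≡1 i (m<n⇒m<1+n i<n))) (f≡1 n (n<1+n n))

  ^-distribʳ-* : ∀ k m n → (m * n) ^ k ≡ m ^ k * n ^ k
  ^-distribʳ-* zero    m n = refl
  ^-distribʳ-* (suc k) m n = trans (cong (m * n *_) (^-distribʳ-* k m n)) (*-interchange m n (m ^ k) (n ^ k))

  ^-swap : ∀ x a b → (x ^ a) ^ b ≡ (x ^ b) ^ a
  ^-swap x a b = trans (^-*-assoc x a b) (trans (cong (x ^_) (*-comm a b)) (sym (^-*-assoc x b a)))

  ∏-^ : ∀ f k n → ∏ f n ^ k ≡ ∏ (λ i → f i ^ k) n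
  ∏-^ f k zero    = ^-zeroˡ k
  ∏-^ f k (suc n) = trans (^-distribʳ-* k (∏ f n) (f n)) (cong (_* f n ^ k) (∏-^ f k n))

  ∏-∣ : ∀ {f g : ℕ → ℕ} n → (∀ i → f i ∣ g i) → ∏ f n ∣ ∏ g n
  ∏-∣ zero    f∣g = ∣-refl
  ∏-∣ (suc n) f∣g = *-pres-∣ (∏-∣ n f∣g) (f∣g n)

  ∏-mono : ∀ {f g : ℕ → ℕ} n → (∀ i → f i ≤ g i) → ∏ f n ≤ ∏ g n
  ∏-mono zero    f≤g = ≤-refl
  ∏-mono (suc n) f≤g = *-mono-≤ (∏-mono n f≤g) (f≤g n)

  ∏-pos : ∀ {f : ℕ → ℕ} n → (∀ i → 1 ≤ f i) → 1 ≤ ∏ f n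
  ∏-pos zero    1≤f = ≤-refl
  ∏-pos (suc n) 1≤f = *-mono-≤ (∏-pos n 1≤f) (1≤f n)

  ∏-single : ∀ {f : ℕ → ℕ} n i₀ → i₀ < n → (∀ i → i ≢ i₀ → f i ≡ 1) → ∏ f n ≡ f i₀
  ∏-single {f} (suc n) i₀ (s≤s i₀≤n) f≡1 with i₀ ≟ n
  ... | yes refl = trans (cong (_* f n) (∏-1 n (λ i i<n → f≡1 i (<⇒≢ i<n)))) (*-identityˡ (f n))
  ... | no  i₀≢n = trans (cong₂ _*_ (∏-single n i₀ (≤∧≢⇒< i₀≤n i₀≢n) f≡1) (f≡1 n (λ n≡i₀ → i₀≢n (sym n≡i₀)))) (*-identityʳ (f i₀))

  prime∣prime⇒≡ : ∀ {p r} → Prime p → Prime r → p ∣ r → p ≡ r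
  prime∣prime⇒≡ pp pr p∣r with prime⇒irreducible pr p∣r
  ... | inj₁ refl = contradiction pp ¬prime[1]
  ... | inj₂ p≡r  = p≡r

  prime∣^⇒∣ : ∀ {p} m e → Prime p → p ∣ m ^ e → p ∣ m
  prime∣^⇒∣ m zero    pp p∣1 with refl ← ∣1⇒≡1 p∣1 = contradiction pp ¬prime[1]
  prime∣^⇒∣ m (suc e) pp p∣ with euclidsLemma m (m ^ e) pp p∣
  ... | inj₁ p∣m   = p∣m
  ... | inj₂ p∣m^e = prime∣^⇒∣ m e pp p∣m^e

  prime∤⇒coprime : ∀ {p n} → Prime p → ¬ p ∣ n → Coprime p n
  prime∤⇒coprime pp p∤n {d} (d∣p , d∣n) with prime⇒irreducible pp d∣p
  ... | inj₁ d≡1  = d≡1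
  ... | inj₂ refl = contradiction d∣n p∤n

  PrimePower : ℕ → Set
  PrimePower d = ∃₂ λ p e → Prime p × d ≡ p ^ suc e

  private
    n<b^n : ∀ b → 2 ≤ b → ∀ n → n < b ^ n
    n<b^n b 2≤b zero    = s≤s z≤n
    n<b^n b 2≤b (suc n) = begin-strict
      suc n <⟨ +-mono-≤ (m^n>0 b {{>-nonZero (≤-trans (s≤s z≤n) 2≤b)}} n) (n<b^n b 2≤b n) ⟩
      b ^ n + b ^ n ≡⟨ cong (b ^ n +_) (+-identityʳ (b ^ n)) ⟨
      2 * b ^ n ≤⟨ *-monoˡ-≤ (b ^ n) 2≤b ⟩
      b ^ suc n ∎
      where open ≤-Reasoning

  primePower? : ∀ d → Dec (PrimePower d)
  primePower? d = map′ to from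
    (anyUpTo? (λ p → anyUpTo? (λ e → prime? p ×-dec (d ≟ p ^ suc e)) d) (suc d))
    where
    to : (∃ λ p → p < suc d × ∃ λ e → e < d × (Prime p × d ≡ p ^ suc e)) → PrimePower d
    to (p , _ , e , _ , prf) = p , e , prf
    from : PrimePower d → ∃ λ p → p < suc d × ∃ λ e → e < d × (Prime p × d ≡ p ^ suc e)
    from (p , e , pp , refl) = p , s≤s (m≤m*n p (p ^ e) {{m^n≢0 p e}}) , e
      , <-trans (n<1+n e) (n<b^n p (nonTrivial⇒n>1 p {{prime⇒nonTrivial pp}}) (suc e)) , pp , refl
      where instance _ = prime⇒nonZero pp

  -- exp of the von Mangoldt function.
  Λ : ℕ → ℕ
  Λ d with primePower? d
  ... | yes (p , _) = p
  ... | no _        = 1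

  Λ≥1 : ∀ d → 1 ≤ Λ d
  Λ≥1 d with primePower? d
  ... | yes (p , _ , pp , _) = >-nonZero⁻¹ p {{prime⇒nonZero pp}}
  ... | no _ = ≤-refl

  Λ-prime^ : ∀ {p} e → Prime p → Λ (p ^ suc e) ≡ p
  Λ-prime^ {p} e pp with primePower? (p ^ suc e)
  ... | no ¬ppow = contradiction (p , e , pp , refl) ¬ppow
  ... | yes (r , f , pr , eq) =
    prime∣prime⇒≡ pr pp (prime∣^⇒∣ p (suc e) pr (subst (r ∣_) (sym eq) (m∣m*n (r ^ f))))

  Λ-¬primePower : ∀ {d} → ¬ PrimePower d → Λ d ≡ 1
  Λ-¬primePower {d} ¬ppow with primePower? d
  ... | yes ppow = contradiction ppow ¬ppow
  ... | no _ = refl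

  exactPower : ∀ {p} → Prime p → ∀ m → 1 ≤ m → ∃ λ v → p ^ v ∣ m × ¬ p ^ suc v ∣ m
  exactPower {p} pp m 1≤m = go m 1≤m (<-wellFounded m)
    where
    instance
      _ = prime⇒nonZero pp
    go : ∀ m → 1 ≤ m → Acc _<_ m → ∃ λ v → p ^ v ∣ m × ¬ p ^ suc v ∣ m
    go m 1≤m (acc rs) with p ∣? m
    ... | no p∤m = 0 , 1∣ m , λ p^1∣m → p∤m (subst (_∣ m) (^-identityʳ p) p^1∣m)
    ... | yes (divides-refl q) with go q 1≤q (rs q<qp)
      where
      1≤q : 1 ≤ q
      1≤q = n≢0⇒n>0 (λ { refl → contradiction 1≤m λ () })
      q<qp : q < q * p
      q<qp = m<m*n q p {{>-nonZero 1≤q}} (nonTrivial⇒n>1 p {{prime⇒nonTrivial pp}})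
    ... | v , p^v∣q , p^1+v∤q = suc v , subst (p ^ suc v ∣_) (*-comm p q) (*-monoʳ-∣ p p^v∣q)
      , λ d → p^1+v∤q (*-cancelˡ-∣ p (subst (p ^ suc (suc v) ∣_) (*-comm q p) d))

  𝟙[_∣_] : ℕ → ℕ → ℕ
  𝟙[ d ∣ m ] with d ∣? m
  ... | yes _ = 1
  ... | no  _ = 0

  𝟙-yes : ∀ {d m} → d ∣ m → 𝟙[ d ∣ m ] ≡ 1
  𝟙-yes {d} {m} d∣m with d ∣? m
  ... | yes _ = refl
  ... | no d∤m = contradiction d∣m d∤m

  𝟙-no : ∀ {d m} → ¬ d ∣ m → 𝟙[ d ∣ m ] ≡ 0
  𝟙-no {d} {m} d∤m with d ∣? m
  ... | yes d∣m = contradiction d∣m d∤m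
  ... | no _ = refl

  private
    ^𝟙-yes : ∀ x {d m} → d ∣ m → x ^ 𝟙[ d ∣ m ] ≡ x
    ^𝟙-yes x d∣m = trans (cong (x ^_) (𝟙-yes d∣m)) (^-identityʳ x)

    ^𝟙-no : ∀ x {d m} → ¬ d ∣ m → x ^ 𝟙[ d ∣ m ] ≡ 1
    ^𝟙-no x d∤m = cong (x ^_) (𝟙-no d∤m)

    δ : ℕ → ℕ → ℕ → ℕ
    δ i₀ p i with i ≟ i₀
    ... | yes _ = p
    ... | no  _ = 1

    δ-yes : ∀ i₀ p → δ i₀ p i₀ ≡ p
    δ-yes i₀ p with i₀ ≟ i₀
    ... | yes _ = refl
    ... | no ne = contradiction refl ne

    δ-no : ∀ {i₀ p i} → i ≢ i₀ → δ i₀ p i ≡ 1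
    δ-no {i₀} {p} {i} ne with i ≟ i₀
    ... | yes eq = contradiction eq ne
    ... | no _ = refl

  -- Multiplying m by p adds exactly one prime power to its divisors, namely p ^ suc v.
  new-primePower : ∀ {p d m} → Prime p → ∀ v → p ^ v ∣ m → ¬ p ^ suc v ∣ m →
    d ∣ p * m → ¬ d ∣ m → PrimePower d → d ≡ p ^ suc v
  new-primePower {p} {d} {m} pp v p^v∣m p^1+v∤m d∣pm d∤m (r , e , pr , refl) with p ≟ r
  ... | no p≢r = contradiction (coprime-divisor (Coprimality.sym (prime∤⇒coprime pp p∤r^)) d∣pm) d∤m
    where
    p∤r^ : ¬ p ∣ r ^ suc e
    p∤r^ p∣ = p≢r (prime∣prime⇒≡ pp pr (prime∣^⇒∣ r (suc e) pp p∣))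
  ... | yes refl = cong (λ n → p ^ suc n) (≤-antisym e≤v v≤e)
    where
    instance _ = prime⇒nonZero pp
    p^-mono : ∀ {a b} → a ≤ b → p ^ a ∣ p ^ b
    p^-mono {a} {b} a≤b = divides (p ^ (b ∸ a))
      (trans (cong (p ^_) (sym (m∸n+n≡m a≤b))) (^-distribˡ-+-* p (b ∸ a) a))
    e≤v : e ≤ v
    e≤v = ≮⇒≥ λ v<e → p^1+v∤m (∣-trans (p^-mono v<e) (*-cancelˡ-∣ p d∣pm))
    v≤e : v ≤ e
    v≤e = ≮⇒≥ λ e<v → d∤m (∣-trans (p^-mono e<v) p^v∣m)

  -- The range `D` is independent of `m`, so that the products for `m` and `p * m` can be compared
  -- factor by factor.
  ∏Λ∣ : ℕ → ℕ → ℕ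
  ∏Λ∣ D m = ∏ (λ i → Λ (suc i) ^ 𝟙[ suc i ∣ m ]) D

  ∏Λ∣-*prime : ∀ {p} → Prime p → ∀ D m → 1 ≤ m → p * m ≤ D → ∏Λ∣ D (p * m) ≡ ∏Λ∣ D m * p
  ∏Λ∣-*prime {p} pp D m 1≤m pm≤D with exactPower pp m 1≤m
  ... | v , p^v∣m , p^1+v∤m = begin
    ∏Λ∣ D (p * m) ≡⟨ ∏-cong D (λ i _ → step i) ⟩
    ∏ (λ i → Λ (suc i) ^ 𝟙[ suc i ∣ m ] * δ i₀ p i) D ≡⟨ ∏-* _ (δ i₀ p) D ⟩
    ∏Λ∣ D m * ∏ (δ i₀ p) D ≡⟨ cong (∏Λ∣ D m *_) (∏-single D i₀ i₀<D (λ i → δ-no)) ⟩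
    ∏Λ∣ D m * δ i₀ p i₀ ≡⟨ cong (∏Λ∣ D m *_) (δ-yes i₀ p) ⟩
    ∏Λ∣ D m * p ∎
    where
    open ≡-Reasoning
    instance
      _ = prime⇒nonZero pp
      m≢0 = >-nonZero 1≤m
      pm≢0 = m*n≢0 p m
      p^≢0 = m^n≢0 p (suc v)
    i₀ = pred (p ^ suc v)
    si₀ : suc i₀ ≡ p ^ suc v
    si₀ = suc-pred (p ^ suc v)
    d₀∣pm : p ^ suc v ∣ p * m
    d₀∣pm = *-monoʳ-∣ p p^v∣m
    i₀<D : i₀ < D
    i₀<D = ≤-trans (≤-reflexive si₀) (≤-trans (∣⇒≤ d₀∣pm) pm≤D)
    step : ∀ i → Λ (suc i) ^ 𝟙[ suc i ∣ p * m ] ≡ Λ (suc i) ^ 𝟙[ suc i ∣ m ] * δ i₀ p i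
    step i with suc i ∣? m
    ... | yes d∣m = trans (^𝟙-yes (Λ (suc i)) (∣n⇒∣m*n p d∣m))
        (sym (trans (cong₂ _*_ (^-identityʳ (Λ (suc i))) (δ-no i≢i₀)) (*-identityʳ _)))
      where
      i≢i₀ : i ≢ i₀
      i≢i₀ refl = p^1+v∤m (subst (_∣ m) si₀ d∣m)
    ... | no d∤m with i ≟ i₀
    ... | yes refl = trans (^𝟙-yes (Λ (suc i)) (subst (_∣ p * m) (sym si₀) d₀∣pm))
        (trans (cong Λ si₀) (trans (Λ-prime^ v pp) (sym (+-identityʳ p))))
    ... | no i≢i₀ with suc i ∣? (p * m)
    ... | no _ = refl
    ... | yes d∣pm = trans (^-identityʳ _) (Λ-¬primePower λ ppow →
        i≢i₀ (suc-injective (trans (new-primePower pp v p^v∣m p^1+v∤m d∣pm d∤m ppow) (sym si₀))))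

  -- Exponential form of log m = Σ log Λ(d) over d ∣ m; the induction removes one prime factor at a
  -- time.
  ∏Λ∣≡ : ∀ D m → 1 ≤ m → m ≤ D → ∏Λ∣ D m ≡ m
  ∏Λ∣≡ D m 1≤m m≤D = go m 1≤m m≤D (<-wellFounded m)
    where
    primeFactor : ∀ m → 2 ≤ m → ∃ λ p → Prime p × p ∣ m
    primeFactor m 2≤m = fromList (factors) (factorsPrime) (isFactorisation)
      where
      open import Data.List.Base using (List; []; _∷_)
      open import Data.Nat.ListAction using (product)
      open import Data.List.Relation.Unary.All using (All; []; _∷_)
      open PrimeFactorisation (factorise m {{>-nonZero (≤-trans (s≤s z≤n) 2≤m)}})
      fromList : ∀ ps → All Prime ps → m ≡ product ps → ∃ λ p → Prime p × p ∣ m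
      fromList [] [] refl = contradiction 2≤m λ { (s≤s ()) }
      fromList (p ∷ ps) (pp ∷ _) eq = p , pp , subst (p ∣_) (sym eq) (m∣m*n (product ps))
    go : ∀ m → 1 ≤ m → m ≤ D → Acc _<_ m → ∏Λ∣ D m ≡ m
    go m 1≤m m≤D (acc rs) with 2 ≤? m
    ... | no m<2 with refl ← ≤-antisym 1≤m (≤-pred (≰⇒> m<2)) = ∏-1 D (λ { zero _ → trans (^-identityʳ (Λ 1)) Λ1 ; (suc i) _ → ^𝟙-no (Λ (suc (suc i))) {suc (suc i)} {1} λ d → contradiction (∣1⇒≡1 d) λ () })
      where
      Λ1 : Λ 1 ≡ 1
      Λ1 = Λ-¬primePower λ { (p , e , pp , eq) → contradiction (∣1⇒≡1 (subst (p ∣_) (sym eq) (m∣m*n (p ^ e)))) λ { refl → ¬prime[1] pp } }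
    ... | yes 2≤m with primeFactor m 2≤m
    ... | p , pp , divides q m≡q*p = subst (λ n → ∏Λ∣ D n ≡ n) (sym m≡pq) (trans (∏Λ∣-*prime pp D q 1≤q pq≤D)
          (trans (cong (_* p) (go q 1≤q (≤-trans (m≤n*m q p) pq≤D) (rs q<m))) (*-comm q p)))
      where
      instance _ = prime⇒nonZero pp
      m≡pq : m ≡ p * q
      m≡pq = trans m≡q*p (*-comm q p)
      pq≤D : p * q ≤ D
      pq≤D = subst (_≤ D) m≡pq m≤D
      1≤q : 1 ≤ q
      1≤q = n≢0⇒n>0 λ { refl → contradiction (subst (1 ≤_) m≡q*p 1≤m) λ () }
      q<m : q < m
      q<m = subst (q <_) (sym m≡q*p) (m<m*n q p {{>-nonZero 1≤q}} (nonTrivial⇒n>1 p {{prime⇒nonTrivial pp}}))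

  suc/ : ∀ n d .{{_ : NonZero d}} → suc n / d ≡ n / d + 𝟙[ d ∣ suc n ]
  suc/ n d with d ∣? suc n
  ... | yes (divides q sn≡qd) = trans (/-congˡ sn≡qd) (trans (m*n/n≡m q d) (sym n/d+1≡q))
    where
    q≡sq' : q ≡ suc (pred q)
    q≡sq' = sym (suc-pred q {{≢-nonZero λ { refl → contradiction sn≡qd λ () }}})
    n≡ : n ≡ pred d + pred q * d
    n≡ = suc-injective (trans sn≡qd (trans (cong (_* d) q≡sq') (cong (_+ pred q * d) (sym (suc-pred d)))))
    n/d+1≡q : n / d + 1 ≡ q
    n/d+1≡q = trans (cong (_+ 1) (trans (/-congˡ n≡) (trans (+-distrib-/-∣ʳ (pred d) (n∣m*n (pred q)))
      (cong₂ _+_ (m<n⇒m/n≡0 (≤-reflexive (suc-pred d))) (m*n/n≡m (pred q) d))))) (trans (+-comm _ 1) (sym q≡sq'))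
  ... | no d∤sn = trans (trans (/-congˡ (cong suc (m≡m%n+[m/n]*n n d))) (trans (+-distrib-/-∣ʳ (suc (n % d)) (n∣m*n (n / d)))
        (cong₂ _+_ (m<n⇒m/n≡0 sr<d) (m*n/n≡m (n / d) d)))) (sym (+-identityʳ _))
    where
    sr<d : suc (n % d) < d
    sr<d = ≤∧≢⇒< (m%n<n n d) λ eq → d∤sn (divides (suc (n / d)) (trans (cong suc (m≡m%n+[m/n]*n n d)) (cong (_+ n / d * d) eq)))

  -- Legendre's formula, written without primes.
  !-∏Λ : ∀ n D → n ≤ D → n ! ≡ ∏ (λ i → Λ (suc i) ^ (n / suc i)) D
  !-∏Λ zero D _ = sym (∏-1 D (λ i _ → cong (Λ (suc i) ^_) (0/n≡0 (suc i))))
  !-∏Λ (suc n) D n<D = begin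
    suc n * n ! ≡⟨ *-comm (suc n) (n !) ⟩
    n ! * suc n ≡⟨ cong₂ _*_ (!-∏Λ n D (<⇒≤ n<D)) (sym (∏Λ∣≡ D (suc n) (s≤s z≤n) n<D)) ⟩
    ∏ (λ i → Λ (suc i) ^ (n / suc i)) D * ∏Λ∣ D (suc n) ≡⟨ ∏-* _ _ D ⟨
    ∏ (λ i → Λ (suc i) ^ (n / suc i) * Λ (suc i) ^ 𝟙[ suc i ∣ suc n ]) D
      ≡⟨ ∏-cong D (λ i _ → trans (sym (^-distribˡ-+-* (Λ (suc i)) (n / suc i) _)) (cong (Λ (suc i) ^_) (sym (suc/ n (suc i))))) ⟩
    ∏ (λ i → Λ (suc i) ^ (suc n / suc i)) D ∎
    where open ≡-Reasoning

-- A common divisor of products of two binomial coefficients.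

module CommonFactor where

  open Prelude
  open import Data.Nat.Divisibility
  open import Data.Nat.Combinatorics using (_C_; nCk≡n!/k![n-k]!; k![n∸k]!∣n!)
  open VonMangoldt

  C-! : ∀ a b → ((a + b) C a) * (a ! * b !) ≡ (a + b) !
  C-! a b = trans (cong (_* (a ! * b !)) (trans (nCk≡n!/k![n-k]! (m≤m+n a b)) (/-congʳ {{nz}} {{a !* b !≢0}} (cong (λ z → a ! * z !) (m+n∸m≡n a b)))))
    (m/n*n≡m {{a !* b !≢0}} (subst (λ z → a ! * z ! ∣ (a + b) !) (m+n∸m≡n a b) (k![n∸k]!∣n! (m≤m+n a b))))
    where instance nz = a !* (a + b ∸ a) !≢0

  /-superadd : ∀ a b d .{{_ : NonZero d}} → a / d + b / d ≤ (a + b) / d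
  /-superadd a b d = begin
    a / d + b / d ≡⟨ m*n/n≡m (a / d + b / d) d ⟨
    (a / d + b / d) * d / d ≤⟨ /-monoˡ-≤ d (≤-trans (≤-reflexive (*-distribʳ-+ d (a / d) (b / d))) (+-mono-≤ (m/n*n≤m a d) (m/n*n≤m b d))) ⟩
    (a + b) / d ∎
    where open ≤-Reasoning

  m<suc[m/n]*n : ∀ m n .{{_ : NonZero n}} → m < suc (m / n) * n
  m<suc[m/n]*n m n = subst (_< suc (m / n) * n) (sym (m≡m%n+[m/n]*n m n)) (+-monoˡ-< (m / n * n) (m%n<n m n))

  /-subadd : ∀ a b d .{{_ : NonZero d}} → (a + b) / d ≤ suc (a / d + b / d)
  /-subadd a b d = ≤-pred (m<n*o⇒m/o<n {a + b} {2+ (a / d + b / d)} (begin-strict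
    a + b ≤⟨ +-monoʳ-≤ a (<⇒≤ (m<suc[m/n]*n b d)) ⟩
    a + suc (b / d) * d <⟨ +-monoˡ-< (suc (b / d) * d) (m<suc[m/n]*n a d) ⟩
    suc (a / d) * d + suc (b / d) * d    ≡⟨ lem (a / d) (b / d) d ⟩
    2+ (a / d + b / d) * d ∎))
    where
    open ≤-Reasoning
    lem : ∀ x y d → suc x * d + suc y * d ≡ 2+ (x + y) * d
    lem = solve-∀

  -- The carries in (n + N + e)! / (n! N! e!) beyond the first one (truncated subtraction).
  carries : ℕ → ℕ → ℕ → (d : ℕ) .{{_ : NonZero d}} → ℕ
  carries n N e d = (n + N + e) / d ∸ suc (n / d + N / d + e / d)

  commonFactor : ℕ → ℕ → ℕ → ℕ
  commonFactor n N e = ∏ (λ i → Λ (suc i) ^ carries n N e (suc i)) (n + N + e)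

  m+[n∸o]≤p : ∀ m n o {p} → m ≤ p → m + n ≤ p + o → m + (n ∸ o) ≤ p
  m+[n∸o]≤p m n o {p} m≤p m+n≤p+o with ≤-total n o
  ... | inj₁ n≤o = subst (_≤ p) (trans (sym (+-identityʳ m)) (cong (m +_) (sym (m≤n⇒m∸n≡0 n≤o)))) m≤p
  ... | inj₂ o≤n = +-cancelʳ-≤ o (m + (n ∸ o)) p (subst (_≤ p + o) (trans (cong (m +_) (sym (m∸n+n≡m o≤n))) (sym (+-assoc m (n ∸ o) o))) m+n≤p+o)

  -- With n = J + l and M = n + N + e the product equals M! / (n! N! e!) times C(n, J), divided by
  -- C(N + l + e, e). At each modulus the last binomial coefficient has at most one carry, so all
  -- carries of the multinomial coefficient but one survive. The truncated subtraction in `carries`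
  -- splits the estimate: without a second carry only the integrality of both binomial coefficients
  -- is used.
  commonFactor∣ : ∀ J l N e → commonFactor (J + l) N e ∣ ((J + l + N + e) C J) * ((N + l) C N)
  commonFactor∣ J l N e = *-cancelʳ-∣ R {{R≢0}} (subst₂ _∣_ lhs rhs (∏-∣ M (λ i →
      subst (_∣ Λ (suc i) ^ (M / suc i + (N + l) / suc i)) (^-distribˡ-+-* (Λ (suc i)) (carries (J + l) N e (suc i)) (S (suc i))) (^-mono-∣ (Λ (suc i)) (floors (suc i))))))
    where
    M = J + l + N + e
    R = J ! * (l + N + e) ! * (N ! * l !)
    R≢0 : NonZero R
    R≢0 = m*n≢0 _ _ {{J !* (l + N + e) !≢0}} {{N !* l !≢0}}
    fl : ℕ → ℕ → ℕ
    fl x i = x / suc i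
    S : (d : ℕ) .{{_ : NonZero d}} → ℕ
    S d = J / d + (l + N + e) / d + (N / d + l / d)
    ^-mono-∣ : ∀ x {a b} → a ≤ b → x ^ a ∣ x ^ b
    ^-mono-∣ x {a} {b} a≤b = divides (x ^ (b ∸ a))
      (trans (cong (x ^_) (sym (m∸n+n≡m a≤b))) (^-distribˡ-+-* x (b ∸ a) a))
    floors : ∀ d .{{_ : NonZero d}} → carries (J + l) N e d + S d ≤ M / d + (N + l) / d
    floors d = ≤-trans (≤-reflexive (+-comm (carries (J + l) N e d) (S d)))
      (m+[n∸o]≤p (S d) (M / d) _ (+-mono-≤ J+rest (/-superadd N l d)) big)
      where
      M≡ : J + (l + N + e) ≡ M
      M≡ = solve-eq J l N e
        where
        solve-eq : ∀ J l N e → J + (l + N + e) ≡ J + l + N + e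
        solve-eq = solve-∀
      J+rest : J / d + (l + N + e) / d ≤ M / d
      J+rest = ≤-trans (/-superadd J (l + N + e) d) (≤-reflexive (/-congˡ M≡))
      open ≤-Reasoning
      big : S d + M / d ≤ M / d + (N + l) / d + suc ((J + l) / d + N / d + e / d)
      big = begin
        J / d + (l + N + e) / d + (N / d + l / d) + M / d  ≡⟨ e1 (J / d) ((l + N + e) / d) (N / d) (l / d) (M / d) ⟩
        J / d + l / d + (l + N + e) / d + (N / d + M / d)  ≤⟨ +-monoˡ-≤ (N / d + M / d) (+-mono-≤ (/-superadd J l d)
            (≤-trans (/-subadd (l + N) e d) (s≤s (≤-reflexive (cong (_+ e / d) (/-congˡ (+-comm l N))))))) ⟩
        (J + l) / d + suc ((N + l) / d + e / d) + (N / d + M / d) ≡⟨ e2 ((J + l) / d) ((N + l) / d) (e / d) (N / d) (M / d) ⟩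
        M / d + (N + l) / d + suc ((J + l) / d + N / d + e / d) ∎
        where
        e1 : ∀ j r n l m → j + r + (n + l) + m ≡ j + l + r + (n + m)
        e1 = solve-∀
        e2 : ∀ j n e N m → j + suc (n + e) + (N + m) ≡ m + n + suc (j + N + e)
        e2 = solve-∀
    le : ∀ x → x ≤ M → x ! ≡ ∏ (λ i → Λ (suc i) ^ (x / suc i)) M
    le x = !-∏Λ x M
    J≤M : J ≤ M
    J≤M = ≤-trans (m≤m+n J (l + N + e)) (≤-reflexive (trans (sym (+-assoc J (l + N) e)) (cong (_+ e) (sym (+-assoc J l N)))))
    r≤M : l + N + e ≤ M
    r≤M = +-monoˡ-≤ e (+-monoˡ-≤ N (m≤n+m l J))
    N+l≤M : N + l ≤ M
    N+l≤M = ≤-trans (≤-reflexive (+-comm N l)) (≤-trans (m≤m+n (l + N) e) r≤M)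
    merge : ∀ (f g : ℕ → ℕ) → ∏ (λ i → Λ (suc i) ^ f i) M * ∏ (λ i → Λ (suc i) ^ g i) M ≡ ∏ (λ i → Λ (suc i) ^ (f i + g i)) M
    merge f g = trans (sym (∏-* _ _ M)) (∏-cong M (λ i _ → sym (^-distribˡ-+-* (Λ (suc i)) (f i) (g i))))
    R≡ : R ≡ ∏ (λ i → Λ (suc i) ^ S (suc i)) M
    R≡ = trans (cong₂ _*_ (trans (cong₂ _*_ (le J J≤M) (le (l + N + e) r≤M)) (merge (fl J) (fl (l + N + e))))
                          (trans (cong₂ _*_ (le N (≤-trans (m≤m+n N l) N+l≤M)) (le l (≤-trans (m≤n+m l N) N+l≤M))) (merge (fl N) (fl l))))
      (merge (λ i → fl J i + fl (l + N + e) i) (λ i → fl N i + fl l i))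
    lhs : ∏ (λ i → Λ (suc i) ^ carries (J + l) N e (suc i) * Λ (suc i) ^ S (suc i)) M ≡ commonFactor (J + l) N e * R
    lhs = trans (∏-* _ _ M) (cong (commonFactor (J + l) N e *_) (sym R≡))
    rhs : ∏ (λ i → Λ (suc i) ^ (M / suc i + (N + l) / suc i)) M ≡ (M C J) * ((N + l) C N) * R
    rhs = begin
      ∏ (λ i → Λ (suc i) ^ (M / suc i + (N + l) / suc i)) M ≡⟨ merge (fl M) (fl (N + l)) ⟨
      _ ≡⟨ cong₂ _*_ (le M ≤-refl) (le (N + l) N+l≤M) ⟨
      M ! * (N + l) ! ≡⟨ cong₂ _*_ (subst (λ z → (z C J) * (J ! * (l + N + e) !) ≡ z !) Meq (C-! J (l + N + e))) (C-! N l) ⟨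
      (M C J) * (J ! * (l + N + e) !) * (((N + l) C N) * (N ! * l !)) ≡⟨ *-interchange (M C J) _ _ _ ⟩
      (M C J) * ((N + l) C N) * R ∎
      where
      open ≡-Reasoning
      Meq : J + (l + N + e) ≡ M
      Meq = trans (sym (+-assoc J (l + N) e)) (cong (_+ e) (sym (+-assoc J l N)))

-- Coefficients of power series and the sum of three residues.

module ResidueIdentity where

  open Prelude
  open import Data.Nat.Combinatorics using (_C_; nCk+nC[k+1]≡[n+1]C[k+1]; nCk≡nC[n∸k]; nCn≡1; k>n⇒nCk≡0)
  import Data.Nat.Tactic.RingSolver as ℕR
  open import Data.Integer.Base using (ℤ; -_; 0ℤ; 1ℤ; -1ℤ) renaming (_+_ to _⊕_; _*_ to _⊗_; _^_ to _↑_)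
  import Data.Integer.Properties as ℤ
  open import Data.Integer.Divisibility.Signed using (_∣_; ∣m∣n⇒∣m+n; ∣m⇒∣m*n)
  import Data.Integer.Tactic.RingSolver as ℤR
  open import Function.Base using (_∘_)

  module _ where
    open import Data.Integer.Base using (+_)
    open ≡-Reasoning

    -- The coefficient of uⁿ in (Σ fⱼ uʲ) / (1 - c u)^α.
    T : ℤ → (ℕ → ℤ) → ℕ → ℕ → ℤ
    T c f zero    n       = f n
    T c f (suc α) zero    = T c f α zero
    T c f (suc α) (suc n) = T c f α (suc n) ⊕ c ⊗ T c f (suc α) n

    Tℕ : ℕ → (ℕ → ℕ) → ℕ → ℕ → ℕ
    Tℕ c f zero    n       = f n
    Tℕ c f (suc α) zero    = Tℕ c f α zero
    Tℕ c f (suc α) (suc n) = Tℕ c f α (suc n) + c * Tℕ c f (suc α) n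

    T-+ : ∀ c f α n → T (+ c) (+_ ∘ f) α n ≡ + Tℕ c f α n
    T-+ c f zero    n       = refl
    T-+ c f (suc α) zero    = T-+ c f α zero
    T-+ c f (suc α) (suc n) = begin
      T (+ c) (+_ ∘ f) α (suc n) ⊕ + c ⊗ T (+ c) (+_ ∘ f) (suc α) n ≡⟨ cong₂ (λ x y → x ⊕ + c ⊗ y) (T-+ c f α (suc n)) (T-+ c f (suc α) n) ⟩
      + Tℕ c f α (suc n) ⊕ + c ⊗ + Tℕ c f (suc α) n ≡⟨ cong (_⊕_ (+ Tℕ c f α (suc n))) (sym (ℤ.pos-* c _)) ⟩
      + Tℕ c f (suc α) (suc n) ∎

    conv : (ℕ → ℤ) → (ℕ → ℤ) → ℕ → ℤ
    conv f g zero    = f 0 ⊗ g 0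
    conv f g (suc n) = f 0 ⊗ g (suc n) ⊕ conv (f ∘ suc) g n

    conv-rec₀ : ∀ f {g h : ℕ → ℤ} → g 0 ≡ h 0 → conv f g 0 ≡ conv f h 0
    conv-rec₀ f = cong (f 0 ⊗_)

    conv-rec : ∀ c f {g h : ℕ → ℤ} → g 0 ≡ h 0 → (∀ l → g (suc l) ≡ h (suc l) ⊕ c ⊗ g l) →
      ∀ n → conv f g (suc n) ≡ conv f h (suc n) ⊕ c ⊗ conv f g n
    conv-rec c f {g} {h} g0 gs zero = begin
      f 0 ⊗ g 1 ⊕ f 1 ⊗ g 0 ≡⟨ cong₂ (λ x y → f 0 ⊗ x ⊕ f 1 ⊗ y) (gs 0) g0 ⟩
      f 0 ⊗ (h 1 ⊕ c ⊗ g 0) ⊕ f 1 ⊗ h 0 ≡⟨ lem (f 0) (h 1) c (g 0) (f 1 ⊗ h 0) ⟩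
      f 0 ⊗ h 1 ⊕ f 1 ⊗ h 0 ⊕ c ⊗ (f 0 ⊗ g 0) ∎
      where
      lem : ∀ f h c g r → f ⊗ (h ⊕ c ⊗ g) ⊕ r ≡ f ⊗ h ⊕ r ⊕ c ⊗ (f ⊗ g)
      lem = ℤR.solve-∀
    conv-rec c f {g} {h} g0 gs (suc n) = begin
      f 0 ⊗ g (suc (suc n)) ⊕ conv (f ∘ suc) g (suc n)
        ≡⟨ cong₂ (λ x y → f 0 ⊗ x ⊕ y) (gs (suc n)) (conv-rec c (f ∘ suc) g0 gs n) ⟩
      f 0 ⊗ (h (suc (suc n)) ⊕ c ⊗ g (suc n)) ⊕ (conv (f ∘ suc) h (suc n) ⊕ c ⊗ conv (f ∘ suc) g n)
        ≡⟨ lem (f 0) (h (suc (suc n))) c (g (suc n)) (conv (f ∘ suc) h (suc n)) (conv (f ∘ suc) g n) ⟩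
      conv f h (suc (suc n)) ⊕ c ⊗ conv f g (suc n) ∎
      where
      lem : ∀ f h c g x y → f ⊗ (h ⊕ c ⊗ g) ⊕ (x ⊕ c ⊗ y) ≡ f ⊗ h ⊕ x ⊕ c ⊗ (f ⊗ g ⊕ y)
      lem = ℤR.solve-∀

    conv-∣ : ∀ {k} f g n → (∀ J l → J + l ≡ n → k ∣ f J ⊗ g l) → k ∣ conv f g n
    conv-∣ f g zero    k∣ = k∣ 0 0 refl
    conv-∣ f g (suc n) k∣ = ∣m∣n⇒∣m+n (k∣ 0 (suc n) refl) (conv-∣ (f ∘ suc) g n (λ J l eq → k∣ (suc J) l (cong suc eq)))

    private
      δ₀ : ℕ → ℤ
      δ₀ zero    = 1ℤ
      δ₀ (suc _) = 0ℤ

      conv-δ₀ : ∀ f n → conv f δ₀ n ≡ f n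
      conv-δ₀ f zero    = ℤ.*-identityʳ (f 0)
      conv-δ₀ f (suc n) = trans (cong₂ _⊕_ (ℤ.*-zeroʳ (f 0)) (conv-δ₀ (f ∘ suc) n)) (ℤ.+-identityˡ (f (suc n)))

    -- The binomial series of 1 / (1 - c u)^(N + 1). It writes the coefficients as sums of the
    -- products of two binomial coefficients that `commonFactor` divides.
    T-conv : ∀ c f N n → T c f (suc N) n ≡ conv f (λ l → + ((N + l) C N) ⊗ c ↑ l) n
    T-conv c f zero n = go n
      where
      g : ℕ → ℤ
      g l = + (l C 0) ⊗ c ↑ l
      gs : ∀ l → g (suc l) ≡ δ₀ (suc l) ⊕ c ⊗ g l
      gs l = lem c (c ↑ l)
        where
        lem : ∀ c x → + 1 ⊗ (c ⊗ x) ≡ + 0 ⊕ c ⊗ (+ 1 ⊗ x)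
        lem = ℤR.solve-∀
      go : ∀ n → T c f 1 n ≡ conv f g n
      go zero    = sym (trans (conv-rec₀ f {g} {δ₀} refl) (conv-δ₀ f 0))
      go (suc n) = sym (trans (conv-rec c f {g} {δ₀} refl gs n) (cong₂ (λ x y → x ⊕ c ⊗ y) (conv-δ₀ f (suc n)) (sym (go n))))
    T-conv c f (suc N) n = go n
      where
      g h : ℕ → ℤ
      g l = + ((suc N + l) C suc N) ⊗ c ↑ l
      h l = + ((N + l) C N) ⊗ c ↑ l
      g0 : g 0 ≡ h 0
      g0 = cong (λ z → + z ⊗ 1ℤ) (trans (cong (_C suc N) (+-identityʳ (suc N))) (trans (nCn≡1 (suc N))
           (sym (trans (cong (_C N) (+-identityʳ N)) (nCn≡1 N)))))
      gs : ∀ l → g (suc l) ≡ h (suc l) ⊕ c ⊗ g l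
      gs l = begin
        + (suc (N + suc l) C suc N) ⊗ (c ⊗ c ↑ l)
          ≡⟨ cong (λ z → + z ⊗ (c ⊗ c ↑ l)) (sym (nCk+nC[k+1]≡[n+1]C[k+1] (N + suc l) N)) ⟩
        (+ ((N + suc l) C N) ⊕ + ((N + suc l) C suc N)) ⊗ (c ⊗ c ↑ l)
          ≡⟨ cong (λ z → (+ ((N + suc l) C N) ⊕ + (z C suc N)) ⊗ (c ⊗ c ↑ l)) (+-suc N l) ⟩
        (+ ((N + suc l) C N) ⊕ + (suc (N + l) C suc N)) ⊗ (c ⊗ c ↑ l)
          ≡⟨ lem (+ ((N + suc l) C N)) (+ (suc (N + l) C suc N)) c (c ↑ l) ⟩
        h (suc l) ⊕ c ⊗ g l ∎
        where
        lem : ∀ a b c x → (a ⊕ b) ⊗ (c ⊗ x) ≡ a ⊗ (c ⊗ x) ⊕ c ⊗ (b ⊗ x)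
        lem = ℤR.solve-∀
      go : ∀ n → T c f (suc (suc N)) n ≡ conv f g n
      go zero    = trans (T-conv c f N 0) (sym (conv-rec₀ f {g} {h} g0))
      go (suc n) = trans (cong₂ (λ x y → x ⊕ c ⊗ y) (T-conv c f N (suc n)) (go n)) (sym (conv-rec c f {g} {h} g0 gs n))

    T-∣ : ∀ {k} c f N n → (∀ J l → J + l ≡ n → k ∣ f J ⊗ + ((N + l) C N)) → k ∣ T c f (suc N) n
    T-∣ {k} c f N n k∣ = subst (k ∣_) (sym (T-conv c f N n)) (conv-∣ f _ n (λ J l eq →
      subst (k ∣_) (ℤ.*-assoc (f J) (+ ((N + l) C N)) (c ↑ l)) (∣m⇒∣m*n (c ↑ l) (k∣ J l eq))))

  -- Termwise form of Σ fⱼ uʲ ≤ K with u = a / b, e / b = 1 - c u.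
  Tℕ-upper : ∀ c f a b e Z K → e + c * a ≡ b → (∀ j → f j * a ^ j * Z ≤ K * b ^ j) →
    ∀ α n → Tℕ c f α n * a ^ n * e ^ α * Z ≤ K * b ^ (n + α)
  Tℕ-upper c f a b e Z K eq bd zero n = begin
    f n * a ^ n * 1 * Z ≡⟨ cong (_* Z) (*-identityʳ (f n * a ^ n)) ⟩
    f n * a ^ n * Z ≤⟨ bd n ⟩
    K * b ^ n ≡⟨ cong (λ z → K * b ^ z) (+-identityʳ n) ⟨
    K * b ^ (n + 0) ∎
    where open ≤-Reasoning
  Tℕ-upper c f a b e Z K eq bd (suc α) zero = begin
    Tℕ c f α 0 * 1 * (e * e ^ α) * Z ≡⟨ l1 (Tℕ c f α 0) e (e ^ α) Z ⟩
    e * (Tℕ c f α 0 * 1 * e ^ α * Z) ≤⟨ *-mono-≤ (subst (e ≤_) eq (m≤m+n e (c * a))) (Tℕ-upper c f a b e Z K eq bd α 0) ⟩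
    b * (K * b ^ α) ≡⟨ l2 b K (b ^ α) ⟩
    K * (b * b ^ α) ∎
    where
    open ≤-Reasoning
    l1 : ∀ T e x Z → T * 1 * (e * x) * Z ≡ e * (T * 1 * x * Z)
    l1 = ℕR.solve-∀
    l2 : ∀ b K x → b * (K * x) ≡ K * (b * x)
    l2 = ℕR.solve-∀
  Tℕ-upper c f a b e Z K eq bd (suc α) (suc n) = begin
    (Tℕ c f α (suc n) + c * Tℕ c f (suc α) n) * (a * a ^ n) * (e * e ^ α) * Z
      ≡⟨ l1 (Tℕ c f α (suc n)) c (Tℕ c f (suc α) n) a (a ^ n) e (e ^ α) Z ⟩
    e * (Tℕ c f α (suc n) * (a * a ^ n) * e ^ α * Z) + c * a * (Tℕ c f (suc α) n * a ^ n * (e * e ^ α) * Z)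
      ≤⟨ +-mono-≤ (*-monoʳ-≤ e (Tℕ-upper c f a b e Z K eq bd α (suc n))) (*-monoʳ-≤ (c * a) (Tℕ-upper c f a b e Z K eq bd (suc α) n)) ⟩
    e * (K * b ^ (suc n + α)) + c * a * (K * b ^ (n + suc α))
      ≡⟨ cong (λ z → e * (K * b ^ z) + c * a * (K * b ^ (n + suc α))) (sym (+-suc n α)) ⟩
    e * (K * b ^ (n + suc α)) + c * a * (K * b ^ (n + suc α))
      ≡⟨ *-distribʳ-+ (K * b ^ (n + suc α)) e (c * a) ⟨
    (e + c * a) * (K * b ^ (n + suc α))
      ≡⟨ cong (_* (K * b ^ (n + suc α))) eq ⟩
    b * (K * b ^ (n + suc α)) ≡⟨ l2 b K (b ^ (n + suc α)) ⟩
    K * (b * b ^ (n + suc α)) ∎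
    where
    open ≤-Reasoning
    l1 : ∀ T c S a x e y Z → (T + c * S) * (a * x) * (e * y) * Z ≡ e * (T * (a * x) * y * Z) + c * a * (S * x * (e * y) * Z)
    l1 = ℕR.solve-∀
    l2 : ∀ b K x → b * (K * x) ≡ K * (b * x)
    l2 = ℕR.solve-∀

  Tℕ-lower₀ : ∀ c f α n → f n ≤ Tℕ c f α n
  Tℕ-lower₀ c f zero    n       = ≤-refl
  Tℕ-lower₀ c f (suc α) zero    = Tℕ-lower₀ c f α zero
  Tℕ-lower₀ c f (suc α) (suc n) = ≤-trans (Tℕ-lower₀ c f α (suc n)) (m≤m+n _ _)

  -- A single term of the Cauchy product with 1 / (1 - u)^(N + 1), whose terms are all nonnegative.
  Tℕ-lower : ∀ f N J l → f J * ((N + l) C N) ≤ Tℕ 1 f (suc N) (l + J)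
  Tℕ-lower f N J zero = ≤-trans (≤-reflexive (trans (cong (f J *_) (trans (cong (_C N) (+-identityʳ N)) (nCn≡1 N))) (*-identityʳ (f J)))) (Tℕ-lower₀ 1 f (suc N) J)
  Tℕ-lower f zero J (suc l) = ≤-trans (Tℕ-lower f zero J l) (≤-trans (≤-reflexive (sym (+-identityʳ _))) (m≤n+m _ (f (suc l + J))))
  Tℕ-lower f (suc N) J (suc l) = begin
    f J * (suc (N + suc l) C suc N) ≡⟨ cong (f J *_) (nCk+nC[k+1]≡[n+1]C[k+1] (N + suc l) N) ⟨
    f J * (((N + suc l) C N) + ((N + suc l) C suc N)) ≡⟨ cong (λ z → f J * (((N + suc l) C N) + (z C suc N))) (+-suc N l) ⟩
    f J * (((N + suc l) C N) + (suc (N + l) C suc N)) ≡⟨ *-distribˡ-+ (f J) _ _ ⟩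
    f J * ((N + suc l) C N) + f J * (suc (N + l) C suc N) ≤⟨ +-mono-≤ (Tℕ-lower f N J (suc l)) (Tℕ-lower f (suc N) J l) ⟩
    Tℕ 1 f (suc N) (suc l + J) + Tℕ 1 f (suc (suc N)) (l + J) ≡⟨ cong (Tℕ 1 f (suc N) (suc l + J) +_) (*-identityˡ _) ⟨
    Tℕ 1 f (suc (suc N)) (suc l + J) ∎
    where open ≤-Reasoning

  binom₈ : ℕ → ℕ → ℕ
  binom₈ M l = (M C l) * 8 ^ l

  binom₈-suc : ∀ M l → binom₈ (suc M) (suc l) ≡ binom₈ M (suc l) + 8 * binom₈ M l
  binom₈-suc M l = trans (cong (_* (8 * 8 ^ l)) (sym (nCk+nC[k+1]≡[n+1]C[k+1] M l))) (lem (M C l) (M C suc l) (8 ^ l))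
    where
    lem : ∀ a b x → (a + b) * (8 * x) ≡ b * (8 * x) + 8 * (a * x)
    lem = ℕR.solve-∀

  private
    T₈₀ : ∀ M α → Tℕ 1 (binom₈ M) α 0 ≡ 1
    T₈₀ M zero    = refl
    T₈₀ M (suc α) = T₈₀ M α

    -- Multiplication by 1 + 8u commutes with division by (1 - u)^α.
    T₈-suc : ∀ M α m → Tℕ 1 (binom₈ (suc M)) α (suc m) ≡ Tℕ 1 (binom₈ M) α (suc m) + 8 * Tℕ 1 (binom₈ M) α m
    T₈-suc M zero    m = binom₈-suc M m
    T₈-suc M (suc α) zero = trans (cong₂ (λ x y → x + 1 * y) (T₈-suc M α 0) (trans (T₈₀ (suc M) α) (sym (T₈₀ M α))))
      (lem (Tℕ 1 (binom₈ M) α 1) (Tℕ 1 (binom₈ M) α 0) )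
      where
      lem : ∀ x y → x + 8 * y + 1 * y ≡ x + 1 * y + 8 * y
      lem = ℕR.solve-∀
    T₈-suc M (suc α) (suc m) = trans (cong₂ (λ x y → x + 1 * y) (T₈-suc M α (suc m)) (T₈-suc M (suc α) m))
      (lem (Tℕ 1 (binom₈ M) α (suc (suc m))) (Tℕ 1 (binom₈ M) α (suc m)) (Tℕ 1 (binom₈ M) (suc α) (suc m)) (Tℕ 1 (binom₈ M) (suc α) m))
      where
      lem : ∀ x y z w → x + 8 * y + 1 * (z + 8 * w) ≡ x + 1 * z + 8 * (y + 1 * w)
      lem = ℕR.solve-∀

  -- 1 + 8u = (1 - u) + 9u.
  T₈-diagonal : ∀ M a m → a + m ≡ M → Tℕ 1 (binom₈ M) (suc a) m ≡ (M C a) * 9 ^ m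
  T₈-diagonal M a zero refl = trans (T₈₀ (a + 0) (suc a)) (sym (trans (*-identityʳ _) (trans (cong (_C a) (+-identityʳ a)) (nCn≡1 a))))
  T₈-diagonal (suc M) zero (suc m) refl = begin
    Tℕ 1 (binom₈ (suc M)) 1 (suc m) ≡⟨ T₈-suc M 1 m ⟩
    binom₈ M (suc m) + 1 * Tℕ 1 (binom₈ M) 1 m + 8 * Tℕ 1 (binom₈ M) 1 m
      ≡⟨ cong₂ (λ x y → x + 1 * y + 8 * y) (cong (_* 8 ^ suc m) (k>n⇒nCk≡0 (n<1+n m))) (T₈-diagonal M 0 m refl) ⟩
    0 * 8 ^ suc m + 1 * (1 * 9 ^ m) + 8 * (1 * 9 ^ m) ≡⟨ lem (8 ^ suc m) (9 ^ m) ⟩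
    1 * (9 * 9 ^ m) ∎
    where
    open ≡-Reasoning
    lem : ∀ y x → 0 * y + 1 * (1 * x) + 8 * (1 * x) ≡ 1 * (9 * x)
    lem = ℕR.solve-∀
  T₈-diagonal (suc M) (suc a) (suc m) eq = begin
    Tℕ 1 (binom₈ (suc M)) (suc (suc a)) (suc m) ≡⟨ T₈-suc M (suc (suc a)) m ⟩
    Tℕ 1 (binom₈ M) (suc a) (suc m) + 1 * Tℕ 1 (binom₈ M) (suc (suc a)) m + 8 * Tℕ 1 (binom₈ M) (suc (suc a)) m
      ≡⟨ cong₂ (λ x y → x + 1 * y + 8 * y) (T₈-diagonal M a (suc m) (suc-injective eq)) (T₈-diagonal M (suc a) m (trans (sym (+-suc a m)) (suc-injective eq))) ⟩
    (M C a) * (9 * 9 ^ m) + 1 * ((M C suc a) * 9 ^ m) + 8 * ((M C suc a) * 9 ^ m) ≡⟨ lem (M C a) (M C suc a) (9 ^ m) ⟩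
    ((M C a) + (M C suc a)) * (9 * 9 ^ m) ≡⟨ cong (_* 9 ^ suc m) (nCk+nC[k+1]≡[n+1]C[k+1] M a) ⟩
    (suc M C suc a) * 9 ^ suc m ∎
    where
    open ≡-Reasoning
    lem : ∀ a b x → a * (9 * x) + 1 * (b * x) + 8 * (b * x) ≡ (a + b) * (9 * x)
    lem = ℕR.solve-∀

  module _ where
    open import Data.Integer.Base using (+_)
    open ≡-Reasoning

    altC : ℕ → ℕ → ℤ
    altC M i = -1ℤ ↑ i ⊗ + (M C i)

    pos-^ : ∀ x k → + (x ^ k) ≡ (+ x) ↑ k
    pos-^ x zero    = refl
    pos-^ x (suc k) = trans (ℤ.pos-* x (x ^ k)) (cong (_⊗_ (+ x)) (pos-^ x k))

    module Residues (M : ℕ) where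
      -- `X` is the residue at 0. Near 1/8 the substitution 1 - 8u = 9w leads to (1 - w)^M / (1 -
      -- 9w)^β, whose coefficients are `Y`; near ∞ the substitution u = 1 / (8w) leads to (1 + 8w)^M
      -- / (1 - w)^α, whose coefficients are `W`. The powers of 8 and 9 that come off are the
      -- factors in `residues`. The value 0 at order 0 expresses that there is no pole.
      X Y : ℕ → ℕ → ℤ
      X α zero    = 0ℤ
      X α (suc b) = T (+ 8) (λ j → + (M C j)) α b
      Y zero    β = 0ℤ
      Y (suc a) β = T (+ 9) (altC M) β a

      W : ℕ → ℕ → ℤ
      W α m = + Tℕ 1 (binom₈ M) α m

      X-rec : ∀ α b → X (suc α) (suc b) ≡ X α (suc b) ⊕ + 8 ⊗ X (suc α) b
      X-rec α zero    = sym (ℤ.+-identityʳ _)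
      X-rec α (suc b) = refl

      Y-rec : ∀ a β → Y (suc a) (suc β) ≡ Y (suc a) β ⊕ + 9 ⊗ Y a (suc β)
      Y-rec zero    β = sym (ℤ.+-identityʳ _)
      Y-rec (suc a) β = refl

      W-rec : ∀ α m → W (suc α) (suc m) ≡ W α (suc m) ⊕ W (suc α) m
      W-rec α m = cong (λ z → + (Tℕ 1 (binom₈ M) α (suc m) + z)) (*-identityˡ _)

      -- The residues of (1 + u)^M / (u^β (1 - 8u)^α) at 0, 1/8 and ∞ add up to zero.
      residues : ∀ α β m → α + β + m ≡ suc M →
        (+ 8) ↑ (α + m) ⊗ X α β ≡ (+ 9) ↑ (β + m) ⊗ Y α β ⊕ -1ℤ ↑ α ⊗ W α m
      residues zero zero m refl = sym (begin
        (+ 9) ↑ m ⊗ 0ℤ ⊕ 1ℤ ⊗ + ((M C suc M) * 8 ^ suc M) ≡⟨ cong (λ z → (+ 9) ↑ m ⊗ 0ℤ ⊕ 1ℤ ⊗ + (z * 8 ^ suc M)) (k>n⇒nCk≡0 (n<1+n M)) ⟩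
        (+ 9) ↑ m ⊗ 0ℤ ⊕ 0ℤ ≡⟨ lem ((+ 9) ↑ m) ((+ 8) ↑ m) ⟩
        (+ 8) ↑ m ⊗ 0ℤ ∎)
        where
        lem : ∀ x y → x ⊗ + 0 ⊕ + 0 ≡ y ⊗ + 0
        lem = ℤR.solve-∀
      residues zero (suc b) m refl = sym (begin
        (+ 9) ↑ (suc b + m) ⊗ 0ℤ ⊕ 1ℤ ⊗ + ((M C m) * 8 ^ m)
          ≡⟨ cong (λ z → (+ 9) ↑ (suc b + m) ⊗ 0ℤ ⊕ 1ℤ ⊗ z) (trans (ℤ.pos-* (M C m) (8 ^ m)) (cong₂ (λ x y → + x ⊗ y) Cm (pos-^ 8 m))) ⟩
        (+ 9) ↑ (suc b + m) ⊗ 0ℤ ⊕ 1ℤ ⊗ (+ (M C b) ⊗ (+ 8) ↑ m)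
          ≡⟨ lem ((+ 9) ↑ (suc b + m)) (+ (M C b)) ((+ 8) ↑ m) ⟩
        (+ 8) ↑ m ⊗ + (M C b) ∎)
        where
        lem : ∀ x y z → x ⊗ + 0 ⊕ + 1 ⊗ (y ⊗ z) ≡ z ⊗ y
        lem = ℤR.solve-∀
        Cm : M C m ≡ M C b
        Cm = trans (nCk≡nC[n∸k] (m≤n+m m b)) (cong (M C_) (m+n∸n≡m b m))
      -- Without a pole at 0 the other two residues cancel, which is `T₈-diagonal`.
      residues (suc a) zero m eq = sym (begin
        (+ 9) ↑ m ⊗ (-1ℤ ↑ a ⊗ + (M C a)) ⊕ -1ℤ ⊗ -1ℤ ↑ a ⊗ W (suc a) m
          ≡⟨ cong (λ z → (+ 9) ↑ m ⊗ (-1ℤ ↑ a ⊗ + (M C a)) ⊕ -1ℤ ⊗ -1ℤ ↑ a ⊗ z)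
               (trans (cong +_ (T₈-diagonal M a m (trans (cong (_+ m) (sym (+-identityʳ a))) (suc-injective eq)))) (trans (ℤ.pos-* (M C a) (9 ^ m)) (cong (_⊗_ (+ (M C a))) (pos-^ 9 m)))) ⟩
        (+ 9) ↑ m ⊗ (-1ℤ ↑ a ⊗ + (M C a)) ⊕ -1ℤ ⊗ -1ℤ ↑ a ⊗ (+ (M C a) ⊗ (+ 9) ↑ m)
          ≡⟨ lem ((+ 9) ↑ m) (-1ℤ ↑ a) (+ (M C a)) ((+ 8) ↑ (suc a + m)) ⟩
        (+ 8) ↑ (suc a + m) ⊗ 0ℤ ∎)
        where
        lem : ∀ x s c y → x ⊗ (s ⊗ c) ⊕ - + 1 ⊗ s ⊗ (c ⊗ x) ≡ y ⊗ + 0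
        lem = ℤR.solve-∀
      -- The partition 1 = (1 - 8u) + 8u of the numerator lowers the order of one of the two poles
      -- and raises `m` by one; all three residues follow it.
      residues (suc a) (suc b) m eq = begin
        (+ 8) ↑ (suc a + m) ⊗ X (suc a) (suc b) ≡⟨ cong (_⊗_ ((+ 8) ↑ (suc a + m))) (X-rec a b) ⟩
        (+ 8) ↑ (suc a + m) ⊗ (X a (suc b) ⊕ + 8 ⊗ X (suc a) b)
          ≡⟨ l1 ((+ 8) ↑ (a + m)) (X a (suc b)) (X (suc a) b) ⟩
        (+ 8) ↑ suc (a + m) ⊗ X a (suc b) ⊕ (+ 8) ↑ suc (suc (a + m)) ⊗ X (suc a) b
          ≡⟨ cong (λ z → (+ 8) ↑ z ⊗ X a (suc b) ⊕ (+ 8) ↑ suc z ⊗ X (suc a) b) (sym (+-suc a m)) ⟩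
        (+ 8) ↑ (a + suc m) ⊗ X a (suc b) ⊕ (+ 8) ↑ (suc a + suc m) ⊗ X (suc a) b
          ≡⟨ cong₂ _⊕_ (residues a (suc b) (suc m) eq₁) (residues (suc a) b (suc m) eq₂) ⟩
        (+ 9) ↑ (suc b + suc m) ⊗ Y a (suc b) ⊕ -1ℤ ↑ a ⊗ W a (suc m) ⊕ ((+ 9) ↑ (b + suc m) ⊗ Y (suc a) b ⊕ -1ℤ ⊗ -1ℤ ↑ a ⊗ W (suc a) (suc m))
          ≡⟨ cong₂ (λ z w → (+ 9) ↑ suc z ⊗ Y a (suc b) ⊕ -1ℤ ↑ a ⊗ W a (suc m) ⊕ ((+ 9) ↑ z ⊗ Y (suc a) b ⊕ -1ℤ ⊗ -1ℤ ↑ a ⊗ w)) (+-suc b m) (W-rec a m) ⟩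
        (+ 9) ↑ suc (suc (b + m)) ⊗ Y a (suc b) ⊕ -1ℤ ↑ a ⊗ W a (suc m) ⊕ ((+ 9) ↑ suc (b + m) ⊗ Y (suc a) b ⊕ -1ℤ ⊗ -1ℤ ↑ a ⊗ (W a (suc m) ⊕ W (suc a) m))
          ≡⟨ l2 ((+ 9) ↑ suc (b + m)) (Y a (suc b)) (-1ℤ ↑ a) (W a (suc m)) (Y (suc a) b) (W (suc a) m) ⟩
        (+ 9) ↑ suc (b + m) ⊗ (Y (suc a) b ⊕ + 9 ⊗ Y a (suc b)) ⊕ -1ℤ ⊗ -1ℤ ↑ a ⊗ W (suc a) m
          ≡⟨ cong (λ z → (+ 9) ↑ suc (b + m) ⊗ z ⊕ -1ℤ ⊗ -1ℤ ↑ a ⊗ W (suc a) m) (Y-rec a b) ⟨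
        (+ 9) ↑ (suc b + m) ⊗ Y (suc a) (suc b) ⊕ -1ℤ ↑ suc a ⊗ W (suc a) m ∎
        where
        l1 : ∀ p x y → + 8 ⊗ p ⊗ (x ⊕ + 8 ⊗ y) ≡ + 8 ⊗ p ⊗ x ⊕ + 8 ⊗ (+ 8 ⊗ p) ⊗ y
        l1 = ℤR.solve-∀
        l2 : ∀ p y s w z v → + 9 ⊗ p ⊗ y ⊕ s ⊗ w ⊕ (p ⊗ z ⊕ - + 1 ⊗ s ⊗ (w ⊕ v)) ≡ p ⊗ (z ⊕ + 9 ⊗ y) ⊕ - + 1 ⊗ s ⊗ v
        l2 = ℤR.solve-∀
        eq₂ : suc a + b + suc m ≡ suc M
        eq₂ = trans (trans (+-suc (suc a + b) m) (cong (_+ m) (sym (+-suc (suc a) b)))) eq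
        eq₁ : a + suc b + suc m ≡ suc M
        eq₁ = trans (+-suc (a + suc b) m) eq

  open Residues public using (residues; X; Y)

-- The Padé identity and the lower bound for the remainder.

module Padé where

  open Prelude
  import Data.Nat.Divisibility as ℕ∣
  open import Data.Nat.Combinatorics using (_C_)
  import Data.Nat.Tactic.RingSolver as ℕR
  open import Data.Integer.Base using (ℤ; -_; 0ℤ; 1ℤ; -1ℤ; ∣_∣) renaming (_+_ to _⊕_; _*_ to _⊗_; _^_ to _↑_; _-_ to _⊖_)
  import Data.Integer.Properties as ℤ
  open import Data.Integer.Divisibility.Signed using (_∣_; divides; ∣n⇒∣m*n; ∣ᵤ⇒∣)
  import Data.Integer.Tactic.RingSolver as ℤR
  open import Function.Base using (_∘_)
  open VonMangoldt
  open CommonFactor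
  open ResidueIdentity hiding (Y)

  commonFactor-comm : ∀ n N e → commonFactor n N e ≡ commonFactor N n e
  commonFactor-comm n N e = trans (∏-cong (n + N + e) (λ i _ → cong (Λ (suc i) ^_) (cong₂ (λ x y → (x / suc i) ∸ suc (y + e / suc i)) (cong (_+ e) (+-comm n N)) (+-comm (n / suc i) (N / suc i)))))
    (cong (λ x → ∏ (λ i → Λ (suc i) ^ carries N n e (suc i)) (x + e)) (+-comm n N))

  -- The multipliers satisfy 3 (16 + 12) = 4 (9 + 12), so that 8^(28 t) = 4^(42 t) and 9^(21 t) =
  -- 3^(42 t) belong to the same k. The index `12 * t ∸ 1` is forced by α + β + m = M + 1 in
  -- `residues`, with α = 16 t + 1 and β = 9 t + 1.
  padéA padéV padéG : ℕ → ℕ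
  padéA t = Tℕ 8 ((9 * t + 16 * t + 12 * t) C_) (suc (16 * t)) (9 * t)
  padéV t = Tℕ 1 (binom₈ (9 * t + 16 * t + 12 * t)) (suc (16 * t)) (12 * t ∸ 1)
  padéG t = commonFactor (9 * t) (16 * t) (12 * t)

  module _ where
    open import Data.Integer.Base using (+_)

    -- Either the integer f P - h m A vanishes, or it is at least G in absolute value.
    remainder-dichotomy : ∀ {A V G n f P e h m r} → + G ∣ + A → + G ∣ P → e ⊗ + A ⊕ + V ≡ + n ⊗ P →
      r ≡ e ⊗ + f ⊖ + n ⊗ h ⊗ m → 2 * (f * V) ≤ n * G → f * V ≤ A * ∣ r ∣
    remainder-dichotomy {A} {V} {G} {n} {f} {P} {e} {h} {m} {r} (divides A′ A≡) (divides P′ P≡) id r≡ small = bound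
      where
      Y : ℤ
      Y = + f ⊗ P′ ⊖ h ⊗ m ⊗ A′
      key : + A ⊗ r ⊕ + f ⊗ + V ≡ + n ⊗ + G ⊗ Y
      key = begin
        + A ⊗ r ⊕ + f ⊗ + V ≡⟨ cong (λ x → + A ⊗ x ⊕ + f ⊗ + V) r≡ ⟩
        + A ⊗ (e ⊗ + f ⊖ + n ⊗ h ⊗ m) ⊕ + f ⊗ + V ≡⟨ l1 (+ A) e (+ f) (+ n) h m (+ V) ⟩
        + f ⊗ (e ⊗ + A ⊕ + V) ⊖ + n ⊗ h ⊗ m ⊗ + A ≡⟨ cong₂ (λ x y → + f ⊗ x ⊖ + n ⊗ h ⊗ m ⊗ y) (trans id (cong (_⊗_ (+ n)) P≡)) A≡ ⟩
        + f ⊗ (+ n ⊗ (P′ ⊗ + G)) ⊖ + n ⊗ h ⊗ m ⊗ (A′ ⊗ + G) ≡⟨ l2 (+ f) (+ n) P′ (+ G) h m A′ ⟩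
        + n ⊗ + G ⊗ Y ∎
        where
        open ≡-Reasoning
        l1 : ∀ A e f n h m V → A ⊗ (e ⊗ f ⊖ n ⊗ h ⊗ m) ⊕ f ⊗ V ≡ f ⊗ (e ⊗ A ⊕ V) ⊖ n ⊗ h ⊗ m ⊗ A
        l1 = ℤR.solve-∀
        l2 : ∀ f n P G h m A → f ⊗ (n ⊗ (P ⊗ G)) ⊖ n ⊗ h ⊗ m ⊗ (A ⊗ G) ≡ n ⊗ G ⊗ (f ⊗ P ⊖ h ⊗ m ⊗ A)
        l2 = ℤR.solve-∀
      bound : f * V ≤ A * ∣ r ∣
      bound with Y ℤ.≟ 0ℤ
      ... | yes Y≡0 = ≤-reflexive (begin
        f * V ≡⟨ ℤ.abs-* (+ f) (+ V) ⟨
        ∣ + f ⊗ + V ∣ ≡⟨ cong ∣_∣ (lem (+ A ⊗ r) (+ f ⊗ + V) (trans key (trans (cong (_⊗_ (+ n ⊗ + G)) Y≡0) (ℤ.*-zeroʳ (+ n ⊗ + G))))) ⟩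
        ∣ - (+ A ⊗ r) ∣ ≡⟨ ℤ.∣-i∣≡∣i∣ (+ A ⊗ r) ⟩
        ∣ + A ⊗ r ∣ ≡⟨ ℤ.abs-* (+ A) r ⟩
        A * ∣ r ∣ ∎)
        where
        open ≡-Reasoning
        lem : ∀ a b → a ⊕ b ≡ 0ℤ → b ≡ - a
        lem a b eq = trans (l a b) (trans (cong (_⊕ - a) eq) (ℤ.+-identityˡ (- a)))
          where
          l : ∀ a b → b ≡ a ⊕ b ⊕ - a
          l = ℤR.solve-∀
      ... | no Y≢0 = +-cancelʳ-≤ (f * V) _ _ (begin
        f * V + f * V ≡⟨ cong (_+_ (f * V)) (+-identityʳ (f * V)) ⟨
        2 * (f * V) ≤⟨ small ⟩
        n * G ≤⟨ m≤m*n (n * G) ∣ Y ∣ {{≢-nonZero (λ ∣Y∣≡0 → Y≢0 (ℤ.∣i∣≡0⇒i≡0 ∣Y∣≡0))}} ⟩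
        n * G * ∣ Y ∣ ≡⟨ cong (_* ∣ Y ∣) (ℤ.abs-* (+ n) (+ G)) ⟨
        ∣ + n ⊗ + G ∣ * ∣ Y ∣ ≡⟨ ℤ.abs-* (+ n ⊗ + G) Y ⟨
        ∣ + n ⊗ + G ⊗ Y ∣ ≡⟨ cong ∣_∣ key ⟨
        ∣ + A ⊗ r ⊕ + f ⊗ + V ∣ ≤⟨ ℤ.∣i+j∣≤∣i∣+∣j∣ (+ A ⊗ r) (+ f ⊗ + V) ⟩
        ∣ + A ⊗ r ∣ + ∣ + f ⊗ + V ∣  ≡⟨ cong₂ _+_ (ℤ.abs-* (+ A) r) (ℤ.abs-* (+ f) (+ V)) ⟩
        A * ∣ r ∣ + f * V ∎)
        where open ≤-Reasoning

    -- For even `N` the residue at ∞ carries the sign (-1)^(N + 1) = -1, so that it joins the first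
    -- term with a plus sign.
    residue-identity : ∀ N n e → 1 ≤ e → -1ℤ ↑ N ≡ 1ℤ → let M = n + N + e in
      (+ 8) ↑ (N + e) ⊗ + Tℕ 8 (M C_) (suc N) n ⊕ + Tℕ 1 (binom₈ M) (suc N) (e ∸ 1) ≡ (+ 9) ↑ (n + e) ⊗ T (+ 9) (altC M) (suc n) N
    residue-identity N n (suc e) _ even = begin
      (+ 8) ↑ (N + suc e) ⊗ + Tℕ 8 (M C_) (suc N) n ⊕ + V
        ≡⟨ cong₂ (λ x y → (+ 8) ↑ x ⊗ y ⊕ + V) (+-suc N e) (sym (T-+ 8 (M C_) (suc N) n)) ⟩
      (+ 8) ↑ (suc N + e) ⊗ X M (suc N) (suc n) ⊕ + V
        ≡⟨ cong (_⊕ + V) (residues M (suc N) (suc n) e eq) ⟩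
      (+ 9) ↑ (suc n + e) ⊗ P ⊕ -1ℤ ⊗ -1ℤ ↑ N ⊗ + V ⊕ + V
        ≡⟨ cong₂ (λ x y → (+ 9) ↑ x ⊗ P ⊕ -1ℤ ⊗ y ⊗ + V ⊕ + V) (sym (+-suc n e)) even ⟩
      (+ 9) ↑ (n + suc e) ⊗ P ⊕ -1ℤ ⊗ 1ℤ ⊗ + V ⊕ + V
        ≡⟨ lem ((+ 9) ↑ (n + suc e) ⊗ P) (+ V) ⟩
      (+ 9) ↑ (n + suc e) ⊗ P ∎
      where
      open ≡-Reasoning
      M = n + N + suc e
      V = Tℕ 1 (binom₈ M) (suc N) e
      P = T (+ 9) (altC M) (suc n) N
      lem : ∀ x v → x ⊕ - + 1 ⊗ + 1 ⊗ v ⊕ v ≡ x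
      lem = ℤR.solve-∀
      eq : suc N + suc n + e ≡ suc M
      eq = cong suc (l N n e)
        where
        l : ∀ N n e → N + suc n + e ≡ n + N + suc e
        l = ℕR.solve-∀

    commonFactor∣T : ∀ N n e → let M = n + N + e in + commonFactor n N e ∣ + Tℕ 8 (M C_) (suc N) n
    commonFactor∣T N n e = subst (+ commonFactor n N e ∣_) (T-+ 8 (M C_) (suc N) n) (T-∣ (+ 8) (+_ ∘ (M C_)) N n
      (λ J l eq → subst (+ commonFactor n N e ∣_) (ℤ.pos-* (M C J) ((N + l) C N)) (∣ᵤ⇒∣ {+ commonFactor n N e} {+ ((M C J) * ((N + l) C N))} (g J l eq))))
      where
      M = n + N + e
      g : ∀ J l → J + l ≡ n → commonFactor n N e ℕ∣.∣ (M C J) * ((N + l) C N)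
      g J l refl = commonFactor∣ J l N e

    -- Compared with `commonFactor∣T` the roles of `n` and `N` are exchanged, and `commonFactor` is
    -- symmetric in them.
    commonFactor∣P : ∀ N n e → let M = n + N + e in + commonFactor n N e ∣ T (+ 9) (altC M) (suc n) N
    commonFactor∣P N n e = T-∣ (+ 9) (altC M) n N (λ J l eq →
      subst (+ commonFactor n N e ∣_) (sym (ℤ.*-assoc (-1ℤ ↑ J) (+ (M C J)) (+ ((n + l) C n))))
        (∣n⇒∣m*n (-1ℤ ↑ J) (subst (+ commonFactor n N e ∣_) (ℤ.pos-* (M C J) ((n + l) C n)) (∣ᵤ⇒∣ {+ commonFactor n N e} {+ ((M C J) * ((n + l) C n))} (g J l eq)))))
      where
      M = n + N + e
      g : ∀ J l → J + l ≡ N → commonFactor n N e ℕ∣.∣ (M C J) * ((n + l) C n)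
      g J l refl = subst₂ (λ x y → x ℕ∣.∣ ((y + e) C J) * ((n + l) C n)) (commonFactor-comm (J + l) n e) (+-comm (J + l) n) (commonFactor∣ J l n e)

    padé-bound : ∀ t j (m : ℤ) → 1 ≤ t → 2 * (4 ^ j * padéV t) ≤ 9 ^ (21 * t) * padéG t →
      4 ^ j * padéV t ≤ padéA t * ∣ + (4 ^ (42 * t + j)) ⊖ + (3 ^ (42 * t + j)) ⊗ m ∣
    padé-bound t j m 1≤t small = remainder-dichotomy {padéA t} {padéV t} {padéG t} {9 ^ (21 * t)} {4 ^ j} {P} {+ (8 ^ (28 * t))} {+ (3 ^ j)} {m}
      (commonFactor∣T (16 * t) (9 * t) (12 * t)) (commonFactor∣P (16 * t) (9 * t) (12 * t)) id r≡ small
      where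
      P = T (+ 9) (altC (9 * t + 16 * t + 12 * t)) (suc (9 * t)) (16 * t)
      id : + (8 ^ (28 * t)) ⊗ + padéA t ⊕ + padéV t ≡ + (9 ^ (21 * t)) ⊗ P
      id = trans (cong (λ x → x ⊗ + padéA t ⊕ + padéV t) (trans (pos-^ 8 (28 * t)) (cong ((+ 8) ↑_) (*-distribʳ-+ t 16 12))))
        (trans (residue-identity (16 * t) (9 * t) (12 * t) (≤-trans 1≤t (m≤n*m t 12)) even)
          (cong (_⊗ P) (sym (trans (pos-^ 9 (21 * t)) (cong ((+ 9) ↑_) (*-distribʳ-+ t 9 12))))))
        where
        even : -1ℤ ↑ (16 * t) ≡ 1ℤ
        even = trans (sym (ℤ.^-*-assoc -1ℤ 16 t)) (ℤ.^-zeroˡ t)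
      pow : ∀ b v {u e} → b ^ v ≡ u ^ e → b ^ (v * t + j) ≡ u ^ (e * t) * b ^ j
      pow b v {u} {e} eq = trans (^-distribˡ-+-* b (v * t) j) (cong (_* b ^ j) (trans (sym (^-*-assoc b v t)) (trans (cong (_^ t) eq) (^-*-assoc u e t))))
      r≡ : + (4 ^ (42 * t + j)) ⊖ + (3 ^ (42 * t + j)) ⊗ m ≡ + (8 ^ (28 * t)) ⊗ + (4 ^ j) ⊖ + (9 ^ (21 * t)) ⊗ + (3 ^ j) ⊗ m
      r≡ = cong₂ (λ x y → x ⊖ y ⊗ m) (trans (cong +_ (pow 4 42 {8} {28} refl)) (ℤ.pos-* (8 ^ (28 * t)) (4 ^ j)))
        (trans (cong +_ (pow 3 42 {9} {21} refl)) (ℤ.pos-* (9 ^ (21 * t)) (3 ^ j)))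

-- Stirling's formula with a rational substitute for e.

module StirlingBounds where

  open Prelude
  open VonMangoldt
  open CommonFactor
  open ≤-Reasoning

  bernoulli-upper : ∀ z k → suc z ^ suc k ≤ z ^ suc k + suc k * suc z ^ k
  bernoulli-upper z zero    = ≤-reflexive (lem z)
    where
    lem : ∀ z → suc z * 1 ≡ z * 1 + 1 * 1
    lem = solve-∀
  bernoulli-upper z (suc k) = begin
    suc z * suc z ^ suc k ≤⟨ *-monoʳ-≤ (suc z) (bernoulli-upper z k) ⟩
    suc z * (z ^ suc k + suc k * suc z ^ k) ≡⟨ l1 z (z ^ suc k) k (suc z ^ k) ⟩
    z * z ^ suc k + (z ^ suc k + suc k * suc z ^ suc k)  ≤⟨ +-monoʳ-≤ (z * z ^ suc k) (+-monoˡ-≤ (suc k * suc z ^ suc k) (^-monoˡ-≤ (suc k) (n≤1+n z))) ⟩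
    z ^ suc (suc k) + suc (suc k) * suc z ^ suc k    ∎
    where
    l1 : ∀ z x k y → suc z * (x + suc k * y) ≡ z * x + (x + suc k * (suc z * y))
    l1 = solve-∀

  bernoulli-lower : ∀ z k → z ^ suc k + suc k * z ^ k ≤ suc z ^ suc k
  bernoulli-lower z zero    = ≤-reflexive (lem z)
    where
    lem : ∀ z → z * 1 + 1 * 1 ≡ suc z * 1
    lem = solve-∀
  bernoulli-lower z (suc k) = begin
    z * z ^ suc k + suc (suc k) * z ^ suc k ≤⟨ m≤m+n _ (suc k * z ^ k) ⟩
    z * z ^ suc k + suc (suc k) * z ^ suc k + suc k * z ^ k ≡⟨ lem z (z ^ k) k ⟩
    suc z * (z ^ suc k + suc k * z ^ k) ≤⟨ *-monoʳ-≤ (suc z) (bernoulli-lower z k) ⟩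
    suc z * suc z ^ suc k ∎
    where
    lem : ∀ z y k → z * (z * y) + suc (suc k) * (z * y) + suc k * y ≡ suc z * (z * y + suc k * y)
    lem = solve-∀

  private
    sq : ∀ n → suc (n * (2 + n)) ≡ suc n * suc n
    sq = solve-∀

  -- (1 + 1/n)ⁿ increases …
  e-lower-mono : ∀ n → suc n ^ n * suc n ^ suc n ≤ (2 + n) ^ suc n * n ^ n
  e-lower-mono zero    = s≤s z≤n
  e-lower-mono n@(suc _) = *-cancelʳ-≤ _ _ n (begin
    suc n ^ n * suc n ^ suc n * n ≡⟨ l1 (suc n ^ n) n ⟩
    suc n ^ n * suc n ^ n * (n * suc n) ≡⟨ cong (_* (n * suc n)) (trans (sym (^-distribʳ-* n (suc n) (suc n))) (cong (_^ n) (sym (sq n)))) ⟩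
    suc z ^ n * (n * suc n) ≤⟨ +-cancelʳ-≤ (suc n * suc z ^ n) _ _ (begin
      suc z ^ n * (n * suc n) + suc n * suc z ^ n ≡⟨ l2 (suc z ^ n) n ⟩
      suc n * suc n * suc z ^ n ≡⟨ cong (_* suc z ^ n) (sq n) ⟨
      suc z ^ suc n ≤⟨ bernoulli-upper z n ⟩
      z ^ suc n + suc n * suc z ^ n ∎) ⟩
    z ^ suc n ≡⟨ ^-distribʳ-* (suc n) n (2 + n) ⟩
    n * n ^ n * (2 + n) ^ suc n ≡⟨ l3 n (n ^ n) ((2 + n) ^ suc n) ⟩
    (2 + n) ^ suc n * n ^ n * n ∎)
    where
    -- Since z + 1 = (n + 1)^2, the quotient of consecutive values of (1 + 1/n)^n is governed by
    -- Bernoulli's inequality for 1 - 1 / (n + 1)^2.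
    z = n * (2 + n)
    l1 : ∀ x n → x * (suc n * x) * n ≡ x * x * (n * suc n)
    l1 = solve-∀
    l2 : ∀ x n → x * (n * suc n) + suc n * x ≡ suc n * suc n * x
    l2 = solve-∀
    l3 : ∀ n x y → n * x * y ≡ y * x * n
    l3 = solve-∀

  -- … and (1 + 1/n)ⁿ⁺¹ decreases.
  e-upper-mono : ∀ n → (2 + n) ^ (2 + n) * n ^ suc n ≤ suc n ^ suc n * suc n ^ (2 + n)
  e-upper-mono n = begin
    (2 + n) * (2 + n) ^ suc n * n ^ suc n ≡⟨ l1 (2 + n) ((2 + n) ^ suc n) (n ^ suc n) ⟩
    n ^ suc n * (2 + n) ^ suc n * (2 + n) ≡⟨ cong (_* (2 + n)) (^-distribʳ-* (suc n) n (2 + n)) ⟨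
    z * z ^ n * (2 + n) ≤⟨ m≤m+n _ (z ^ n) ⟩
    z * z ^ n * (2 + n) + z ^ n ≡⟨ l2 n (z ^ n) ⟩
    (z * z ^ n + suc n * z ^ n) * suc n ≤⟨ *-monoˡ-≤ (suc n) (bernoulli-lower z n) ⟩
    suc z ^ suc n * suc n ≡⟨ cong (λ x → x ^ suc n * suc n) (sq n) ⟩
    (suc n * suc n) ^ suc n * suc n ≡⟨ cong (_* suc n) (^-distribʳ-* (suc n) (suc n) (suc n)) ⟩
    suc n ^ suc n * suc n ^ suc n * suc n ≡⟨ l3 (suc n ^ suc n) (suc n) ⟩
    suc n ^ suc n * suc n ^ (2 + n) ∎
    where
    z = n * (2 + n)
    l1 : ∀ a x y → a * x * y ≡ y * x * a
    l1 = solve-∀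
    l2 : ∀ n y → (n * (2 + n)) * y * (2 + n) + y ≡ ((n * (2 + n)) * y + suc n * y) * suc n
    l2 = solve-∀
    l3 : ∀ x y → x * x * y ≡ x * (y * x)
    l3 = solve-∀

  -- α / β = (1 + 1/H)ᴴ plays the role of e.
  module Stirling (H : ℕ) .{{_ : NonZero H}} where
    α β : ℕ
    α = suc H ^ H
    β = H ^ H

    instance
      β≢0 : NonZero β
      β≢0 = m^n≢0 H H
      α≢0 : NonZero α
      α≢0 = m^n≢0 (suc H) H

    -- An equality at n = H, from where monotonicity carries it down. Taking `H` above every
    -- factorial argument therefore gives one constant that serves all of them and later cancels
    -- exactly.
    e-lower : ∀ n → n ≤ H → suc n ^ n * β ≤ α * n ^ n
    e-lower n n≤H = go (H ∸ n) n (m∸n+n≡m n≤H)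
      where
      go : ∀ k n → k + n ≡ H → suc n ^ n * β ≤ α * n ^ n
      go zero    n refl = ≤-refl
      go (suc k) n eq   = *-cancelʳ-≤ _ _ (suc n ^ suc n) {{m^n≢0 (suc n) (suc n)}} (begin
        suc n ^ n * β * suc n ^ suc n ≡⟨ l1 (suc n ^ n) β (suc n ^ suc n) ⟩
        β * (suc n ^ n * suc n ^ suc n)   ≤⟨ *-monoʳ-≤ β (e-lower-mono n) ⟩
        β * ((2 + n) ^ suc n * n ^ n) ≡⟨ l2 β ((2 + n) ^ suc n) (n ^ n) ⟩
        (2 + n) ^ suc n * β * n ^ n ≤⟨ *-monoˡ-≤ (n ^ n) (go k (suc n) (trans (+-suc k n) eq)) ⟩
        α * suc n ^ suc n * n ^ n ≡⟨ l3 α (suc n ^ suc n) (n ^ n) ⟩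
        α * n ^ n * suc n ^ suc n ∎)
        where
        l1 : ∀ x b y → x * b * y ≡ b * (x * y)
        l1 = solve-∀
        l2 : ∀ b x y → b * (x * y) ≡ x * b * y
        l2 = solve-∀
        l3 : ∀ a x y → a * x * y ≡ a * y * x
        l3 = solve-∀

    e-upper : ∀ n → n ≤ H → α * n ^ suc n ≤ suc n ^ suc n * β
    e-upper n n≤H = go (H ∸ n) n (m∸n+n≡m n≤H)
      where
      go : ∀ k n → k + n ≡ H → α * n ^ suc n ≤ suc n ^ suc n * β
      go zero    n refl = begin
        suc n ^ n * (n * n ^ n) ≤⟨ *-monoʳ-≤ (suc n ^ n) (*-monoˡ-≤ (n ^ n) (n≤1+n n)) ⟩
        suc n ^ n * (suc n * n ^ n) ≡⟨ l0 (suc n ^ n) (suc n) (n ^ n) ⟩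
        suc n ^ suc n * n ^ n ∎
        where
        l0 : ∀ x s y → x * (s * y) ≡ s * x * y
        l0 = solve-∀
      go (suc k) n eq   = *-cancelʳ-≤ _ _ (suc n ^ (2 + n)) {{m^n≢0 (suc n) (2 + n)}} (begin
        α * n ^ suc n * suc n ^ (2 + n) ≡⟨ l1 α (n ^ suc n) (suc n ^ (2 + n)) ⟩
        α * suc n ^ (2 + n) * n ^ suc n ≤⟨ *-monoˡ-≤ (n ^ suc n) (go k (suc n) (trans (+-suc k n) eq)) ⟩
        (2 + n) ^ (2 + n) * β * n ^ suc n ≡⟨ l2 ((2 + n) ^ (2 + n)) β (n ^ suc n) ⟩
        (2 + n) ^ (2 + n) * n ^ suc n * β ≤⟨ *-monoˡ-≤ β (e-upper-mono n) ⟩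
        suc n ^ suc n * suc n ^ (2 + n) * β ≡⟨ l3 (suc n ^ suc n) (suc n ^ (2 + n)) β ⟩
        suc n ^ suc n * β * suc n ^ (2 + n) ∎)
        where
        l1 : ∀ a x y → a * x * y ≡ a * y * x
        l1 = solve-∀
        l2 : ∀ x b y → x * b * y ≡ x * y * b
        l2 = solve-∀
        l3 : ∀ x y b → x * y * b ≡ x * b * y
        l3 = solve-∀

    α≤4β : α ≤ 4 * β
    α≤4β = subst (_≤ 4 * β) (*-identityʳ α) (e-upper 1 (>-nonZero⁻¹ H))

    !-lower : ∀ n → n ≤ suc H → n ^ n * β ^ n ≤ n ! * α ^ n
    !-lower zero    _         = ≤-refl
    !-lower (suc n) (s≤s n≤H) = begin
      suc n * suc n ^ n * (β * β ^ n) ≡⟨ l1 (suc n) (suc n ^ n) β (β ^ n) ⟩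
      suc n * (suc n ^ n * β) * β ^ n ≤⟨ *-monoˡ-≤ (β ^ n) (*-monoʳ-≤ (suc n) (e-lower n n≤H)) ⟩
      suc n * (α * n ^ n) * β ^ n ≡⟨ l2 (suc n) α (n ^ n) (β ^ n) ⟩
      suc n * α * (n ^ n * β ^ n) ≤⟨ *-monoʳ-≤ (suc n * α) (!-lower n (m≤n⇒m≤1+n n≤H)) ⟩
      suc n * α * (n ! * α ^ n) ≡⟨ l3 (suc n) α (n !) (α ^ n) ⟩
      suc n * n ! * (α * α ^ n) ∎
      where
      l1 : ∀ s x b y → s * x * (b * y) ≡ s * (x * b) * y
      l1 = solve-∀
      l2 : ∀ s a x y → s * (a * x) * y ≡ s * a * (x * y)
      l2 = solve-∀
      l3 : ∀ s a x y → s * a * (x * y) ≡ s * x * (a * y)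
      l3 = solve-∀

    !-upper : ∀ n → suc n ≤ suc H → suc n ! * α ^ suc n * β ≤ suc n ^ (2 + n) * β ^ suc n * α
    !-upper zero    _         = ≤-reflexive (l0 α β)
      where
      l0 : ∀ a b → 1 * (a * 1) * b ≡ 1 * (b * 1) * a
      l0 = solve-∀
    !-upper (suc n) (s≤s n<H) = begin
      (2 + n) * suc n ! * (α * α ^ suc n) * β ≡⟨ l1 (2 + n) (suc n !) α (α ^ suc n) β ⟩
      (2 + n) * α * (suc n ! * α ^ suc n * β) ≤⟨ *-monoʳ-≤ ((2 + n) * α) (!-upper n (m≤n⇒m≤1+n n<H)) ⟩
      (2 + n) * α * (suc n ^ (2 + n) * β ^ suc n * α) ≡⟨ l2 (2 + n) α (suc n ^ (2 + n)) (β ^ suc n) ⟩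
      (2 + n) * (α * suc n ^ (2 + n)) * β ^ suc n * α ≤⟨ *-monoˡ-≤ α (*-monoˡ-≤ (β ^ suc n) (*-monoʳ-≤ (2 + n) (e-upper (suc n) n<H))) ⟩
      (2 + n) * ((2 + n) ^ (2 + n) * β) * β ^ suc n * α ≡⟨ l3 (2 + n) ((2 + n) ^ (2 + n)) β (β ^ suc n) α ⟩
      (2 + n) ^ (3 + n) * β ^ (2 + n) * α ∎
      where
      l1 : ∀ s x a y b → s * x * (a * y) * b ≡ s * a * (x * y * b)
      l1 = solve-∀
      l2 : ∀ s a x y → s * a * (x * y * a) ≡ s * (a * x) * y * a
      l2 = solve-∀
      l3 : ∀ s x b y a → s * (x * b) * y * a ≡ s * x * (b * y) * a
      l3 = solve-∀

    -- n ≈ y / m: (n!)ᵐ compared with (y / e m)^y.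
    !-lower-frac : ∀ y m x → x ≤ suc H → 4 ≤ x → y ≤ x * m → (y * β) ^ y ≤ (x !) ^ m * (m * α) ^ y
    !-lower-frac y m x x≤ 4≤x y≤xm = *-cancelʳ-≤ _ _ (α ^ D) {{m^n≢0 α D}} (begin
      (y * β) ^ y * α ^ D ≤⟨ *-mono-≤ (^-monoˡ-≤ y (*-monoˡ-≤ β y≤xm)) (^-monoˡ-≤ D (≤-trans α≤4β (*-monoˡ-≤ β 4≤x))) ⟩
      (x * m * β) ^ y * (x * β) ^ D ≡⟨ cong (λ z → z ^ y * (x * β) ^ D) (l1 x m β) ⟩
      (m * (x * β)) ^ y * (x * β) ^ D    ≡⟨ cong (_* (x * β) ^ D) (^-distribʳ-* y m (x * β)) ⟩
      m ^ y * (x * β) ^ y * (x * β) ^ D  ≡⟨ trans (*-assoc (m ^ y) _ _) (cong (m ^ y *_) (sym (^-distribˡ-+-* (x * β) y D))) ⟩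
      m ^ y * (x * β) ^ (y + D) ≡⟨ cong (λ z → m ^ y * (x * β) ^ z) y+D ⟩
      m ^ y * (x * β) ^ (x * m) ≡⟨ cong (m ^ y *_) (sym (^-*-assoc (x * β) x m)) ⟩
      m ^ y * ((x * β) ^ x) ^ m ≤⟨ *-monoʳ-≤ (m ^ y) (^-monoˡ-≤ m (≤-trans (≤-reflexive (^-distribʳ-* x x β)) (!-lower x x≤))) ⟩
      m ^ y * (x ! * α ^ x) ^ m ≡⟨ cong (m ^ y *_) (trans (^-distribʳ-* m (x !) (α ^ x)) (cong ((x !) ^ m *_) (trans (^-*-assoc α x m) (cong (α ^_) (sym y+D))))) ⟩
      m ^ y * ((x !) ^ m * α ^ (y + D))    ≡⟨ cong (λ z → m ^ y * ((x !) ^ m * z)) (^-distribˡ-+-* α y D) ⟩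
      m ^ y * ((x !) ^ m * (α ^ y * α ^ D)) ≡⟨ l2 (m ^ y) ((x !) ^ m) (α ^ y) (α ^ D) ⟩
      (x !) ^ m * (m ^ y * α ^ y) * α ^ D  ≡⟨ cong (λ z → (x !) ^ m * z * α ^ D) (sym (^-distribʳ-* y m α)) ⟩
      (x !) ^ m * (m * α) ^ y * α ^ D ∎)
      where
      -- Rounding y / m up to `x` leaves `D` surplus factors, which do no harm because α ≤ 4 β ≤ x
      -- β.
      D = x * m ∸ y
      y+D : y + D ≡ x * m
      y+D = m+[n∸m]≡n y≤xm
      l1 : ∀ x m b → x * m * b ≡ m * (x * b)
      l1 = solve-∀
      l2 : ∀ a b c d → a * (b * (c * d)) ≡ b * (a * c) * d
      l2 = solve-∀

    -- The counterpart with y / m rounded down. The missing y - x m factors cost nothing because m α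
    -- ≤ y β; the factor `(4 * x) ^ m` collects the polynomial loss `x` of `!-upper` and α / β ≤ 4.
    !-upper-frac : ∀ y m x → x ≤ suc H → 4 ≤ x → x * m ≤ y → (x !) ^ m * (m * α) ^ y ≤ (y * β) ^ y * (4 * x) ^ m
    !-upper-frac y m x@(suc n) x≤ 4≤x xm≤y = *-cancelʳ-≤ _ _ (β ^ m) {{m^n≢0 β m}} (begin
      (x !) ^ m * (m * α) ^ y * β ^ m ≡⟨ cong (λ z → (x !) ^ m * z * β ^ m) (trans (cong ((m * α) ^_) (sym xm+D)) (trans (^-distribˡ-+-* (m * α) (x * m) D) (cong (_* (m * α) ^ D) (^-distribʳ-* (x * m) m α)))) ⟩
      (x !) ^ m * (m ^ (x * m) * α ^ (x * m) * (m * α) ^ D) * β ^ m ≡⟨ l1 ((x !) ^ m) (m ^ (x * m)) (α ^ (x * m)) ((m * α) ^ D) (β ^ m) ⟩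
      m ^ (x * m) * ((x !) ^ m * α ^ (x * m) * β ^ m) * (m * α) ^ D ≡⟨ cong (λ z → m ^ (x * m) * z * (m * α) ^ D) (sym (pow3 (x !) (α ^ x) β (^-*-assoc α x m))) ⟩
      m ^ (x * m) * (x ! * α ^ x * β) ^ m * (m * α) ^ D ≤⟨ *-mono-≤ (*-monoʳ-≤ (m ^ (x * m)) (^-monoˡ-≤ m (!-upper n x≤))) (^-monoˡ-≤ D mα≤yβ) ⟩
      m ^ (x * m) * (x ^ (2 + n) * β ^ x * α) ^ m * (y * β) ^ D ≡⟨ cong (λ z → m ^ (x * m) * z ^ m * (y * β) ^ D) (trans (cong (_* α) (l0 x (x ^ x) (β ^ x))) (cong (λ w → x * w * α) (sym (^-distribʳ-* x x β)))) ⟩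
      m ^ (x * m) * (x * (x * β) ^ x * α) ^ m * (y * β) ^ D  ≡⟨ cong (λ z → m ^ (x * m) * z * (y * β) ^ D) (pow3 x ((x * β) ^ x) α (^-*-assoc (x * β) x m)) ⟩
      m ^ (x * m) * (x ^ m * (x * β) ^ (x * m) * α ^ m) * (y * β) ^ D ≡⟨ l2 (m ^ (x * m)) (x ^ m) ((x * β) ^ (x * m)) (α ^ m) ((y * β) ^ D) ⟩
      (x * β) ^ (x * m) * m ^ (x * m) * (y * β) ^ D * (x ^ m * α ^ m) ≡⟨ cong (λ z → z * (y * β) ^ D * (x ^ m * α ^ m)) (sym (^-distribʳ-* (x * m) (x * β) m)) ⟩
      (x * β * m) ^ (x * m) * (y * β) ^ D * (x ^ m * α ^ m)  ≤⟨ *-mono-≤ (*-monoˡ-≤ ((y * β) ^ D) (^-monoˡ-≤ (x * m) xβm≤)) (*-monoʳ-≤ (x ^ m) (^-monoˡ-≤ m α≤4β)) ⟩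
      (y * β) ^ (x * m) * (y * β) ^ D * (x ^ m * (4 * β) ^ m) ≡⟨ cong₂ _*_ (trans (sym (^-distribˡ-+-* (y * β) (x * m) D)) (cong ((y * β) ^_) xm+D)) (cong (x ^ m *_) (^-distribʳ-* m 4 β)) ⟩
      (y * β) ^ y * (x ^ m * (4 ^ m * β ^ m)) ≡⟨ l3 ((y * β) ^ y) (x ^ m) (4 ^ m) (β ^ m) ⟩
      (y * β) ^ y * (4 ^ m * x ^ m) * β ^ m ≡⟨ cong (λ z → (y * β) ^ y * z * β ^ m) (sym (^-distribʳ-* m 4 x)) ⟩
      (y * β) ^ y * (4 * x) ^ m * β ^ m ∎)
      where
      D = y ∸ x * m
      xm+D : x * m + D ≡ y
      xm+D = m+[n∸m]≡n xm≤y
      pow3 : ∀ a b c {d} → b ^ m ≡ d → (a * b * c) ^ m ≡ a ^ m * d * c ^ m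
      pow3 a b c refl = trans (^-distribʳ-* m (a * b) c) (cong (_* c ^ m) (^-distribʳ-* m a b))
      mα≤yβ : m * α ≤ y * β
      mα≤yβ = begin
        m * α ≤⟨ *-monoʳ-≤ m α≤4β ⟩
        m * (4 * β)   ≡⟨ l4 m β ⟩
        4 * m * β ≤⟨ *-monoˡ-≤ β (≤-trans (*-monoˡ-≤ m 4≤x) xm≤y) ⟩
        y * β ∎
        where
        l4 : ∀ m b → m * (4 * b) ≡ 4 * m * b
        l4 = solve-∀
      xβm≤ : x * β * m ≤ y * β
      xβm≤ = ≤-trans (≤-reflexive (l5 x β m)) (*-monoˡ-≤ β xm≤y)
        where
        l5 : ∀ x b m → x * b * m ≡ x * m * b
        l5 = solve-∀
      l0 : ∀ a x y → a * x * y ≡ a * (x * y)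
      l0 = *-assoc
      l1 : ∀ f a b c d → f * (a * b * c) * d ≡ a * (f * b * d) * c
      l1 = solve-∀
      l2 : ∀ a b c d e → a * (b * c * d) * e ≡ c * a * e * (b * d)
      l2 = solve-∀
      l3 : ∀ a b c d → a * (b * (c * d)) ≡ a * (c * b) * d
      l3 = solve-∀

-- Exponential growth of products of factorials of ⌊q t / m⌋.

module FactorialProducts where

  open Prelude
  open import Agda.Builtin.Nat using (div-helper)
  open VonMangoldt
  open CommonFactor
  open StirlingBounds

  -- term q m c L stands for the factor (⌊q t / suc m⌋ !)^(c * suc m).
  data Terms : Set where
    []   : Terms
    term : (q m c : ℕ) → Terms → Terms

  factorials : Terms → ℕ → ℕ
  factorials []             t = 1
  factorials (term q m c L) t = ((q * t / suc m) !) ^ (suc m * c) * factorials L t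

  -- The exponent of Λ (suc d) in factorials L t.
  floors : Terms → ℕ → ℕ → ℕ
  floors []             t d = 0
  floors (term q m c L) t d = suc m * c * div-helper 0 m (div-helper 0 d (q * t) d) m + floors L t d

  -- By Stirling's formula, `factorials L t` is about (`∏num L` / `∏den L`)^t (t / e)^(t
  -- `weight L`). The factor `suc m` in each exponent of `factorials` keeps these quantities
  -- integral. `count` is the number of factorials with multiplicity and bounds both the rounding
  -- and the error in Stirling's formula.
  weight : Terms → ℕ
  weight []             = 0
  weight (term q m c L) = q * c + weight L

  count : Terms → ℕ
  count []             = 0
  count (term q m c L) = suc m * c + count L

  ∏num ∏den : Terms → ℕ
  ∏num []             = 1
  ∏num (term q m c L) = q ^ (q * c) * ∏num L
  ∏den []             = 1
  ∏den (term q m c L) = suc m ^ (q * c) * ∏den L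

  -- The first condition keeps the factorial arguments below H = 37 t; the second makes them at
  -- least 4, as the rounding in `!-lower-frac` and `!-upper-frac` demands.
  Admissible : ℕ → Terms → Set
  Admissible t []             = ⊤
  Admissible t (term q m c L) = q ≤ 37 × 4 * suc m ≤ q * t × Admissible t L

  Admissible-mono : ∀ L {s t} → s ≤ t → Admissible s L → Admissible t L
  Admissible-mono []             s≤t _                = tt
  Admissible-mono (term q m c L) s≤t (q≤ , m≤ , adm) = q≤ , ≤-trans m≤ (*-monoʳ-≤ q s≤t) , Admissible-mono L s≤t adm

  factorials-∏Λ : ∀ L t → Admissible t L → factorials L t ≡ ∏ (λ i → Λ (suc i) ^ floors L t i) (37 * t)
  factorials-∏Λ []             t _              = sym (∏-1 (37 * t) (λ i _ → refl))
  factorials-∏Λ (term q m c L) t (q≤ , _ , adm) = begin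
    (n !) ^ e * factorials L t
      ≡⟨ cong₂ (λ x y → x ^ e * y) (!-∏Λ n (37 * t) (≤-trans (m/n≤m (q * t) (suc m)) (*-monoˡ-≤ t q≤))) (factorials-∏Λ L t adm) ⟩
    ∏ (λ i → Λ (suc i) ^ (n / suc i)) (37 * t) ^ e * ∏ (λ i → Λ (suc i) ^ floors L t i) (37 * t)
      ≡⟨ cong (_* _) (∏-^ _ e (37 * t)) ⟩
    ∏ (λ i → (Λ (suc i) ^ (n / suc i)) ^ e) (37 * t) * ∏ (λ i → Λ (suc i) ^ floors L t i) (37 * t)
      ≡⟨ ∏-* _ _ (37 * t) ⟨
    ∏ (λ i → (Λ (suc i) ^ (n / suc i)) ^ e * Λ (suc i) ^ floors L t i) (37 * t)
      ≡⟨ ∏-cong (37 * t) (λ i _ → trans (cong (_* Λ (suc i) ^ floors L t i) (^-*-assoc (Λ (suc i)) (n / suc i) e))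
          (trans (sym (^-distribˡ-+-* (Λ (suc i)) (n / suc i * e) (floors L t i)))
            (cong (λ z → Λ (suc i) ^ (z + floors L t i)) (trans (*-comm (n / suc i) e) (cong (e *_) (swap i)))))) ⟩
    ∏ (λ i → Λ (suc i) ^ floors (term q m c L) t i) (37 * t) ∎
    where
    open ≡-Reasoning
    n = q * t / suc m
    e = suc m * c
    -- Dividing by the modulus first makes the exponent a function of ⌊q t / d⌋ alone, on which the
    -- sampling of certificates rests.
    swap : ∀ i → q * t / suc m / suc i ≡ q * t / suc i / suc m
    swap i = trans (m/n/o≡m/[n*o] (q * t) (suc m) (suc i)) (trans (/-congʳ {m = q * t} (*-comm (suc m) (suc i))) (sym (m/n/o≡m/[n*o] (q * t) (suc i) (suc m))))

  opaque
    -- Bounds the error of Stirling's formula for every factorial that occurs.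
    slack : ℕ → ℕ
    slack t = 4 * suc (37 * t)

    slack-def : ∀ t → slack t ≡ 4 * suc (37 * t)
    slack-def t = refl

  module _ (t : ℕ) .{{_ : NonZero t}} where
    private
      H = 37 * t
      instance
        H≢0 : NonZero H
        H≢0 = m*n≢0 37 t
    open Stirling H
    open ≤-Reasoning

    private
      σ = slack t

    private
      y^y : ∀ q c → (q * t * β) ^ (q * t * c) ≡ (q ^ (q * c)) ^ t * (t * β) ^ (t * (q * c))
      y^y q c = begin-equality
        (q * t * β) ^ (q * t * c) ≡⟨ cong₂ _^_ (*-assoc q t β) (l1 q t c) ⟩
        (q * (t * β)) ^ (q * c * t) ≡⟨ ^-distribʳ-* (q * c * t) q (t * β) ⟩
        q ^ (q * c * t) * (t * β) ^ (q * c * t) ≡⟨ cong₂ _*_ (sym (^-*-assoc q (q * c) t)) (cong ((t * β) ^_) (*-comm (q * c) t)) ⟩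
        (q ^ (q * c)) ^ t * (t * β) ^ (t * (q * c)) ∎
        where
        l1 : ∀ q t c → q * t * c ≡ q * c * t
        l1 = solve-∀

      m^y : ∀ q m c → (m * α) ^ (q * t * c) ≡ (m ^ (q * c)) ^ t * α ^ (t * (q * c))
      m^y q m c = begin-equality
        (m * α) ^ (q * t * c) ≡⟨ cong ((m * α) ^_) (l1 q t c) ⟩
        (m * α) ^ (q * c * t) ≡⟨ ^-distribʳ-* (q * c * t) m α ⟩
        m ^ (q * c * t) * α ^ (q * c * t) ≡⟨ cong₂ _*_ (sym (^-*-assoc m (q * c) t)) (cong (α ^_) (*-comm (q * c) t)) ⟩
        (m ^ (q * c)) ^ t * α ^ (t * (q * c)) ∎
        where
        l1 : ∀ q t c → q * t * c ≡ q * c * t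
        l1 = solve-∀

      combine : ∀ a b x v w → (a ^ t * x ^ (t * v)) * (b ^ t * x ^ (t * w)) ≡ (a * b) ^ t * x ^ (t * (v + w))
      combine a b x v w = begin-equality
        (a ^ t * x ^ (t * v)) * (b ^ t * x ^ (t * w)) ≡⟨ *-interchange (a ^ t) _ (b ^ t) _ ⟩
        (a ^ t * b ^ t) * (x ^ (t * v) * x ^ (t * w)) ≡⟨ cong₂ _*_ (sym (^-distribʳ-* t a b)) (trans (sym (^-distribˡ-+-* x (t * v) (t * w))) (cong (x ^_) (sym (*-distribˡ-+ t v w)))) ⟩
        (a * b) ^ t * x ^ (t * (v + w)) ∎

      1^t : ∀ x → 1 ^ t * x ^ (t * 0) ≡ 1
      1^t x = cong₂ _*_ (^-zeroˡ t) (cong (x ^_) (*-zeroʳ t))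

      module Single (q m c : ℕ) (q≤ : q ≤ 37) (4m≤ : 4 * suc m ≤ q * t) where
        y = q * t
        n = y / suc m
        e = suc m * c

        n≤H : n ≤ H
        n≤H = ≤-trans (m/n≤m y (suc m)) (*-monoˡ-≤ t q≤)

        4≤n : 4 ≤ n
        4≤n = ≤-trans (≤-reflexive (sym (m*n/n≡m 4 (suc m)))) (/-monoˡ-≤ (suc m) 4m≤)

        -- The lower estimate rounds `y / suc m` up; the surplus factor `suc n` of `suc n !` goes
        -- into `σ`.
        lower : (y * β) ^ (y * c) ≤ (n !) ^ e * σ ^ e * (suc m * α) ^ (y * c)
        lower = begin
          (y * β) ^ (y * c) ≡⟨ ^-*-assoc (y * β) y c ⟨
          ((y * β) ^ y) ^ c ≤⟨ ^-monoˡ-≤ c (!-lower-frac y (suc m) (suc n) (s≤s n≤H) (m≤n⇒m≤1+n 4≤n) (<⇒≤ (m<suc[m/n]*n y (suc m)))) ⟩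
          ((suc n !) ^ suc m * (suc m * α) ^ y) ^ c ≡⟨ trans (^-distribʳ-* c _ _) (cong₂ _*_ (^-*-assoc (suc n !) (suc m) c) (^-*-assoc (suc m * α) y c)) ⟩
          (suc n * n !) ^ e * (suc m * α) ^ (y * c) ≤⟨ *-monoˡ-≤ ((suc m * α) ^ (y * c)) (^-monoˡ-≤ e (*-monoˡ-≤ (n !) (≤-trans (≤-trans (s≤s n≤H) (m≤n*m (suc H) 4)) (≤-reflexive (sym (slack-def t)))))) ⟩
          (σ * n !) ^ e * (suc m * α) ^ (y * c) ≡⟨ cong (_* (suc m * α) ^ (y * c)) (trans (cong (λ z → z ^ e) (*-comm σ (n !))) (^-distribʳ-* e (n !) σ)) ⟩
          (n !) ^ e * σ ^ e * (suc m * α) ^ (y * c) ∎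

        upper : (n !) ^ e * (suc m * α) ^ (y * c) ≤ σ ^ e * (y * β) ^ (y * c)
        upper = begin
          (n !) ^ e * (suc m * α) ^ (y * c) ≡⟨ cong₂ _*_ (^-*-assoc (n !) (suc m) c) (^-*-assoc (suc m * α) y c) ⟨
          ((n !) ^ suc m) ^ c * ((suc m * α) ^ y) ^ c ≡⟨ ^-distribʳ-* c _ _ ⟨
          ((n !) ^ suc m * (suc m * α) ^ y) ^ c ≤⟨ ^-monoˡ-≤ c (!-upper-frac y (suc m) n (m≤n⇒m≤1+n n≤H) 4≤n (m/n*n≤m y (suc m))) ⟩
          ((y * β) ^ y * (4 * n) ^ suc m) ^ c ≡⟨ trans (^-distribʳ-* c _ _) (cong₂ _*_ (^-*-assoc (y * β) y c) (^-*-assoc (4 * n) (suc m) c)) ⟩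
          (y * β) ^ (y * c) * (4 * n) ^ e ≤⟨ *-monoʳ-≤ ((y * β) ^ (y * c)) (^-monoˡ-≤ e (≤-trans (*-monoʳ-≤ 4 (m≤n⇒m≤1+n n≤H)) (≤-reflexive (sym (slack-def t))))) ⟩
          (y * β) ^ (y * c) * σ ^ e ≡⟨ *-comm _ (σ ^ e) ⟩
          σ ^ e * (y * β) ^ (y * c) ∎

    numβ denα : Terms → ℕ
    numβ L = ∏num L ^ t * (t * β) ^ (t * weight L)
    denα L = ∏den L ^ t * α ^ (t * weight L)

    private
      numβ-∷ : ∀ q m c L → numβ (term q m c L) ≡ (q * t * β) ^ (q * t * c) * numβ L
      numβ-∷ q m c L = sym (trans (cong (_* numβ L) (y^y q c)) (combine (q ^ (q * c)) (∏num L) (t * β) (q * c) (weight L)))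

      denα-∷ : ∀ q m c L → denα (term q m c L) ≡ (suc m * α) ^ (q * t * c) * denα L
      denα-∷ q m c L = sym (trans (cong (_* denα L) (m^y q (suc m) c)) (combine (suc m ^ (q * c)) (∏den L) α (q * c) (weight L)))

    factorials-lower : ∀ L → Admissible t L → numβ L ≤ factorials L t * slack t ^ count L * denα L
    factorials-lower [] _ = ≤-reflexive (trans (1^t (t * β)) (sym (trans (+-identityʳ (denα [])) (1^t α))))
    factorials-lower (term q m c L) (q≤ , 4m≤ , adm) = begin
      numβ (term q m c L) ≡⟨ numβ-∷ q m c L ⟩
      (y * β) ^ (y * c) * numβ L ≤⟨ *-mono-≤ lower (factorials-lower L adm) ⟩
      (n !) ^ e * σ ^ e * (suc m * α) ^ (y * c) * (factorials L t * σ ^ count L * denα L)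
        ≡⟨ l1 ((n !) ^ e) (σ ^ e) ((suc m * α) ^ (y * c)) (factorials L t) (σ ^ count L) (denα L) ⟩
      (n !) ^ e * factorials L t * (σ ^ e * σ ^ count L) * ((suc m * α) ^ (y * c) * denα L)
        ≡⟨ cong₂ (λ a b → (n !) ^ e * factorials L t * a * b) (sym (^-distribˡ-+-* σ e (count L))) (sym (denα-∷ q m c L)) ⟩
      factorials (term q m c L) t * σ ^ count (term q m c L) * denα (term q m c L) ∎
      where
      open Single q m c q≤ 4m≤
      l1 : ∀ a b c d e f → a * b * c * (d * e * f) ≡ a * d * (b * e) * (c * f)
      l1 = solve-∀

    factorials-upper : ∀ L → Admissible t L → factorials L t * denα L ≤ slack t ^ count L * numβ L
    factorials-upper [] _ = ≤-reflexive (trans (trans (+-identityʳ (denα [])) (1^t α)) (sym (trans (+-identityʳ (numβ [])) (1^t (t * β)))))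
    factorials-upper (term q m c L) (q≤ , 4m≤ , adm) = begin
      (n !) ^ e * factorials L t * denα (term q m c L) ≡⟨ cong ((n !) ^ e * factorials L t *_) (denα-∷ q m c L) ⟩
      (n !) ^ e * factorials L t * ((suc m * α) ^ (y * c) * denα L) ≡⟨ *-interchange ((n !) ^ e) _ _ _ ⟩
      (n !) ^ e * (suc m * α) ^ (y * c) * (factorials L t * denα L) ≤⟨ *-mono-≤ upper (factorials-upper L adm) ⟩
      σ ^ e * (y * β) ^ (y * c) * (σ ^ count L * numβ L) ≡⟨ *-interchange (σ ^ e) _ _ _ ⟩
      σ ^ e * σ ^ count L * ((y * β) ^ (y * c) * numβ L) ≡⟨ cong₂ _*_ (sym (^-distribˡ-+-* σ e (count L))) (sym (numβ-∷ q m c L)) ⟩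
      σ ^ count (term q m c L) * numβ (term q m c L) ∎
      where open Single q m c q≤ 4m≤

    -- For balanced lists the powers of t and of e cancel.
    factorials-ratio : ∀ P N → Admissible t P → Admissible t N → weight P ≡ weight N →
      factorials N t * (∏num P * ∏den N) ^ t ≤ factorials P t * (∏num N * ∏den P) ^ t * slack t ^ (count P + count N)
    factorials-ratio P N admP admN wt = *-cancelʳ-≤ _ _ (x * z) {{m*n≢0 x z {{m^n≢0 (t * β) (t * weight P) {{m*n≢0 t β}}}} {{m^n≢0 α (t * weight P)}}}} (begin
      factorials N t * (∏num P * ∏den N) ^ t * (x * z)
        ≡⟨ cong (λ a → factorials N t * a * (x * z)) (^-distribʳ-* t (∏num P) (∏den N)) ⟩
      factorials N t * (∏num P ^ t * ∏den N ^ t) * (x * z)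
        ≡⟨ l1 (factorials N t) (∏num P ^ t) (∏den N ^ t) x z ⟩
      factorials N t * (∏den N ^ t * z) * (∏num P ^ t * x)
        ≡⟨ cong (λ w → factorials N t * (∏den N ^ t * α ^ (t * w)) * numβ P) wt ⟩
      factorials N t * denα N * numβ P
        ≤⟨ *-mono-≤ (factorials-upper N admN) (factorials-lower P admP) ⟩
      σ ^ count N * numβ N * (factorials P t * σ ^ count P * denα P)
        ≡⟨ cong (λ w → σ ^ count N * (∏num N ^ t * (t * β) ^ (t * w)) * (factorials P t * σ ^ count P * denα P)) (sym wt) ⟩
      σ ^ count N * (∏num N ^ t * x) * (factorials P t * σ ^ count P * (∏den P ^ t * z))
        ≡⟨ l2 (σ ^ count N) (∏num N ^ t) x (factorials P t) (σ ^ count P) (∏den P ^ t) z ⟩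
      factorials P t * (∏num N ^ t * ∏den P ^ t) * (σ ^ count P * σ ^ count N) * (x * z)
        ≡⟨ cong₂ (λ a b → factorials P t * a * b * (x * z)) (sym (^-distribʳ-* t (∏num N) (∏den P))) (sym (^-distribˡ-+-* σ (count P) (count N))) ⟩
      factorials P t * (∏num N * ∏den P) ^ t * σ ^ (count P + count N) * (x * z) ∎)
      where
      x = (t * β) ^ (t * weight P)
      z = α ^ (t * weight P)
      l1 : ∀ f a b x z → f * (a * b) * (x * z) ≡ f * (b * z) * (a * x)
      l1 = solve-∀
      l2 : ∀ s a x f r b z → s * (a * x) * (f * r * (b * z)) ≡ f * (a * b) * (r * s) * (x * z)
      l2 = solve-∀

-- Chebyshev's recursion for lcm (1, ..., n).

module Chebyshev where

  open Prelude
  open import Data.Nat.Divisibility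
  open import Data.Bool.Base using (true; false; if_then_else_; T)
  open import Relation.Nullary.Decidable using (from-yes)
  open VonMangoldt
  open CommonFactor
  open StirlingBounds
  open FactorialProducts

  ind : ℕ → ℕ → ℕ
  ind X k = if X ≤ᵇ k then 1 else 0

  ind-yes : ∀ {X k} → X ≤ k → ind X k ≡ 1
  ind-yes {X} {k} X≤k with X ≤ᵇ k in eq
  ... | true  = refl
  ... | false = contradiction (subst T eq (≤⇒≤ᵇ X≤k)) λ ()

  ind-no : ∀ {X k} → k < X → ind X k ≡ 0
  ind-no {X} {k} k<X with X ≤ᵇ k in eq
  ... | false = refl
  ... | true  = contradiction (≤ᵇ⇒≤ X k (subst T (sym eq) tt)) (<⇒≱ k<X)

  -- lcm (1, …, n)
  ψ : ℕ → ℕ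
  ψ n = ∏ (λ i → Λ (suc i)) n

  ∏-truncate : ∀ {f g : ℕ → ℕ} D E → E ≤ D → (∀ i → i < E → f i ≡ g i) → (∀ i → E ≤ i → f i ≡ 1) → ∏ f D ≡ ∏ g E
  ∏-truncate {f} {g} D E E≤D below above = go D E≤D
    where
    go : ∀ D → E ≤ D → ∏ f D ≡ ∏ g E
    go D E≤D with E ≟ D
    ... | yes refl = ∏-cong E below
    go zero    E≤D | no E≢D = contradiction (n≤0⇒n≡0 E≤D) E≢D
    go (suc D) E≤D | no E≢D = trans (cong₂ _*_ (go D E≤D′) (above D E≤D′)) (*-identityʳ _)
      where
      E≤D′ = ≤-pred (≤∧≢⇒< E≤D E≢D)

  -- The condition X ≤ ⌊n / d⌋ is the same as d ≤ ⌊n / X⌋.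
  ∏Λ-ind : ∀ X n D .{{_ : NonZero X}} → n / X ≤ D → ∏ (λ i → Λ (suc i) ^ ind X (n / suc i)) D ≡ ψ (n / X)
  ∏Λ-ind X n D n/X≤D = ∏-truncate D (n / X) n/X≤D below above
    where
    below : ∀ i → i < n / X → Λ (suc i) ^ ind X (n / suc i) ≡ Λ (suc i)
    below i i<n/X = trans (cong (Λ (suc i) ^_) (ind-yes X≤)) (^-identityʳ _)
      where
      X≤ : X ≤ n / suc i
      X≤ = ≤-trans (≤-reflexive (sym (m*n/n≡m X (suc i)))) (/-monoˡ-≤ (suc i)
        (≤-trans (≤-reflexive (*-comm X (suc i))) (≤-trans (*-monoˡ-≤ X i<n/X) (m/n*n≤m n X))))
    above : ∀ i → n / X ≤ i → Λ (suc i) ^ ind X (n / suc i) ≡ 1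
    above i n/X≤i = cong (Λ (suc i) ^_) (ind-no (m<n*o⇒m/o<n {n} {X} (<-≤-trans (m<suc[m/n]*n n X)
      (≤-trans (*-monoˡ-≤ X (s≤s n/X≤i)) (≤-reflexive (*-comm (suc i) X))))))

  -- Beyond `T₀` a step in t enlarges the slack by a factor of at most 1 + 1 / T₀, and (1 + 1 /
  -- T₀)^T₀ ≤ 4. A polynomial loss thus becomes an exponential one with the small rate of 2 / T₀
  -- bits, which can be compared with the main terms.
  slack-growth : ∀ T₀ .{{_ : NonZero T₀}} s → slack (s + T₀) ^ T₀ ≤ slack T₀ ^ T₀ * 4 ^ s
  slack-growth T₀ zero    = ≤-reflexive (sym (*-identityʳ (slack T₀ ^ T₀)))
  slack-growth T₀ (suc s) = *-cancelʳ-≤ _ _ (T₀ ^ T₀) {{m^n≢0 T₀ T₀}} (begin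
    slack (suc s + T₀) ^ T₀ * T₀ ^ T₀ ≡⟨ ^-distribʳ-* T₀ (slack (suc s + T₀)) T₀ ⟨
    (slack (suc s + T₀) * T₀) ^ T₀ ≤⟨ ^-monoˡ-≤ T₀ step ⟩
    (slack (s + T₀) * suc T₀) ^ T₀ ≡⟨ ^-distribʳ-* T₀ (slack (s + T₀)) (suc T₀) ⟩
    slack (s + T₀) ^ T₀ * suc T₀ ^ T₀ ≤⟨ *-mono-≤ (slack-growth T₀ s) (Stirling.α≤4β T₀) ⟩
    slack T₀ ^ T₀ * 4 ^ s * (4 * T₀ ^ T₀) ≡⟨ lem (slack T₀ ^ T₀) (4 ^ s) (T₀ ^ T₀) ⟩
    slack T₀ ^ T₀ * 4 ^ suc s * T₀ ^ T₀ ∎)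
    where
    open ≤-Reasoning
    lem : ∀ x y z → x * y * (4 * z) ≡ x * (4 * y) * z
    lem = solve-∀
    step : slack (suc s + T₀) * T₀ ≤ slack (s + T₀) * suc T₀
    step = subst₂ _≤_ (cong (_* T₀) (sym (slack-def (suc s + T₀)))) (cong (_* suc T₀) (sym (slack-def (s + T₀)))) (begin
      4 * suc (37 * (suc s + T₀)) * T₀ ≡⟨ l1 s T₀ ⟩
      4 * suc (37 * (s + T₀)) * T₀ + 148 * T₀ ≤⟨ +-monoʳ-≤ (4 * suc (37 * (s + T₀)) * T₀) (≤-trans (*-monoʳ-≤ 148 (m≤n+m T₀ s)) (m≤m+n (148 * (s + T₀)) 4)) ⟩
      4 * suc (37 * (s + T₀)) * T₀ + (148 * (s + T₀) + 4) ≡⟨ l2 s T₀ ⟩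
      4 * suc (37 * (s + T₀)) * suc T₀ ∎)
      where
      l1 : ∀ s T → 4 * suc (37 * (suc s + T)) * T ≡ 4 * suc (37 * (s + T)) * T + 148 * T
      l1 = solve-∀
      l2 : ∀ s T → 4 * suc (37 * (s + T)) * T + (148 * (s + T) + 4) ≡ 4 * suc (37 * (s + T)) * suc T
      l2 = solve-∀

  -- Chebyshev's inequality ψ(n) ≤ ψ(n / 6) n! ⌊n/30⌋! / (⌊n/2⌋! ⌊n/3⌋! ⌊n/5⌋!).
  chebyshev⁺ chebyshev⁻ : Terms
  chebyshev⁺ = term 1 0 30 (term 1 29 1 [])
  chebyshev⁻ = term 1 1 15 (term 1 2 10 (term 1 4 6 []))

  -- The function k - ⌊k/2⌋ - ⌊k/3⌋ - ⌊k/5⌋ + ⌊k/30⌋ has period 30, is nonnegative, and is at least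
  -- 1 for 1 ≤ k < 6. The first period is checked by computation; from 30 on both indicators are 1,
  -- and nonnegativity at the remainder is enough. The common factor 30 clears the denominators 2,
  -- 3, 5 and 30.
  chebyshev-floors : ∀ k → 30 * ind 1 k + (30 * (k / 2) + (30 * (k / 3) + (30 * (k / 5) + 0))) ≤ 30 * (k / 1) + (30 * (k / 30) + 0) + 30 * ind 6 k
  chebyshev-floors k with k / 30 in a≡ | k <? 30
  ... | a | yes k<30 = subst (λ z → 30 * ind 1 k + (30 * (k / 2) + (30 * (k / 3) + (30 * (k / 5) + 0))) ≤ 30 * (k / 1) + (30 * z + 0) + 30 * ind 6 k) (trans (sym (m<n⇒m/n≡0 k<30)) a≡)
        (allBelow k<30)
    where
    allBelow : ∀ {k} → k < 30 → 30 * ind 1 k + (30 * (k / 2) + (30 * (k / 3) + (30 * (k / 5) + 0))) ≤ 30 * (k / 1) + 0 + 30 * ind 6 k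
    allBelow = from-yes (allUpTo? (λ k → (30 * ind 1 k + (30 * (k / 2) + (30 * (k / 3) + (30 * (k / 5) + 0)))) ≤? (30 * (k / 1) + 0 + 30 * ind 6 k)) 30)
  ... | a | no k≮30 = begin
      30 * ind 1 k + (30 * (k / 2) + (30 * (k / 3) + (30 * (k / 5) + 0)))
        ≡⟨ cong₂ _+_ (cong (30 *_) (ind-yes {1} {k} (≤-trans (s≤s z≤n) (≮⇒≥ k≮30)))) (cong₂ _+_ (cong (30 *_) (part 15 2 refl)) (cong₂ _+_ (cong (30 *_) (part 10 3 refl)) (cong (λ z → 30 * z + 0) (part 6 5 refl)))) ⟩
      30 * 1 + (30 * (b / 2 + a * 15) + (30 * (b / 3 + a * 10) + (30 * (b / 5 + a * 6) + 0)))
        ≡⟨ l1 (b / 2) (b / 3) (b / 5) a ⟩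
      30 + 930 * a + 30 * (b / 2 + b / 3 + b / 5)
        ≤⟨ +-monoʳ-≤ (30 + 930 * a) (*-monoʳ-≤ 30 (rest (m%n<n k 30))) ⟩
      30 + 930 * a + 30 * b
        ≡⟨ l2 a b ⟩
      30 * (b + a * 30) + (30 * a + 0) + 30 * 1
        ≡⟨ cong₂ (λ x y → 30 * x + (30 * a + 0) + 30 * y) (trans (sym k≡) (sym (n/1≡n k))) (sym (ind-yes {6} {k} (≤-trans (m≤m+n 6 24) (≮⇒≥ k≮30)))) ⟩
      30 * (k / 1) + (30 * a + 0) + 30 * ind 6 k ∎
    where
    open ≤-Reasoning
    b = k % 30
    k≡ : k ≡ b + a * 30
    k≡ = trans (m≡m%n+[m/n]*n k 30) (cong (λ z → b + z * 30) a≡)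
    part : ∀ e d .{{_ : NonZero d}} → e * d ≡ 30 → k / d ≡ b / d + a * e
    part e d eq = trans (/-congˡ (trans k≡ (cong (b +_) (trans (cong (a *_) (sym eq)) (sym (*-assoc a e d))))))
      (trans (+-distrib-/-∣ʳ b (n∣m*n (a * e))) (cong (b / d +_) (m*n/n≡m (a * e) d)))
    rest : ∀ {b} → b < 30 → b / 2 + b / 3 + b / 5 ≤ b
    rest = from-yes (allUpTo? (λ b → (b / 2 + b / 3 + b / 5) ≤? b) 30)
    l1 : ∀ x y z a → 30 * 1 + (30 * (x + a * 15) + (30 * (y + a * 10) + (30 * (z + a * 6) + 0))) ≡ 30 + 930 * a + 30 * (x + y + z)
    l1 = solve-∀
    l2 : ∀ a b → 30 + 930 * a + 30 * b ≡ 30 * (b + a * 30) + (30 * a + 0) + 30 * 1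
    l2 = solve-∀

  ∏Λ-merge : ∀ (f g : ℕ → ℕ) D → ∏ (λ i → Λ (suc i) ^ f i) D * ∏ (λ i → Λ (suc i) ^ g i) D ≡ ∏ (λ i → Λ (suc i) ^ (f i + g i)) D
  ∏Λ-merge f g D = trans (sym (∏-* _ _ D)) (∏-cong D (λ i _ → sym (^-distribˡ-+-* (Λ (suc i)) (f i) (g i))))

  ∏Λ-scale : ∀ (f : ℕ → ℕ) k D → ∏ (λ i → Λ (suc i) ^ f i) D ^ k ≡ ∏ (λ i → Λ (suc i) ^ (k * f i)) D
  ∏Λ-scale f k D = trans (∏-^ _ k D) (∏-cong D (λ i _ → trans (^-*-assoc (Λ (suc i)) (f i) k) (cong (Λ (suc i) ^_) (*-comm (f i) k))))

  ∏Λ-mono : ∀ {f g : ℕ → ℕ} D → (∀ i → f i ≤ g i) → ∏ (λ i → Λ (suc i) ^ f i) D ≤ ∏ (λ i → Λ (suc i) ^ g i) D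
  ∏Λ-mono D f≤g = ∏-mono D (λ i → ^-monoʳ-≤ (Λ (suc i)) {{>-nonZero (Λ≥1 (suc i))}} (f≤g i))

  factorials≥1 : ∀ L t → 1 ≤ factorials L t
  factorials≥1 []          t = ≤-refl
  factorials≥1 (term q m c L) t = *-mono-≤ (m^n>0 _ {{(q * t / suc m) !≢0}} (suc m * c)) (factorials≥1 L t)

  ψ-factorials : ∀ P N k X .{{_ : NonZero X}} n → Admissible n P → Admissible n N →
    (∀ i → k * ind 1 (n / suc i) + floors N n i ≤ floors P n i + k * ind X (n / suc i)) →
    ψ n ^ k * factorials N n ≤ factorials P n * ψ (n / X) ^ k
  ψ-factorials P N k X n admP admN ineq = begin
    ψ n ^ k * factorials N n
      ≡⟨ cong₂ (λ x y → x ^ k * y) (trans (cong ψ (sym (n/1≡n n))) (sym (∏Λ-ind 1 n D (≤-trans (m/n≤m n 1) (m≤n*m n 37)))))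
                   (factorials-∏Λ N n admN) ⟩
    ∏ (λ i → Λ (suc i) ^ ind 1 (n / suc i)) D ^ k * ∏ (λ i → Λ (suc i) ^ floors N n i) D
      ≡⟨ cong (_* ∏ (λ i → Λ (suc i) ^ floors N n i) D) (∏Λ-scale (λ i → ind 1 (n / suc i)) k D) ⟩
    ∏ (λ i → Λ (suc i) ^ (k * ind 1 (n / suc i))) D * ∏ (λ i → Λ (suc i) ^ floors N n i) D
      ≡⟨ ∏Λ-merge (λ i → k * ind 1 (n / suc i)) (floors N n) D ⟩
    ∏ (λ i → Λ (suc i) ^ (k * ind 1 (n / suc i) + floors N n i)) D
      ≤⟨ ∏Λ-mono {λ i → k * ind 1 (n / suc i) + floors N n i} {λ i → floors P n i + k * ind X (n / suc i)} D ineq ⟩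
    ∏ (λ i → Λ (suc i) ^ (floors P n i + k * ind X (n / suc i))) D
      ≡⟨ ∏Λ-merge (floors P n) (λ i → k * ind X (n / suc i)) D ⟨
    ∏ (λ i → Λ (suc i) ^ floors P n i) D * ∏ (λ i → Λ (suc i) ^ (k * ind X (n / suc i))) D
      ≡⟨ cong (∏ (λ i → Λ (suc i) ^ floors P n i) D *_) (∏Λ-scale (λ i → ind X (n / suc i)) k D) ⟨
    ∏ (λ i → Λ (suc i) ^ floors P n i) D * ∏ (λ i → Λ (suc i) ^ ind X (n / suc i)) D ^ k
      ≡⟨ cong₂ (λ x y → x * y ^ k) (sym (factorials-∏Λ P n admP)) (∏Λ-ind X n D (≤-trans (m/n≤m n X) (m≤n*m n 37))) ⟩
    factorials P n * ψ (n / X) ^ k ∎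
    where
    open ≤-Reasoning
    D = 37 * n

  ψ-recursion : ∀ P N k X .{{_ : NonZero X}} n .{{_ : NonZero n}} → Admissible n P → Admissible n N → weight N ≡ weight P →
    (∀ i → k * ind 1 (n / suc i) + floors N n i ≤ floors P n i + k * ind X (n / suc i)) →
    ψ n ^ k * (∏num N * ∏den P) ^ n ≤ (∏num P * ∏den N) ^ n * slack n ^ (count N + count P) * ψ (n / X) ^ k
  ψ-recursion P N k X n admP admN wt ineq = go (factorials N n) (factorials P n) {ψ n ^ k} (factorials≥1 N n)
      (ψ-factorials P N k X n admP admN ineq) (factorials-ratio n N P admN admP wt)
    where
    open ≤-Reasoning
    go : ∀ F⁻ F⁺ {x y B C σ} → 1 ≤ F⁻ → x * F⁻ ≤ F⁺ * y → F⁺ * B ≤ F⁻ * C * σ → x * B ≤ C * σ * y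
    go F⁻ F⁺ {x} {y} {B} {C} {σ} 1≤F⁻ h₁ h₂ = *-cancelˡ-≤ F⁻ {{>-nonZero 1≤F⁻}} (begin
      F⁻ * (x * B) ≡⟨ l1 F⁻ x B ⟩
      x * F⁻ * B ≤⟨ *-monoˡ-≤ B h₁ ⟩
      F⁺ * y * B ≡⟨ l2 F⁺ y B ⟩
      F⁺ * B * y ≤⟨ *-monoˡ-≤ y h₂ ⟩
      F⁻ * C * σ * y   ≡⟨ l3 F⁻ C σ y ⟩
      F⁻ * (C * σ * y) ∎)
      where
      l1 : ∀ a b c → a * (b * c) ≡ b * a * c
      l1 = solve-∀
      l2 : ∀ a b c → a * b * c ≡ a * c * b
      l2 = solve-∀
      l3 : ∀ a b c d → a * b * c * d ≡ a * (b * c * d)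
      l3 = solve-∀

-- The explicit bound ψ(n) ≤ 2^(49 n / 30).

module ChebyshevBound where

  open Prelude
  open import Data.Nat.Divisibility
  open import Data.Nat.Primality
  open import Data.Nat.Induction using (<-wellFounded)
  open import Induction.WellFounded using (Acc; acc)
  open import Data.Bool.Base using (Bool; true; _∧_; T)
  open import Data.Bool.Properties using (T-≡; T-∧)
  open import Data.List.Base using (List; []; _∷_)
  open import Data.List.Relation.Unary.All using (All; []; _∷_; all?)
  open import Function.Bundles using (Equivalence)
  open import Relation.Nullary.Decidable using (from-yes)
  open VonMangoldt
  open CommonFactor
  open StirlingBounds
  open FactorialProducts
  open Chebyshev

  ^-cancel-≤ : ∀ k .{{_ : NonZero k}} {x y} → x ^ k ≤ y ^ k → x ≤ y
  ^-cancel-≤ k x^k≤y^k = ≮⇒≥ λ y<x → <⇒≱ (^-monoˡ-< k y<x) x^k≤y^k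

  Λ≤ : ∀ d → 1 ≤ d → Λ d ≤ d
  Λ≤ d 1≤d with primePower? d
  ... | yes (p , e , pp , refl) = m≤m*n p (p ^ e) {{m^n≢0 p e {{prime⇒nonZero pp}}}}
  ... | no _ = 1≤d

  Λ-twoPrimes : ∀ {p} k r → Prime p → ¬ p ∣ r → r ≢ 1 → Λ (p ^ suc k * r) ≡ 1
  Λ-twoPrimes {p} k r pp p∤r r≢1 = Λ-¬primePower λ { (ρ , e , pρ , eq) →
    let p≡ρ = prime∣prime⇒≡ pp pρ (prime∣^⇒∣ ρ (suc e) pp (subst (p ∣_) eq (∣m⇒∣m*n r (m∣m*n (p ^ k)))))
        r∣p^ = subst (λ z → r ∣ z ^ suc e) (sym p≡ρ) (subst (r ∣_) eq (n∣m*n (p ^ suc k)))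
    in r≢1 (∣p^⇒≡1 (suc e) r∣p^) }
    where
    ∣p^⇒≡1 : ∀ e → r ∣ p ^ e → r ≡ 1
    ∣p^⇒≡1 zero    r∣1 = ∣1⇒≡1 r∣1
    ∣p^⇒≡1 (suc e) r∣  = ∣p^⇒≡1 e (Coprimality.coprime-divisor (Coprimality.sym (prime∤⇒coprime pp p∤r)) r∣)
      where import Data.Nat.Coprimality as Coprimality

  -- d with all factors p removed (as long as the fuel lasts).
  strip : ℕ → (p : ℕ) .{{_ : NonZero p}} → ℕ → ℕ
  strip zero       p d = d
  strip (suc fuel) p d with d % p
  ... | zero  = strip fuel p (d / p)
  ... | suc _ = d

  strip-spec : ∀ fuel p .{{_ : NonZero p}} d → ∃ λ k → d ≡ p ^ k * strip fuel p d
  strip-spec zero       p d = 0 , sym (+-identityʳ d)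
  strip-spec (suc fuel) p d with d % p in eq
  ... | suc _ = 0 , sym (+-identityʳ d)
  ... | zero with strip-spec fuel p (d / p)
  ... | k , d/p≡ = suc k , trans (sym (m*[n/m]≡n (m%n≡0⇒n∣m d p eq))) (trans (cong (p *_) d/p≡) (sym (*-assoc p (p ^ k) _)))

  -- An upper bound for Λ, exact as long as the list contains the least prime factor of d.
  Λ⁺-by : ℕ → ℕ → ℕ → ℕ → ℕ
  Λ⁺-by p d zero          _       = d
  Λ⁺-by p d (suc zero)    _       = p
  Λ⁺-by p d (suc (suc _)) zero    = d
  Λ⁺-by p d (suc (suc _)) (suc _) = 1

  Λ⁺ : List ℕ → ℕ → ℕ
  Λ⁺-test : (p : ℕ) .{{_ : NonZero p}} → List ℕ → ℕ → ℕ → ℕ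
  Λ⁺ []             d = d
  Λ⁺ (zero ∷ ps)    d = d
  Λ⁺ (suc p ∷ ps)   d = Λ⁺-test (suc p) ps d (d % suc p)
  Λ⁺-test p ps d (suc _) = Λ⁺ ps d
  Λ⁺-test p ps d zero    = Λ⁺-by p d (strip 13 p d) (strip 13 p d % p)

  Λ≤Λ⁺-by : ∀ {p d} .{{_ : NonZero p}} → Prime p → p ∣ d → 1 ≤ d → ∀ k r ρ → d ≡ p ^ k * r → r % p ≡ ρ → Λ d ≤ Λ⁺-by p d r ρ
  Λ≤Λ⁺-by {p} {d} pp p∣d 1≤d k zero          ρ       eq r%p = Λ≤ d 1≤d
  Λ≤Λ⁺-by {p} {d} pp p∣d 1≤d k (suc (suc _)) zero    eq r%p = Λ≤ d 1≤d
  Λ≤Λ⁺-by {p} {d} pp p∣d 1≤d zero    (suc zero) ρ refl r%p with refl ← ∣1⇒≡1 p∣d = contradiction pp ¬prime[1]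
  Λ≤Λ⁺-by {p} {d} pp p∣d 1≤d (suc k) (suc zero) ρ eq r%p = ≤-reflexive (trans (cong Λ (trans eq (*-identityʳ (p ^ suc k)))) (Λ-prime^ k pp))
  Λ≤Λ⁺-by {p} {d} pp p∣d 1≤d zero r@(suc (suc _)) (suc _) eq r%p =
    contradiction (trans (sym r%p) (n∣m⇒m%n≡0 r p (subst (p ∣_) (trans eq (+-identityʳ r)) p∣d))) λ ()
  Λ≤Λ⁺-by {p} {d} pp p∣d 1≤d (suc k) r@(suc (suc _)) (suc _) eq r%p = ≤-reflexive (trans (cong Λ eq) (Λ-twoPrimes k r pp
    (λ p∣r → contradiction (trans (sym r%p) (n∣m⇒m%n≡0 r p p∣r)) λ ()) λ ()))

  Λ≤Λ⁺ : ∀ ps → All Prime ps → ∀ d → 1 ≤ d → Λ d ≤ Λ⁺ ps d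
  Λ≤Λ⁺-test : ∀ p .{{_ : NonZero p}} ps → Prime p → All Prime ps → ∀ d → 1 ≤ d → ∀ ρ → d % p ≡ ρ → Λ d ≤ Λ⁺-test p ps d ρ
  Λ≤Λ⁺ []           []         d 1≤d = Λ≤ d 1≤d
  Λ≤Λ⁺ (zero ∷ ps)  _          d 1≤d = Λ≤ d 1≤d
  Λ≤Λ⁺ (suc p ∷ ps) (pp ∷ pps) d 1≤d = Λ≤Λ⁺-test (suc p) ps pp pps d 1≤d (d % suc p) refl
  Λ≤Λ⁺-test p ps pp pps d 1≤d (suc _) _   = Λ≤Λ⁺ ps pps d 1≤d
  Λ≤Λ⁺-test p ps pp pps d 1≤d zero    d%p =
    Λ≤Λ⁺-by pp (m%n≡0⇒n∣m d p d%p) 1≤d (proj₁ (strip-spec 13 p d)) (strip 13 p d) (strip 13 p d % p) (proj₂ (strip-spec 13 p d)) refl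

  ψ-check : List ℕ → ℕ → ℕ → ℕ → ℕ → Bool
  ψ-check ps zero    i x y = true
  ψ-check ps (suc k) i x y = (x ^ 30 ≤ᵇ y) ∧ ψ-check ps k (suc i) (x * Λ⁺ ps (suc i)) (y * 2 ^ 49)

  ψ-check-sound : ∀ ps → All Prime ps → ∀ k i x y → ψ i ≤ x → y ≡ 2 ^ (49 * i) → ψ-check ps k i x y ≡ true →
    ∀ n → i ≤ n → n < k + i → ψ n ^ 30 ≤ 2 ^ (49 * n)
  ψ-check-sound ps pps zero i x y ψ≤x y≡ ok n i≤n n<i = contradiction i≤n (<⇒≱ n<i)
  ψ-check-sound ps pps (suc k) i x y ψ≤x y≡ ok n i≤n n<k+i with Equivalence.to T-∧ (subst T (sym ok) tt) | i ≟ n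
  ... | here , _ | yes refl = ≤-trans (^-monoˡ-≤ 30 ψ≤x) (≤-trans (≤ᵇ⇒≤ (x ^ 30) y here) (≤-reflexive y≡))
  ... | _ , there | no i≢n = ψ-check-sound ps pps k (suc i) (x * Λ⁺ ps (suc i)) (y * 2 ^ 49) (*-mono-≤ ψ≤x (Λ≤Λ⁺ ps pps (suc i) (s≤s z≤n)))
      (trans (cong (_* 2 ^ 49) y≡) (trans (sym (^-distribˡ-+-* 2 (49 * i) 49)) (cong (2 ^_) (lem i)))) (Equivalence.to T-≡ there) n (≤∧≢⇒< i≤n i≢n)
      (subst (n <_) (sym (+-suc k i)) n<k+i)
    where
    lem : ∀ i → 49 * i + 49 ≡ 49 * suc i
    lem = solve-∀

  -- As 59^2 > 3000, every composite number below 3000 has a prime factor in this list, so `Λ⁺` is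
  -- exact in the range of `ψ-small`. The fuel 13 suffices there because 2^12 > 3000.
  primes : List ℕ
  primes = 2 ∷ 3 ∷ 5 ∷ 7 ∷ 11 ∷ 13 ∷ 17 ∷ 19 ∷ 23 ∷ 29 ∷ 31 ∷ 37 ∷ 41 ∷ 43 ∷ 47 ∷ 53 ∷ []

  primes-prime : All Prime primes
  primes-prime = from-yes (all? prime? primes)

  ψ-small : ∀ n → n < 3000 → ψ n ^ 30 ≤ 2 ^ (49 * n)
  ψ-small n n<3000 = ψ-check-sound primes primes-prime 3000 0 1 1 ≤-refl refl refl n z≤n (subst (n <_) refl n<3000)

  -- Raising to the power u = 6 w makes the exponents integral; the losses are absorbed since C < R.
  ψ-step : ∀ T₀ .{{_ : NonZero T₀}} s {X Y B C L e u v w a σ₀} .{{_ : NonZero B}} .{{_ : NonZero u}} →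
    let instance n≢0 = >-nonZero (≤-trans (>-nonZero⁻¹ T₀) (m≤n+m T₀ s)) ; n = s + T₀ in
    X * B ^ n ≤ C ^ n * slack n ^ e * Y → Y ≤ 2 ^ (L * (n / 6)) →
    e * u ≡ T₀ * v → 6 * w ≡ u → a + L * w ≡ L * u →
    C ^ u * 4 ^ v ≤ 2 ^ a * B ^ u → slack T₀ ≤ σ₀ → C ^ u * σ₀ ^ v ≤ 2 ^ a * B ^ u →
    X ≤ 2 ^ (L * n)
  ψ-step T₀ s {X} {Y} {B} {C} {L} {e} {u} {v} {w} {a} {σ₀} hX hY eu wu aL step σ≤ base₀ =
    ^-cancel-≤ u (*-cancelʳ-≤ _ _ ((B ^ n) ^ u) {{m^n≢0 (B ^ n) u {{m^n≢0 B n}}}} (begin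
    X ^ u * (B ^ n) ^ u ≡⟨ ^-distribʳ-* u _ _ ⟨
    (X * B ^ n) ^ u ≤⟨ ^-monoˡ-≤ u (≤-trans hX (*-monoʳ-≤ (C ^ n * σ ^ e) hY)) ⟩
    (C ^ n * σ ^ e * 2 ^ (L * (n / 6))) ^ u ≡⟨ trans (^-distribʳ-* u _ _) (cong₂ _*_ (^-distribʳ-* u _ _) (^-*-assoc 2 (L * (n / 6)) u)) ⟩
    (C ^ n) ^ u * (σ ^ e) ^ u * 2 ^ (L * (n / 6) * u) ≤⟨ *-mono-≤ (*-mono-≤ (≤-reflexive (^-swap C n u)) slack≤) (^-monoʳ-≤ 2 six) ⟩
    (C ^ u) ^ n * ((slack T₀ ^ v) ^ T₀ * (4 ^ v) ^ s) * 2 ^ (L * w * n)  ≡⟨ cong (λ z → z * ((slack T₀ ^ v) ^ T₀ * (4 ^ v) ^ s) * 2 ^ (L * w * n)) (^-distribˡ-+-* (C ^ u) s T₀) ⟩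
    (C ^ u) ^ s * (C ^ u) ^ T₀ * ((slack T₀ ^ v) ^ T₀ * (4 ^ v) ^ s) * 2 ^ (L * w * n) ≡⟨ cong (_* 2 ^ (L * w * n)) (trans (l1 ((C ^ u) ^ s) ((C ^ u) ^ T₀) ((slack T₀ ^ v) ^ T₀) ((4 ^ v) ^ s)) (cong₂ _*_ (sym (^-distribʳ-* s (C ^ u) (4 ^ v))) (sym (^-distribʳ-* T₀ (C ^ u) (slack T₀ ^ v))))) ⟩
    (C ^ u * 4 ^ v) ^ s * (C ^ u * slack T₀ ^ v) ^ T₀ * 2 ^ (L * w * n) ≤⟨ *-monoˡ-≤ (2 ^ (L * w * n)) (*-mono-≤ (^-monoˡ-≤ s step) (^-monoˡ-≤ T₀ base)) ⟩
    R ^ s * R ^ T₀ * 2 ^ (L * w * n) ≡⟨ cong (_* 2 ^ (L * w * n)) (^-distribˡ-+-* R s T₀) ⟨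
    R ^ n * 2 ^ (L * w * n) ≡⟨ cong (_* 2 ^ (L * w * n)) (trans (^-distribʳ-* n (2 ^ a) (B ^ u)) (cong₂ _*_ (^-*-assoc 2 a n) (^-swap B u n))) ⟩
    2 ^ (a * n) * (B ^ n) ^ u * 2 ^ (L * w * n) ≡⟨ l2 (2 ^ (a * n)) ((B ^ n) ^ u) (2 ^ (L * w * n)) ⟩
    2 ^ (a * n) * 2 ^ (L * w * n) * (B ^ n) ^ u ≡⟨ cong (_* (B ^ n) ^ u) (trans (sym (^-distribˡ-+-* 2 (a * n) (L * w * n))) (trans (cong (2 ^_) l3) (sym (^-*-assoc 2 (L * n) u)))) ⟩
    (2 ^ (L * n)) ^ u * (B ^ n) ^ u ∎))
    where
    open ≤-Reasoning
    instance
      n≢0 = >-nonZero (≤-trans (>-nonZero⁻¹ T₀) (m≤n+m T₀ s))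
    n = s + T₀
    R = 2 ^ a * B ^ u
    base : C ^ u * slack T₀ ^ v ≤ R
    base = ≤-trans (*-monoʳ-≤ (C ^ u) (^-monoˡ-≤ v σ≤)) base₀
    σ = slack n
    slack≤ : (σ ^ e) ^ u ≤ (slack T₀ ^ v) ^ T₀ * (4 ^ v) ^ s
    slack≤ = begin
      (σ ^ e) ^ u ≡⟨ trans (^-*-assoc σ e u) (trans (cong (σ ^_) eu) (sym (^-*-assoc σ T₀ v))) ⟩
      (σ ^ T₀) ^ v ≤⟨ ^-monoˡ-≤ v (slack-growth T₀ s) ⟩
      (slack T₀ ^ T₀ * 4 ^ s) ^ v ≡⟨ trans (^-distribʳ-* v (slack T₀ ^ T₀) (4 ^ s)) (cong₂ _*_ (^-swap (slack T₀) T₀ v) (^-swap 4 s v)) ⟩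
      (slack T₀ ^ v) ^ T₀ * (4 ^ v) ^ s ∎
    six : L * (n / 6) * u ≤ L * w * n
    six = begin
      L * (n / 6) * u ≡⟨ cong (L * (n / 6) *_) (sym wu) ⟩
      L * (n / 6) * (6 * w)   ≡⟨ l4 L (n / 6) w ⟩
      L * w * (n / 6 * 6) ≤⟨ *-monoʳ-≤ (L * w) (m/n*n≤m n 6) ⟩
      L * w * n ∎
      where
      l4 : ∀ L x w → L * x * (6 * w) ≡ L * w * (x * 6)
      l4 = solve-∀
    l1 : ∀ a b c d → a * b * (c * d) ≡ a * d * (b * c)
    l1 = solve-∀
    l2 : ∀ a b c → a * b * c ≡ a * c * b
    l2 = solve-∀
    l3 : a * n + L * w * n ≡ L * n * u
    l3 = trans (sym (*-distribʳ-+ n a (L * w))) (trans (cong (_* n) aL) (l5 L u n))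
      where
      l5 : ∀ L u n → L * u * n ≡ L * n * u
      l5 = solve-∀

  ψ-induct : ∀ P N k T₀ .{{_ : NonZero T₀}} s {L u v w a σ₀} .{{_ : NonZero (∏num N * ∏den P)}} .{{_ : NonZero u}} →
    Admissible (s + T₀) P → Admissible (s + T₀) N → weight N ≡ weight P →
    (∀ i → k * ind 1 ((s + T₀) / suc i) + floors N (s + T₀) i ≤ floors P (s + T₀) i + k * ind 6 ((s + T₀) / suc i)) →
    (count N + count P) * u ≡ T₀ * v → 6 * w ≡ u → a + L * w ≡ L * u →
    (∏num P * ∏den N) ^ u * 4 ^ v ≤ 2 ^ a * (∏num N * ∏den P) ^ u →
    slack T₀ ≤ σ₀ → (∏num P * ∏den N) ^ u * σ₀ ^ v ≤ 2 ^ a * (∏num N * ∏den P) ^ u →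
    ψ ((s + T₀) / 6) ^ k ≤ 2 ^ (L * ((s + T₀) / 6)) → ψ (s + T₀) ^ k ≤ 2 ^ (L * (s + T₀))
  ψ-induct P N k T₀ s {L} {u} {v} {w} {a} {σ₀} admP admN wt ineq h₁ h₂ h₃ h₄ h₅ h₆ ih =
    ψ-step T₀ s {L = L} {e = count N + count P} {u} {v} {w} {a} {σ₀} (ψ-recursion P N k 6 (s + T₀) {{n≢0}} admP admN wt ineq) ih h₁ h₂ h₃ h₄ h₅ h₆
    where n≢0 = >-nonZero (≤-trans (>-nonZero⁻¹ T₀) (m≤n+m T₀ s))

  ψ-large : ∀ s → ψ ((s + 3000) / 6) ^ 30 ≤ 2 ^ (49 * ((s + 3000) / 6)) → ψ (s + 3000) ^ 30 ≤ 2 ^ (49 * (s + 3000))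
  -- Chebyshev's lists have counts 60 and 90, whence 150 · 60 = 3000 · 3; further 60 = 6 · 10, 2450
  -- = 49 · 60 - 49 · 10 and 444004 = `slack 3000`.
  ψ-large s = ψ-induct chebyshev⁺ chebyshev⁻ 30 3000 s {49} {60} {3} {10} {2450} {444004} adm⁺ adm⁻ refl
      (λ i → subst (λ z → 30 * ind 1 (z / suc i) + floors chebyshev⁻ n i ≤ floors chebyshev⁺ n i + 30 * ind 6 (z / suc i)) (*-identityˡ n) (chebyshev-floors (1 * n / suc i)))
      refl refl refl (≤ᵇ⇒≤ _ _ tt) (≤-reflexive (slack-def 3000)) (≤ᵇ⇒≤ _ _ tt)
    where
    n = s + 3000
    120≤n : 120 ≤ 1 * n
    120≤n = ≤-trans (m≤m+n 120 2880) (≤-trans (m≤n+m 3000 s) (≤-reflexive (sym (+-identityʳ n))))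
    le : ∀ a → a ≤ 120 → a ≤ 1 * n
    le a a≤ = ≤-trans a≤ 120≤n
    1≤37 : 1 ≤ 37
    1≤37 = s≤s z≤n
    adm⁺ : Admissible n chebyshev⁺
    adm⁺ = 1≤37 , le 4 (m≤m+n 4 116) , 1≤37 , le 120 ≤-refl , tt
    adm⁻ : Admissible n chebyshev⁻
    adm⁻ = 1≤37 , le 8 (m≤m+n 8 112) , 1≤37 , le 12 (m≤m+n 12 108) , 1≤37 , le 20 (m≤m+n 20 100) , tt

  -- Iterating n ↦ n / 6 multiplies Chebyshev's exponent by 6/5, which without losses gives 30 · 6/5
  -- · log₂ (2^(1/2) 3^(1/3) 5^(1/5) / 30^(1/30)) ≈ 47.85; the value 49 leaves room for the slack
  -- from n = 3000 on.
  ψ-bound : ∀ n → ψ n ^ 30 ≤ 2 ^ (49 * n)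
  ψ-bound n = go n (<-wellFounded n)
    where
    go : ∀ n → Acc _<_ n → ψ n ^ 30 ≤ 2 ^ (49 * n)
    go n (acc rs) with n <? 3000
    ... | yes n<3000 = ψ-small n n<3000
    ... | no  n≮3000 = subst (λ z → ψ z ^ 30 ≤ 2 ^ (49 * z)) n≡ (ψ-large (n ∸ 3000) (go ((n ∸ 3000 + 3000) / 6) (rs n/6<n)))
      where
      n≡ : n ∸ 3000 + 3000 ≡ n
      n≡ = m∸n+n≡m (≮⇒≥ n≮3000)
      n/6<n : (n ∸ 3000 + 3000) / 6 < n
      n/6<n = subst (λ z → z / 6 < n) (sym n≡) (m/n<m n 6 {{>-nonZero (≤-trans (s≤s z≤n) (≮⇒≥ n≮3000))}} (s≤s (s≤s z≤n)))

-- Certificates for lower bounds of `padéG` and their reduction to finitely many sample points.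

module Certificates where

  open Prelude
  open import Agda.Builtin.Nat using (div-helper)
  open import Data.Bool.Base using (Bool; true; _∧_; T)
  open import Data.Bool.Properties using (T-≡; T-∧)
  open import Function.Bundles using (Equivalence)
  open VonMangoldt
  open CommonFactor
  open Padé
  open StirlingBounds
  open FactorialProducts
  open Chebyshev
  open ChebyshevBound

  -- level X z L allows the excess suc X * z at the moduli d with suc X ≤ t / d.
  data Levels : Set where
    []    : Levels
    level : (X z : ℕ) → Levels → Levels

  allowance : Levels → ℕ → ℕ
  allowance []            n = 0
  allowance (level X z L) n = suc X * z * ind (suc X) n + allowance L n

  ψ-levels : Levels → ℕ → ℕ
  ψ-levels []            t = 1
  ψ-levels (level X z L) t = ψ (t / suc X) ^ (suc X * z) * ψ-levels L t

  cost : Levels → ℕ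
  cost []            = 0
  cost (level X z L) = z + cost L

  ψ-levels-∏Λ : ∀ L t → ψ-levels L t ≡ ∏ (λ i → Λ (suc i) ^ allowance L (t / suc i)) (37 * t)
  ψ-levels-∏Λ []            t = sym (∏-1 (37 * t) (λ _ _ → refl))
  ψ-levels-∏Λ (level X z L) t = begin
    ψ (t / suc X) ^ e * ψ-levels L t
      ≡⟨ cong₂ (λ x y → x ^ e * y) (sym (∏Λ-ind (suc X) t (37 * t) (≤-trans (m/n≤m t (suc X)) (m≤n*m t 37)))) (ψ-levels-∏Λ L t) ⟩
    ∏ (λ i → Λ (suc i) ^ ind (suc X) (t / suc i)) (37 * t) ^ e * ∏ (λ i → Λ (suc i) ^ allowance L (t / suc i)) (37 * t)
      ≡⟨ cong (_* ∏ (λ i → Λ (suc i) ^ allowance L (t / suc i)) (37 * t)) (∏Λ-scale (λ i → ind (suc X) (t / suc i)) e (37 * t)) ⟩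
    ∏ (λ i → Λ (suc i) ^ (e * ind (suc X) (t / suc i))) (37 * t) * ∏ (λ i → Λ (suc i) ^ allowance L (t / suc i)) (37 * t)
      ≡⟨ ∏Λ-merge (λ i → e * ind (suc X) (t / suc i)) (λ i → allowance L (t / suc i)) (37 * t) ⟩
    ∏ (λ i → Λ (suc i) ^ allowance (level X z L) (t / suc i)) (37 * t) ∎
    where
    open ≡-Reasoning
    e = suc X * z

  -- The factor `suc X` in the exponent cancels against the argument `t / suc X`: a level costs 49 z
  -- / 30 bits per unit of t whatever `X` is. A larger `X` thus buys a larger excess, at fewer
  -- moduli.
  ψ-levels-bound : ∀ L t → ψ-levels L t ^ 30 ≤ 2 ^ (49 * (t * cost L))
  ψ-levels-bound []            t = ≤-trans (≤-reflexive (^-zeroˡ 30)) (m^n>0 2 (49 * (t * 0)))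
  ψ-levels-bound (level X z L) t = begin
    (ψ n ^ (suc X * z) * ψ-levels L t) ^ 30 ≡⟨ ^-distribʳ-* 30 (ψ n ^ (suc X * z)) (ψ-levels L t) ⟩
    (ψ n ^ (suc X * z)) ^ 30 * ψ-levels L t ^ 30 ≡⟨ cong (_* ψ-levels L t ^ 30) (^-swap (ψ n) (suc X * z) 30) ⟩
    (ψ n ^ 30) ^ (suc X * z) * ψ-levels L t ^ 30 ≤⟨ *-mono-≤ (^-monoˡ-≤ (suc X * z) (ψ-bound n)) (ψ-levels-bound L t) ⟩
    (2 ^ (49 * n)) ^ (suc X * z) * 2 ^ (49 * (t * cost L)) ≡⟨ cong (_* 2 ^ (49 * (t * cost L))) (^-*-assoc 2 (49 * n) (suc X * z)) ⟩
    2 ^ (49 * n * (suc X * z)) * 2 ^ (49 * (t * cost L))  ≤⟨ *-monoˡ-≤ (2 ^ (49 * (t * cost L))) (^-monoʳ-≤ 2 exps) ⟩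
    2 ^ (49 * (t * z)) * 2 ^ (49 * (t * cost L)) ≡⟨ ^-distribˡ-+-* 2 (49 * (t * z)) (49 * (t * cost L)) ⟨
    2 ^ (49 * (t * z) + 49 * (t * cost L)) ≡⟨ cong (2 ^_) (l2 t z (cost L)) ⟩
    2 ^ (49 * (t * (z + cost L))) ∎
    where
    open ≤-Reasoning
    n = t / suc X
    exps : 49 * n * (suc X * z) ≤ 49 * (t * z)
    exps = ≤-trans (≤-reflexive (l1 n (suc X) z)) (*-monoʳ-≤ 49 (*-monoˡ-≤ z (m/n*n≤m t (suc X))))
      where
      l1 : ∀ n x z → 49 * n * (x * z) ≡ 49 * (n * x * z)
      l1 = solve-∀
    l2 : ∀ t z c → 49 * (t * z) + 49 * (t * c) ≡ 49 * (t * (z + c))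
    l2 = solve-∀

  padéG-∏Λ : ∀ t → padéG t ≡ ∏ (λ i → Λ (suc i) ^ carries (9 * t) (16 * t) (12 * t) (suc i)) (37 * t)
  padéG-∏Λ t = cong (∏ (λ i → Λ (suc i) ^ carries (9 * t) (16 * t) (12 * t) (suc i))) (lem t)
    where
    lem : ∀ t → 9 * t + 16 * t + 12 * t ≡ 37 * t
    lem = solve-∀

  -- Demanded at every modulus, prime power or not, so that a check involves floors only. The excess
  -- `z₀` is tolerated at all moduli up to 37 t and is paid for by `ψ (37 * t) ^ z₀`.
  Certifies : Terms → Terms → ℕ → ℕ → Levels → ℕ → ℕ → Set
  Certifies P N S z₀ L t i =
    floors P t i ≤ floors N t i + (S * carries (9 * t) (16 * t) (12 * t) (suc i) + (z₀ + allowance L (t / suc i)))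

  certificate-bound : ∀ P N S z₀ L t → Admissible t P → Admissible t N → (∀ i → Certifies P N S z₀ L t i) →
    factorials P t ≤ factorials N t * (padéG t ^ S * (ψ (37 * t) ^ z₀ * ψ-levels L t))
  certificate-bound P N S z₀ L t admP admN cert = begin
    factorials P t ≡⟨ factorials-∏Λ P t admP ⟩
    ∏ (λ i → Λ (suc i) ^ floors P t i) D ≤⟨ ∏Λ-mono {floors P t} {λ i → floors N t i + (S * κ i + (z₀ + ℓ i))} D cert ⟩
    ∏ (λ i → Λ (suc i) ^ (floors N t i + (S * κ i + (z₀ + ℓ i)))) D ≡⟨ ∏Λ-merge (floors N t) (λ i → S * κ i + (z₀ + ℓ i)) D ⟨
    ∏ (λ i → Λ (suc i) ^ floors N t i) D * ∏ (λ i → Λ (suc i) ^ (S * κ i + (z₀ + ℓ i))) D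
      ≡⟨ cong₂ _*_ (sym (factorials-∏Λ N t admN)) (sym (∏Λ-merge (λ i → S * κ i) (λ i → z₀ + ℓ i) D)) ⟩
    factorials N t * (∏ (λ i → Λ (suc i) ^ (S * κ i)) D * ∏ (λ i → Λ (suc i) ^ (z₀ + ℓ i)) D)
      ≡⟨ cong₂ (λ x y → factorials N t * (x * y)) (trans (sym (∏Λ-scale κ S D)) (cong (_^ S) (sym (padéG-∏Λ t)))) (sym (∏Λ-merge (λ _ → z₀) ℓ D)) ⟩
    factorials N t * (padéG t ^ S * (∏ (λ i → Λ (suc i) ^ z₀) D * ∏ (λ i → Λ (suc i) ^ ℓ i) D))
      ≡⟨ cong₂ (λ x y → factorials N t * (padéG t ^ S * (x * y))) (sym (∏-^ (λ i → Λ (suc i)) z₀ D)) (sym (ψ-levels-∏Λ L t)) ⟩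
    factorials N t * (padéG t ^ S * (ψ (37 * t) ^ z₀ * ψ-levels L t)) ∎
    where
    open ≤-Reasoning
    D = 37 * t
    κ ℓ : ℕ → ℕ
    κ i = carries (9 * t) (16 * t) (12 * t) (suc i)
    ℓ i = allowance L (t / suc i)

  floors-upper : ∀ L t i → floors L t i * suc i ≤ weight L * t
  floors-upper []             t i = z≤n
  floors-upper (term q m c L) t i = begin
    (suc m * c * k + floors L t i) * suc i ≡⟨ l1 (suc m) c k (floors L t i) (suc i) ⟩
    c * (k * suc m * suc i) + floors L t i * suc i ≤⟨ +-mono-≤ (*-monoʳ-≤ c (≤-trans (*-monoˡ-≤ (suc i) (m/n*n≤m (q * t / suc i) (suc m))) (m/n*n≤m (q * t) (suc i)))) (floors-upper L t i) ⟩
    c * (q * t) + weight L * t ≡⟨ l2 c q t (weight L) ⟩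
    (q * c + weight L) * t ∎
    where
    open ≤-Reasoning
    k = q * t / suc i / suc m
    l1 : ∀ m c k f d → (m * c * k + f) * d ≡ c * (k * m * d) + f * d
    l1 = solve-∀
    l2 : ∀ c q t w → c * (q * t) + w * t ≡ (q * c + w) * t
    l2 = solve-∀

  floors-lower : ∀ L t i → weight L * t ≤ (floors L t i + count L) * suc i
  floors-lower []             t i = z≤n
  floors-lower (term q m c L) t i = begin
    (q * c + weight L) * t ≡⟨ l2 c q t (weight L) ⟨
    c * (q * t) + weight L * t ≤⟨ +-mono-≤ (*-monoʳ-≤ c qt≤) (floors-lower L t i) ⟩
    c * (suc k * suc m * suc i) + (floors L t i + count L) * suc i ≡⟨ l1 (suc m) c k (floors L t i) (count L) (suc i) ⟩
    (suc m * c * k + floors L t i + (suc m * c + count L)) * suc i ∎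
    where
    open ≤-Reasoning
    k = q * t / suc i / suc m
    qt≤ : q * t ≤ suc k * suc m * suc i
    qt≤ = ≤-trans (<⇒≤ (m<suc[m/n]*n (q * t) (suc i))) (*-monoˡ-≤ (suc i) (m<suc[m/n]*n (q * t / suc i) (suc m)))
    l1 : ∀ m c k f n d → c * (suc k * m * d) + (f + n) * d ≡ (m * c * k + f + (m * c + n)) * d
    l1 = solve-∀
    l2 : ∀ c q t w → c * (q * t) + w * t ≡ (q * c + w) * t
    l2 = solve-∀

  -- Up to the counts, both sides equal `weight` times t / d. This bounds the excess even at the
  -- smallest moduli, where t / d is out of reach of any finite check.
  floors-balanced : ∀ P N → weight P ≡ weight N → ∀ t i → floors P t i ≤ floors N t i + count N
  floors-balanced P N wt t i = *-cancelʳ-≤ _ _ (suc i)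
    (≤-trans (floors-upper P t i) (≤-trans (≤-reflexive (cong (_* t) wt)) (floors-lower N t i)))

  Below : ℕ → Levels → Set
  Below n []            = ⊤
  Below n (level X z L) = suc X ≤ n × Below n L

  total : Levels → ℕ
  total []            = 0
  total (level X z L) = suc X * z + total L

  allowance-total : ∀ L {X n} → Below X L → X ≤ n → allowance L n ≡ total L
  allowance-total []            _          _   = refl
  allowance-total (level Y z L) (Y≤ , bel) X≤n =
    cong₂ _+_ (trans (cong (suc Y * z *_) (ind-yes (≤-trans Y≤ X≤n))) (*-identityʳ (suc Y * z))) (allowance-total L bel X≤n)

  -- The four numerators that occur in `carries`. Terms restricted to them jump at the same grid of
  -- values of t / d.
  data Grid : ℕ → Set where
    q37 : Grid 37
    q16 : Grid 16
    q12 : Grid 12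
    q9  : Grid 9

  OnGrid : Terms → Set
  OnGrid []             = ⊤
  OnGrid (term q m c L) = Grid q × OnGrid L

  floors-cong : ∀ L {t i s j} → OnGrid L → (∀ {q} → Grid q → q * t / suc i ≡ q * s / suc j) → floors L t i ≡ floors L s j
  floors-cong []             _        eq = refl
  floors-cong (term q m c L) (g , gs) eq = cong₂ (λ x y → suc m * c * (x / suc m) + y) (eq g) (floors-cong L gs eq)

  -- Between consecutive multiples of 1/37, 1/16, 1/12 and 1/9 all floors are constant, so t / d may be
  -- replaced by the largest such multiple below it.
  module Sample (step : ∀ {q} → Grid q → ℕ) (D : ℕ) (q*step : ∀ {q} (g : Grid q) → q * step g ≡ suc D) (t i : ℕ) where
    u : ℕ → ℕ
    u q = q * t / suc i

    step≢0 : ∀ {q} (g : Grid q) → NonZero (step g)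
    step≢0 {q} g = ≢-nonZero (λ s≡0 → contradiction (trans (sym (q*step g)) (trans (cong (q *_) s≡0) (*-zeroʳ q))) λ ())

    comp : ∀ {q} → Grid q → ℕ
    comp {q} g = step g * u q

    num : ℕ
    num = comp q37 ⊔ (comp q16 ⊔ (comp q12 ⊔ comp q9))

    comp≤num : ∀ {q} (g : Grid q) → comp g ≤ num
    comp≤num q37 = m≤m⊔n (comp q37) _
    comp≤num q16 = ≤-trans (m≤m⊔n (comp q16) _) (m≤n⊔m (comp q37) _)
    comp≤num q12 = ≤-trans (m≤m⊔n (comp q12) _) (≤-trans (m≤n⊔m (comp q16) _) (m≤n⊔m (comp q37) _))
    comp≤num q9  = ≤-trans (m≤n⊔m (comp q12) _) (≤-trans (m≤n⊔m (comp q16) _) (m≤n⊔m (comp q37) _))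

    -- The two sides are separated by the value (t / d) `suc D`: a rounded-down multiple lies at or
    -- below it, the next multiple above it.
    comp< : ∀ {q r} (g : Grid q) (h : Grid r) → comp h < step g * suc (u q)
    comp< {q} {r} g h = *-cancelʳ-< (suc i) _ _ (begin-strict
      step h * u r * suc i ≡⟨ *-assoc (step h) (u r) (suc i) ⟩
      step h * (u r * suc i) ≤⟨ *-monoʳ-≤ (step h) (m/n*n≤m (r * t) (suc i)) ⟩
      step h * (r * t) ≡⟨ l1 (step h) r t ⟩
      r * step h * t ≡⟨ cong (_* t) (trans (q*step h) (sym (q*step g))) ⟩
      q * step g * t ≡⟨ l1 (step g) q t ⟨
      step g * (q * t) <⟨ *-monoʳ-< (step g) {{step≢0 g}} (m<suc[m/n]*n (q * t) (suc i)) ⟩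
      step g * (suc (u q) * suc i) ≡⟨ *-assoc (step g) (suc (u q)) (suc i) ⟨
      step g * suc (u q) * suc i  ∎)
      where
      open ≤-Reasoning
      l1 : ∀ k q t → k * (q * t) ≡ q * k * t
      l1 = solve-∀

    num< : ∀ {q} (g : Grid q) → num < step g * suc (u q)
    num< g = ⊔-lub (comp< g q37) (⊔-lub (comp< g q16) (⊔-lub (comp< g q12) (comp< g q9)))

    sample : ∀ {q} → Grid q → q * t / suc i ≡ q * num / suc D
    sample {q} g = sym (≤-antisym
      (≤-pred (m<n*o⇒m/o<n {q * num} {suc (u q)} (begin-strict
        q * num <⟨ *-monoʳ-< q {{q≢0 g}} (num< g) ⟩
        q * (step g * suc (u q)) ≡⟨ *-assoc q (step g) (suc (u q)) ⟨
        q * step g * suc (u q) ≡⟨ cong (_* suc (u q)) (q*step g) ⟩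
        suc D * suc (u q) ≡⟨ *-comm (suc D) (suc (u q)) ⟩
        suc (u q) * suc D ∎)))
      (≤-trans (≤-reflexive (sym (m*n/n≡m (u q) (suc D)))) (/-monoˡ-≤ (suc D) (begin
        u q * suc D ≡⟨ *-comm (u q) (suc D) ⟩
        suc D * u q ≡⟨ cong (_* u q) (sym (q*step g)) ⟩
        q * step g * u q ≡⟨ *-assoc q (step g) (u q) ⟩
        q * (step g * u q) ≤⟨ *-monoʳ-≤ q (comp≤num g) ⟩
        q * num ∎))))
      where
      open ≤-Reasoning
      q≢0 : ∀ {q} → Grid q → NonZero q
      q≢0 q37 = _
      q≢0 q16 = _
      q≢0 q12 = _
      q≢0 q9  = _

    attained : (num ≡ comp q37) ⊎ (num ≡ comp q16) ⊎ (num ≡ comp q12) ⊎ (num ≡ comp q9)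
    attained with ⊔-sel (comp q37) (comp q16 ⊔ (comp q12 ⊔ comp q9)) | ⊔-sel (comp q16) (comp q12 ⊔ comp q9) | ⊔-sel (comp q12) (comp q9)
    ... | inj₁ e | _      | _      = inj₁ e
    ... | inj₂ e | inj₁ f | _      = inj₂ (inj₁ (trans e f))
    ... | inj₂ e | inj₂ f | inj₁ g = inj₂ (inj₂ (inj₁ (trans e (trans f g))))
    ... | inj₂ e | inj₂ f | inj₂ g = inj₂ (inj₂ (inj₂ (trans e (trans f g))))

    -- The floor of t / d itself is not of the form ⌊q t / d⌋ with q on the grid, but it is ⌊⌊16 t /
    -- d⌋ / 16⌋.
    whole : t / suc i ≡ num / suc D
    whole = trans (via16 t (suc i)) (trans (cong (_/ 16) (sample q16)) (sym (via16 num (suc D))))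
      where
      via16 : ∀ t d .{{_ : NonZero d}} → t / d ≡ 16 * t / d / 16
      via16 t d = sym (trans (m/n/o≡m/[n*o] (16 * t) d 16) (trans (/-congʳ {m = 16 * t} (*-comm d 16)) (m*n/m*o≡n/o 16 t d)))
        where
        instance
          d16≢0 = m*n≢0 d 16
          16d≢0 = m*n≢0 16 d

    carries-sample : carries (9 * t) (16 * t) (12 * t) (suc i) ≡ carries (9 * num) (16 * num) (12 * num) (suc D)
    carries-sample = cong₂ (λ x y → x ∸ suc y) (trans (/-congˡ (lem t)) (trans (sample q37) (/-congˡ (sym (lem num)))))
      (cong₂ _+_ (cong₂ _+_ (sample q9) (sample q16)) (sample q12))
      where
      lem : ∀ t → 9 * t + 16 * t + 12 * t ≡ 37 * t
      lem = solve-∀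

  certifies? : ℕ → Terms → Terms → ℕ → ℕ → Levels → ℕ → Bool
  certifies? D P N S z₀ L num =
    floors P num D ≤ᵇ floors N num D + (S * carries (9 * num) (16 * num) (12 * num) (suc D) + (z₀ + allowance L (div-helper 0 D num D)))

  allMultiples : (ℕ → Bool) → ℕ → ℕ → Bool
  allMultiples f s zero    = true
  allMultiples f s (suc k) = f (s * k) ∧ allMultiples f s k

  allMultiples-sound : ∀ f s k → allMultiples f s k ≡ true → ∀ n → n < k → f (s * n) ≡ true
  allMultiples-sound f s (suc k) ok n (s≤s n≤k) with Equivalence.to T-∧ (subst T (sym ok) tt) | n ≟ k
  ... | here , _  | yes refl = Equivalence.to T-≡ here
  ... | _ , there | no n≢k   = allMultiples-sound f s k (Equivalence.to T-≡ there) n (≤∧≢⇒< n≤k n≢k)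

  module _ (step : ∀ {q} → Grid q → ℕ) (D : ℕ) (q*step : ∀ {q} (g : Grid q) → q * step g ≡ suc D)
    (P N : Terms) (S z₀ : ℕ) (L : Levels) (X : ℕ) (onP : OnGrid P) (onN : OnGrid N) (wt : weight P ≡ weight N)
    (below : Below X L) (enough : count N ≤ total L)
    (ok : ∀ {q} (g : Grid q) → allMultiples (certifies? D P N S z₀ L) (step g) (q * X) ≡ true) where

    -- For t / d ≥ X all levels are active, and their total covers the general excess `count N`. For
    -- t / d < X the sample point is a multiple of one of the four steps, with fewer than q X
    -- possibilities for each.
    certified : ∀ t i → Certifies P N S z₀ L t i
    certified t i with X ≤? t / suc i
    ... | yes X≤n = begin
      floors P t i ≤⟨ floors-balanced P N wt t i ⟩
      floors N t i + count N ≤⟨ +-monoʳ-≤ (floors N t i) enough ⟩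
      floors N t i + total L ≡⟨ cong (floors N t i +_) (sym (allowance-total L below X≤n)) ⟩
      floors N t i + allowance L (t / suc i) ≤⟨ +-monoʳ-≤ (floors N t i) (≤-trans (m≤n+m (allowance L (t / suc i)) z₀) (m≤n+m (z₀ + allowance L (t / suc i)) (S * carries (9 * t) (16 * t) (12 * t) (suc i)))) ⟩
      floors N t i + (S * carries (9 * t) (16 * t) (12 * t) (suc i) + (z₀ + allowance L (t / suc i))) ∎
      where open ≤-Reasoning
    ... | no X≰n = subst₂ _≤_ (sym (floors-cong P onP sample)) (cong₂ _+_ (sym (floors-cong N onN sample))
          (cong₂ (λ x y → S * x + (z₀ + allowance L y)) (sym carries-sample) (sym whole)))
          (≤ᵇ⇒≤ _ _ (Equivalence.from T-≡ (holds attained)))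
      where
      open Sample step D q*step t i
      u<qX : ∀ q → u q < q * X ⊎ q ≡ 0
      u<qX zero = inj₂ refl
      u<qX q@(suc _) = inj₁ (m<n*o⇒m/o<n {q * t} {q * X} (<-≤-trans (*-monoʳ-< q (<-≤-trans (m<suc[m/n]*n t (suc i)) (*-monoˡ-≤ (suc i) (≰⇒> X≰n)))) (≤-reflexive (sym (*-assoc q X (suc i))))))
      at : ∀ {q} (g : Grid q) → u q < q * X ⊎ q ≡ 0 → num ≡ comp g → certifies? D P N S z₀ L num ≡ true
      at {q} g (inj₁ u<) eq = trans (cong (certifies? D P N S z₀ L) eq) (allMultiples-sound (certifies? D P N S z₀ L) (step g) (q * X) (ok g) (u q) u<)
      at g (inj₂ q≡0) eq = contradiction (trans (sym (q*step g)) (cong (_* step g) q≡0)) λ ()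
      holds : (num ≡ comp q37) ⊎ (num ≡ comp q16) ⊎ (num ≡ comp q12) ⊎ (num ≡ comp q9) → certifies? D P N S z₀ L num ≡ true
      holds (inj₁ e)               = at q37 (u<qX 37) e
      holds (inj₂ (inj₁ e))        = at q16 (u<qX 16) e
      holds (inj₂ (inj₂ (inj₁ e))) = at q12 (u<qX 12) e
      holds (inj₂ (inj₂ (inj₂ e))) = at q9 (u<qX 9) e

-- Comparison of huge products through integral logarithms.

module LogarithmicForm where

  open Prelude
  open import Data.Nat.Combinatorics using (_C_; nCk+nC[k+1]≡[n+1]C[k+1])
  open VonMangoldt
  open CommonFactor
  open ResidueIdentity using (Tℕ; Tℕ-upper; Tℕ-lower; binom₈)
  open Padé
  open StirlingBounds
  open FactorialProducts
  open Chebyshev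
  open ChebyshevBound
  open Certificates

  -- Logarithms to base 2 in units of 1 / W.
  module Logarithms (W : ℕ) (lo hi : ℕ → ℕ) where

    Logged : ℕ → Set
    Logged r = 2 ^ lo r ≤ r ^ W × r ^ W ≤ 2 ^ hi r

    AllLogged : Terms → Set
    AllLogged []             = ⊤
    AllLogged (term q m c L) = Logged q × Logged (suc m) × AllLogged L

    Σnum Σden : (ℕ → ℕ) → Terms → ℕ
    Σnum lg []             = 0
    Σnum lg (term q m c L) = lg q * (q * c) + Σnum lg L
    Σden lg []             = 0
    Σden lg (term q m c L) = lg (suc m) * (q * c) + Σden lg L

    private
      low : ∀ a b e f k → 2 ^ a ≤ b ^ W → 2 ^ e ≤ f ^ W → 2 ^ (a * k + e) ≤ (b ^ k * f) ^ W
      low a b e f k p q = begin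
        2 ^ (a * k + e) ≡⟨ trans (^-distribˡ-+-* 2 (a * k) e) (cong (_* 2 ^ e) (sym (^-*-assoc 2 a k))) ⟩
        (2 ^ a) ^ k * 2 ^ e    ≤⟨ *-mono-≤ (^-monoˡ-≤ k p) q ⟩
        (b ^ W) ^ k * f ^ W    ≡⟨ trans (cong (_* f ^ W) (^-swap b W k)) (sym (^-distribʳ-* W (b ^ k) f)) ⟩
        (b ^ k * f) ^ W ∎
        where open ≤-Reasoning

      upp : ∀ a b e f k → b ^ W ≤ 2 ^ a → f ^ W ≤ 2 ^ e → (b ^ k * f) ^ W ≤ 2 ^ (a * k + e)
      upp a b e f k p q = begin
        (b ^ k * f) ^ W ≡⟨ trans (^-distribʳ-* W (b ^ k) f) (cong (_* f ^ W) (^-swap b k W)) ⟩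
        (b ^ W) ^ k * f ^ W    ≤⟨ *-mono-≤ (^-monoˡ-≤ k p) q ⟩
        (2 ^ a) ^ k * 2 ^ e    ≡⟨ trans (cong (_* 2 ^ e) (^-*-assoc 2 a k)) (sym (^-distribˡ-+-* 2 (a * k) e)) ⟩
        2 ^ (a * k + e) ∎
        where open ≤-Reasoning

    ∏num-lower : ∀ L → AllLogged L → 2 ^ Σnum lo L ≤ ∏num L ^ W
    ∏num-lower []             _             = ≤-reflexive (sym (^-zeroˡ W))
    ∏num-lower (term q m c L) (lq , _ , ls) = low (lo q) q (Σnum lo L) (∏num L) (q * c) (proj₁ lq) (∏num-lower L ls)

    ∏den-lower : ∀ L → AllLogged L → 2 ^ Σden lo L ≤ ∏den L ^ W
    ∏den-lower []             _             = ≤-reflexive (sym (^-zeroˡ W))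
    ∏den-lower (term q m c L) (_ , lm , ls) = low (lo (suc m)) (suc m) (Σden lo L) (∏den L) (q * c) (proj₁ lm) (∏den-lower L ls)

    ∏num-upper : ∀ L → AllLogged L → ∏num L ^ W ≤ 2 ^ Σnum hi L
    ∏num-upper []             _             = ≤-reflexive (^-zeroˡ W)
    ∏num-upper (term q m c L) (lq , _ , ls) = upp (hi q) q (Σnum hi L) (∏num L) (q * c) (proj₂ lq) (∏num-upper L ls)

    ∏den-upper : ∀ L → AllLogged L → ∏den L ^ W ≤ 2 ^ Σden hi L
    ∏den-upper []             _             = ≤-reflexive (^-zeroˡ W)
    ∏den-upper (term q m c L) (_ , lm , ls) = upp (hi (suc m)) (suc m) (Σden hi L) (∏den L) (q * c) (proj₂ lm) (∏den-upper L ls)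

  -- The certificate bounds the ratio of the two factorial products from above and Stirling's
  -- formula bounds it from below; what remains is a bound for G^S. In the power `k * W`, the factor
  -- `k` clears the denominator in the bound for `Ψ` and `W` that of the logarithms.
  G-lower : ∀ {G Fp Fn N₁ D₁ σ Ψ t c S W k z ℓ₁ ℓ₂} → 1 ≤ Fn →
    Fp ≤ Fn * (G ^ S * Ψ) → Ψ ^ k ≤ 2 ^ (t * z) → Fn * N₁ ^ t ≤ Fp * D₁ ^ t * σ ^ c →
    2 ^ ℓ₁ ≤ N₁ ^ W → D₁ ^ W ≤ 2 ^ ℓ₂ →
    2 ^ (ℓ₁ * (t * k)) ≤ 2 ^ (ℓ₂ * (t * k) + t * z * W) * (σ ^ c) ^ (k * W) * G ^ (S * (k * W))
  G-lower {G} {Fp} {Fn} {N₁} {D₁} {σ} {Ψ} {t} {c} {S} {W} {k} {z} {ℓ₁} {ℓ₂} 1≤Fn cert ψ≤ ratio num≥ den≤ = begin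
    2 ^ (ℓ₁ * (t * k)) ≡⟨ ^-*-assoc 2 ℓ₁ (t * k) ⟨
    (2 ^ ℓ₁) ^ (t * k) ≤⟨ ^-monoˡ-≤ (t * k) num≥ ⟩
    (N₁ ^ W) ^ (t * k) ≡⟨ trans (^-swap N₁ W (t * k)) (trans (cong (_^ W) (sym (^-*-assoc N₁ t k))) (^-*-assoc (N₁ ^ t) k W)) ⟩
    (N₁ ^ t) ^ (k * W) ≤⟨ ^-monoˡ-≤ (k * W) N₁≤ ⟩
    (G ^ S * Ψ * D₁ ^ t * σ ^ c) ^ (k * W) ≡⟨ trans (^-distribʳ-* (k * W) _ (σ ^ c)) (cong (_* (σ ^ c) ^ (k * W)) (trans (^-distribʳ-* (k * W) _ (D₁ ^ t)) (cong (_* (D₁ ^ t) ^ (k * W)) (^-distribʳ-* (k * W) (G ^ S) Ψ)))) ⟩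
    (G ^ S) ^ (k * W) * Ψ ^ (k * W) * (D₁ ^ t) ^ (k * W) * (σ ^ c) ^ (k * W)
      ≤⟨ *-monoˡ-≤ ((σ ^ c) ^ (k * W)) (*-mono-≤ (*-mono-≤ (≤-reflexive (^-*-assoc G S (k * W))) Ψ≤) D≤) ⟩
    G ^ (S * (k * W)) * 2 ^ (t * z * W) * 2 ^ (ℓ₂ * (t * k)) * (σ ^ c) ^ (k * W)
      ≡⟨ l1 (G ^ (S * (k * W))) (2 ^ (t * z * W)) (2 ^ (ℓ₂ * (t * k))) ((σ ^ c) ^ (k * W)) ⟩
    2 ^ (ℓ₂ * (t * k)) * 2 ^ (t * z * W) * (σ ^ c) ^ (k * W) * G ^ (S * (k * W))
      ≡⟨ cong (λ x → x * (σ ^ c) ^ (k * W) * G ^ (S * (k * W))) (^-distribˡ-+-* 2 (ℓ₂ * (t * k)) (t * z * W)) ⟨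
    2 ^ (ℓ₂ * (t * k) + t * z * W) * (σ ^ c) ^ (k * W) * G ^ (S * (k * W)) ∎
    where
    open ≤-Reasoning
    l1 : ∀ g a b s → g * a * b * s ≡ b * a * s * g
    l1 = solve-∀
    N₁≤ : N₁ ^ t ≤ G ^ S * Ψ * D₁ ^ t * σ ^ c
    N₁≤ = *-cancelˡ-≤ Fn {{>-nonZero 1≤Fn}} (begin
      Fn * N₁ ^ t ≤⟨ ratio ⟩
      Fp * D₁ ^ t * σ ^ c ≤⟨ *-monoˡ-≤ (σ ^ c) (*-monoˡ-≤ (D₁ ^ t) cert) ⟩
      Fn * (G ^ S * Ψ) * D₁ ^ t * σ ^ c    ≡⟨ l2 Fn (G ^ S * Ψ) (D₁ ^ t) (σ ^ c) ⟩
      Fn * (G ^ S * Ψ * D₁ ^ t * σ ^ c)    ∎)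
      where
      l2 : ∀ f g d s → f * g * d * s ≡ f * (g * d * s)
      l2 = solve-∀
    Ψ≤ : Ψ ^ (k * W) ≤ 2 ^ (t * z * W)
    Ψ≤ = ≤-trans (≤-reflexive (sym (^-*-assoc Ψ k W))) (≤-trans (^-monoˡ-≤ W ψ≤) (≤-reflexive (^-*-assoc 2 (t * z) W)))
    D≤ : (D₁ ^ t) ^ (k * W) ≤ 2 ^ (ℓ₂ * (t * k))
    D≤ = ≤-trans (≤-reflexive (trans (^-*-assoc D₁ t (k * W)) (trans (cong (D₁ ^_) (l3 t k W)) (sym (^-*-assoc D₁ W (t * k))))))
      (≤-trans (^-monoˡ-≤ (t * k) den≤) (≤-reflexive (^-*-assoc 2 ℓ₂ (t * k))))
      where
      l3 : ∀ t k W → t * (k * W) ≡ W * (t * k)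
      l3 = solve-∀

  -- The power `R` makes the logarithms integral and `T₀` does so for the growth rate of the slack;
  -- after that only exponents of 2 are compared.
  exponents⇒≤ : ∀ {X Y G σ R c T₀ e₁ e₂ x₀ y₀ s h} .{{_ : NonZero (R * T₀)}} →
    2 ^ e₁ ≤ 2 ^ e₂ * σ ^ c * G ^ R → σ ^ T₀ ≤ 2 ^ (h * T₀ + 2 * s) →
    X ^ R ≤ 2 ^ x₀ → 2 ^ y₀ ≤ Y ^ R →
    T₀ * (x₀ + e₂) + (h * T₀ + 2 * s) * c ≤ T₀ * (y₀ + e₁) → X ≤ Y * G
  exponents⇒≤ {X} {Y} {G} {σ} {R} {c} {T₀} {e₁} {e₂} {x₀} {y₀} {s} {h} g≥ σ≤ X≤ Y≥ num =
    ^-cancel-≤ (R * T₀) (*-cancelʳ-≤ _ _ (2 ^ (T₀ * e₂ + (h * T₀ + 2 * s) * c)) {{m^n≢0 2 (T₀ * e₂ + (h * T₀ + 2 * s) * c)}} (begin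
    X ^ (R * T₀) * 2 ^ (T₀ * e₂ + b) ≤⟨ *-monoˡ-≤ _ (≤-trans (≤-reflexive (sym (^-*-assoc X R T₀))) (≤-trans (^-monoˡ-≤ T₀ X≤) (≤-reflexive (^-*-assoc 2 x₀ T₀)))) ⟩
    2 ^ (x₀ * T₀) * 2 ^ (T₀ * e₂ + b) ≡⟨ ^-distribˡ-+-* 2 (x₀ * T₀) (T₀ * e₂ + b) ⟨
    2 ^ (x₀ * T₀ + (T₀ * e₂ + b)) ≤⟨ ^-monoʳ-≤ 2 (≤-trans (≤-reflexive (l1 x₀ T₀ e₂ b)) num) ⟩
    2 ^ (T₀ * (y₀ + e₁)) ≡⟨ trans (cong (2 ^_) (l2 T₀ y₀ e₁)) (^-distribˡ-+-* 2 (y₀ * T₀) (e₁ * T₀)) ⟩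
    2 ^ (y₀ * T₀) * 2 ^ (e₁ * T₀) ≡⟨ cong₂ _*_ (sym (^-*-assoc 2 y₀ T₀)) (sym (^-*-assoc 2 e₁ T₀)) ⟩
    (2 ^ y₀) ^ T₀ * (2 ^ e₁) ^ T₀ ≤⟨ *-mono-≤ (^-monoˡ-≤ T₀ Y≥) (^-monoˡ-≤ T₀ g≥) ⟩
    (Y ^ R) ^ T₀ * (2 ^ e₂ * σ ^ c * G ^ R) ^ T₀    ≡⟨ cong ((Y ^ R) ^ T₀ *_) (trans (^-distribʳ-* T₀ (2 ^ e₂ * σ ^ c) (G ^ R)) (cong (_* (G ^ R) ^ T₀) (trans (^-distribʳ-* T₀ (2 ^ e₂) (σ ^ c)) (cong₂ _*_ (trans (^-*-assoc 2 e₂ T₀) (cong (2 ^_) (*-comm e₂ T₀))) (^-swap σ c T₀))))) ⟩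
    (Y ^ R) ^ T₀ * (2 ^ (T₀ * e₂) * (σ ^ T₀) ^ c * (G ^ R) ^ T₀) ≤⟨ *-monoʳ-≤ ((Y ^ R) ^ T₀) (*-monoˡ-≤ ((G ^ R) ^ T₀) (*-monoʳ-≤ (2 ^ (T₀ * e₂)) (≤-trans (^-monoˡ-≤ c σ≤) (≤-reflexive (^-*-assoc 2 (h * T₀ + 2 * s) c))))) ⟩
    (Y ^ R) ^ T₀ * (2 ^ (T₀ * e₂) * 2 ^ b * (G ^ R) ^ T₀) ≡⟨ cong (λ z → (Y ^ R) ^ T₀ * (z * (G ^ R) ^ T₀)) (sym (^-distribˡ-+-* 2 (T₀ * e₂) b)) ⟩
    (Y ^ R) ^ T₀ * (2 ^ (T₀ * e₂ + b) * (G ^ R) ^ T₀) ≡⟨ l3 ((Y ^ R) ^ T₀) (2 ^ (T₀ * e₂ + b)) ((G ^ R) ^ T₀) ⟩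
    (Y ^ R) ^ T₀ * (G ^ R) ^ T₀ * 2 ^ (T₀ * e₂ + b) ≡⟨ cong (_* 2 ^ (T₀ * e₂ + b)) (trans (cong₂ _*_ (^-*-assoc Y R T₀) (^-*-assoc G R T₀)) (sym (^-distribʳ-* (R * T₀) Y G))) ⟩
    (Y * G) ^ (R * T₀) * 2 ^ (T₀ * e₂ + b) ∎))
    where
    open ≤-Reasoning
    b = (h * T₀ + 2 * s) * c
    l1 : ∀ x T e b → x * T + (T * e + b) ≡ T * (x + e) + b
    l1 = solve-∀
    l2 : ∀ T y e → T * (y + e) ≡ y * T + e * T
    l2 = solve-∀
    l3 : ∀ a b c → a * (b * c) ≡ a * c * b
    l3 = solve-∀

  -- One term of the binomial expansion; the powers of `y` on both sides avoid the exponent M - j.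
  binomial-term : ∀ x y M j → (M C j) * x ^ j * y ^ M ≤ (x + y) ^ M * y ^ j
  binomial-term x y zero    zero    = ≤-refl
  binomial-term x y zero    (suc j) = z≤n
  binomial-term x y (suc M) zero    = ≤-trans (≤-reflexive (+-identityʳ (y ^ suc M))) (≤-trans (^-monoˡ-≤ (suc M) (m≤n+m y x)) (≤-reflexive (sym (*-identityʳ _))))
  binomial-term x y (suc M) (suc j) = begin
    (suc M C suc j) * (x * x ^ j) * (y * y ^ M) ≡⟨ cong (λ z → z * (x * x ^ j) * (y * y ^ M)) (sym (nCk+nC[k+1]≡[n+1]C[k+1] M j)) ⟩
    ((M C j) + (M C suc j)) * (x * x ^ j) * (y * y ^ M) ≡⟨ l1 (M C j) (M C suc j) x (x ^ j) y (y ^ M) ⟩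
    x * y * ((M C j) * x ^ j * y ^ M) + y * ((M C suc j) * (x * x ^ j) * y ^ M) ≤⟨ +-mono-≤ (*-monoʳ-≤ (x * y) (binomial-term x y M j)) (*-monoʳ-≤ y (binomial-term x y M (suc j))) ⟩
    x * y * ((x + y) ^ M * y ^ j) + y * ((x + y) ^ M * (y * y ^ j)) ≡⟨ l2 x y ((x + y) ^ M) (y ^ j) ⟩
    (x + y) ^ suc M * y ^ suc j ∎
    where
    open ≤-Reasoning
    l1 : ∀ a b x u y v → (a + b) * (x * u) * (y * v) ≡ x * y * (a * u * v) + y * (b * (x * u) * v)
    l1 = solve-∀
    l2 : ∀ x y z w → x * y * (z * w) + y * (z * (y * w)) ≡ (x + y) * z * (y * w)
    l2 = solve-∀

-- Upper bounds for `padéA` and `padéV`, and a lower bound for `padéV`.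

module PadéEstimates where

  open Prelude
  open import Data.Nat.Combinatorics using (_C_)
  open VonMangoldt
  open CommonFactor
  open ResidueIdentity using (Tℕ; Tℕ-upper; Tℕ-lower; binom₈)
  open Padé
  open StirlingBounds
  open FactorialProducts
  open Chebyshev
  open ChebyshevBound
  open Certificates
  open LogarithmicForm

  -- Tℕ-upper at u = 1 / b for binomial coefficients, with all exponents linear in t.
  T-upper : ∀ c x e b f → e + c ≡ b → ∀ t A B D n M → (∀ j → f j ≡ (M C j) * x ^ j) → M ≡ (B + D) * t →
    ∀ r → n + suc (A * t) ≡ B * t + r →
    Tℕ c f (suc (A * t)) n * e * (e ^ A * b ^ D) ^ t * b ^ (B * t) ≤ b ^ r * ((x + b) ^ (B + D)) ^ t * b ^ (B * t)
  T-upper c x e b f eq t A B D n M f≡ M≡ r exp = begin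
    V * e * (e ^ A * b ^ D) ^ t * b ^ (B * t) ≡⟨ cong (λ z → V * e * z * b ^ (B * t)) (trans (^-distribʳ-* t (e ^ A) (b ^ D)) (cong₂ _*_ (^-*-assoc e A t) (^-*-assoc b D t))) ⟩
    V * e * (e ^ (A * t) * b ^ (D * t)) * b ^ (B * t) ≡⟨ l1 V e (e ^ (A * t)) (b ^ (D * t)) (b ^ (B * t)) ⟩
    V * (e * e ^ (A * t)) * (b ^ (B * t) * b ^ (D * t))   ≡⟨ cong₂ (λ y z → V * y * z) refl (trans (sym (^-distribˡ-+-* b (B * t) (D * t))) (cong (b ^_) (trans (sym (*-distribʳ-+ t B D)) (sym M≡)))) ⟩
    V * e ^ suc (A * t) * b ^ M ≡⟨ cong (λ z → z * e ^ suc (A * t) * b ^ M) (trans (sym (*-identityʳ V)) (cong (V *_) (sym (^-zeroˡ n)))) ⟩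
    V * 1 ^ n * e ^ suc (A * t) * b ^ M ≤⟨ Tℕ-upper c f 1 b e (b ^ M) ((x + b) ^ M) (trans (cong (e +_) (*-identityʳ c)) eq) bd (suc (A * t)) n ⟩
    (x + b) ^ M * b ^ (n + suc (A * t)) ≡⟨ cong₂ _*_ (trans (cong ((x + b) ^_) M≡) (sym (^-*-assoc (x + b) (B + D) t))) (trans (cong (b ^_) exp) (^-distribˡ-+-* b (B * t) r)) ⟩
    ((x + b) ^ (B + D)) ^ t * (b ^ (B * t) * b ^ r) ≡⟨ l2 (((x + b) ^ (B + D)) ^ t) (b ^ (B * t)) (b ^ r) ⟩
    b ^ r * ((x + b) ^ (B + D)) ^ t * b ^ (B * t) ∎
    where
    open ≤-Reasoning
    V = Tℕ c f (suc (A * t)) n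
    bd : ∀ j → f j * 1 ^ j * b ^ M ≤ (x + b) ^ M * b ^ j
    bd j = ≤-trans (≤-reflexive (cong (_* b ^ M) (trans (cong (f j *_) (^-zeroˡ j)) (trans (*-identityʳ (f j)) (f≡ j))))) (binomial-term x b M j)
    l1 : ∀ V e x y z → V * e * (x * y) * z ≡ V * (e * x) * (z * y)
    l1 = solve-∀
    l2 : ∀ x y z → x * (y * z) ≡ z * x * y
    l2 = solve-∀

  M≡37 : ∀ t → 9 * t + 16 * t + 12 * t ≡ 37 * t
  M≡37 = solve-∀

  -- The point u = 1/19 is close to the minimum of (1 + 8u)^37 / ((1 - u)^16 u^12), attained at the
  -- smaller root of 6u² - 19u + 1, about 1/18.68.
  V-upper : ∀ t → 1 ≤ t → padéV t * 18 * (18 ^ 16 * 19 ^ 9) ^ t ≤ (27 ^ 37) ^ t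
  V-upper t 1≤t = *-cancelʳ-≤ _ _ (19 ^ (28 * t)) {{m^n≢0 19 (28 * t)}}
    (≤-trans (T-upper 1 8 18 19 (binom₈ (9 * t + 16 * t + 12 * t)) refl t 16 28 9 (12 * t ∸ 1) (9 * t + 16 * t + 12 * t) (λ j → refl) (M≡37 t) 0 exp)
      (≤-reflexive (cong (_* 19 ^ (28 * t)) (*-identityˡ ((27 ^ 37) ^ t)))))
    where
    exp : 12 * t ∸ 1 + suc (16 * t) ≡ 28 * t + 0
    exp = trans (+-suc (12 * t ∸ 1) (16 * t)) (trans (cong (_+ 16 * t) (m+[n∸m]≡n (≤-trans 1≤t (m≤n*m t 12)))) (l t))
      where
      l : ∀ t → 12 * t + 16 * t ≡ 28 * t + 0
      l = solve-∀

  -- The point u = 1/25 is close to the minimum of (1 + u)^37 / ((1 - 8u)^16 u^9), attained at the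
  -- smaller root of 32u² - 76u + 3, about 1/24.91.
  A-upper : ∀ t → padéA t * 17 * (17 ^ 16 * 25 ^ 12) ^ t ≤ 25 ^ 1 * (26 ^ 37) ^ t
  A-upper t = *-cancelʳ-≤ _ _ (25 ^ (25 * t)) {{m^n≢0 25 (25 * t)}}
    (T-upper 8 1 17 25 ((9 * t + 16 * t + 12 * t) C_) refl t 16 25 12 (9 * t) (9 * t + 16 * t + 12 * t)
      (λ j → sym (trans (cong (((9 * t + 16 * t + 12 * t) C j) *_) (^-zeroˡ j)) (*-identityʳ _))) (M≡37 t) 1 (l t))
    where
    l : ∀ t → 9 * t + suc (16 * t) ≡ 25 * t + 1
    l = solve-∀

  V⁺ V⁻ : Terms
  V⁺ = term 37 0 1 (term 17 0 1 [])
  V⁻ = term 11 0 1 (term 26 0 1 (term 16 0 1 (term 1 0 1 [])))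

  -- The term j = 11 t dominates the sum defining V.
  V-lower-factorials : ∀ t → 1 ≤ t → 8 ^ (11 * t) * ((37 * t) ! * (17 * t) !) ≤ 17 * padéV t * ((11 * t) ! * ((26 * t) ! * ((16 * t) ! * t !)))
  V-lower-factorials t@(suc t′) _ = begin
    8 ^ (11 * t) * ((37 * t) ! * (17 * t) !)
      ≡⟨ cong₂ (λ x y → 8 ^ (11 * t) * (x * y)) (sym C37) (sym C17) ⟩
    8 ^ (11 * t) * ((M C 11 * t) * ((11 * t) ! * (26 * t) !) * (17 * ((16 * t + t′) C 16 * t) * ((16 * t) ! * t !)))
      ≡⟨ l1 (8 ^ (11 * t)) (M C 11 * t) ((11 * t) !) ((26 * t) !) ((16 * t + t′) C 16 * t) ((16 * t) !) (t !) ⟩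
    17 * (binom₈ M (11 * t) * ((16 * t + t′) C 16 * t)) * ((11 * t) ! * ((26 * t) ! * ((16 * t) ! * t !)))
      ≤⟨ *-monoˡ-≤ _ (*-monoʳ-≤ 17 (≤-trans (Tℕ-lower (binom₈ M) (16 * t) (11 * t) t′) (≤-reflexive (cong (Tℕ 1 (binom₈ M) (suc (16 * t))) (ex t′))))) ⟩
    17 * padéV t * ((11 * t) ! * ((26 * t) ! * ((16 * t) ! * t !))) ∎
    where
    open ≤-Reasoning
    M = 9 * t + 16 * t + 12 * t
    ex : ∀ t′ → t′ + 11 * suc t′ ≡ 12 * suc t′ ∸ 1
    ex t′ = refl
    C37 : (M C 11 * t) * ((11 * t) ! * (26 * t) !) ≡ (37 * t) !
    C37 = trans (cong (λ z → (z C 11 * t) * ((11 * t) ! * (26 * t) !)) (a t)) (trans (C-! (11 * t) (26 * t)) (cong _! (b t)))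
      where
      a : ∀ t → 9 * t + 16 * t + 12 * t ≡ 11 * t + 26 * t
      a = solve-∀
      b : ∀ t → 11 * t + 26 * t ≡ 37 * t
      b = solve-∀
    -- The cofactor has index t - 1 = (12 t - 1) - 11 t, and 17 C(17 t - 1, 16 t) = C(17 t, 16 t).
    C17 : 17 * ((16 * t + t′) C 16 * t) * ((16 * t) ! * t !) ≡ (17 * t) !
    C17 = trans (l2 ((16 * t + t′) C 16 * t) ((16 * t) !) t (t′ !)) (trans (cong (17 * t *_) (C-! (16 * t) t′)) (trans (cong (_* (16 * t + t′) !) (sym (c t′))) (cong _! (c t′))))
      where
      c : ∀ t′ → suc (16 * suc t′ + t′) ≡ 17 * suc t′
      c = solve-∀
      l2 : ∀ x y t z → 17 * x * (y * (t * z)) ≡ 17 * t * (x * (y * z))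
      l2 = solve-∀
    l1 : ∀ e x a b y c d → e * (x * (a * b) * (17 * y * (c * d))) ≡ 17 * (x * e * y) * (a * (b * (c * d)))
    l1 = solve-∀

  V-lower : ∀ t .{{_ : NonZero t}} → 4 ≤ t →
    (8 ^ 11) ^ t * (∏num V⁺ * ∏den V⁻) ^ t ≤ 17 * padéV t * (∏num V⁻ * ∏den V⁺) ^ t * slack t ^ (count V⁺ + count V⁻)
  V-lower t 4≤t = go {padéV t} (factorials V⁻ t) (factorials V⁺ t) {(8 ^ 11) ^ t} (factorials≥1 V⁻ t) h₁ (factorials-ratio t V⁺ V⁻ adm⁺ adm⁻ refl)
    where
    go : ∀ {V} Fn Fp {e N D σ} → 1 ≤ Fn → e * Fp ≤ 17 * V * Fn → Fn * N ≤ Fp * D * σ → e * N ≤ 17 * V * D * σ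
    go {V} Fn Fp {e} {N} {D} {σ} 1≤ h₁ h₂ = *-cancelˡ-≤ Fn {{>-nonZero 1≤}} (begin
      Fn * (e * N) ≡⟨ l1 Fn e N ⟩
      e * (Fn * N) ≤⟨ *-monoʳ-≤ e h₂ ⟩
      e * (Fp * D * σ) ≡⟨ l2 e Fp D σ ⟩
      e * Fp * D * σ ≤⟨ *-monoˡ-≤ σ (*-monoˡ-≤ D h₁) ⟩
      17 * V * Fn * D * σ  ≡⟨ l3 (17 * V) Fn D σ ⟩
      Fn * (17 * V * D * σ) ∎)
      where
      open ≤-Reasoning
      l1 : ∀ f e n → f * (e * n) ≡ e * (f * n)
      l1 = solve-∀
      l2 : ∀ e f d s → e * (f * d * s) ≡ e * f * d * s
      l2 = solve-∀
      l3 : ∀ v f d s → v * f * d * s ≡ f * (v * d * s)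
      l3 = solve-∀
    one : ∀ q R → ((q * t / 1) !) ^ (1 * 1) * R ≡ (q * t) ! * R
    one q R = cong (_* R) (trans (^-identityʳ _) (cong _! (n/1≡n (q * t))))
    F⁺ : factorials V⁺ t ≡ (37 * t) ! * (17 * t) !
    F⁺ = trans (one 37 _) (cong ((37 * t) ! *_) (trans (one 17 1) (*-identityʳ _)))
    F⁻ : factorials V⁻ t ≡ (11 * t) ! * ((26 * t) ! * ((16 * t) ! * t !))
    F⁻ = trans (one 11 _) (cong ((11 * t) ! *_) (trans (one 26 _) (cong ((26 * t) ! *_) (trans (one 16 _) (cong ((16 * t) ! *_)
      (trans (one 1 1) (trans (*-identityʳ _) (cong _! (*-identityˡ t)))))))))
    h₁ : (8 ^ 11) ^ t * factorials V⁺ t ≤ 17 * padéV t * factorials V⁻ t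
    h₁ = subst₂ (λ x y → x ≤ 17 * padéV t * y) (cong₂ _*_ (sym (^-*-assoc 8 11 t)) (sym F⁺)) (sym F⁻) (V-lower-factorials t (>-nonZero⁻¹ t))
    4≤ : ∀ q → 1 ≤ q → 4 * 1 ≤ q * t
    4≤ q 1≤q = ≤-trans 4≤t (≤-trans (≤-reflexive (sym (*-identityˡ t))) (*-monoˡ-≤ t 1≤q))
    adm⁺ : Admissible t V⁺
    adm⁺ = ≤-refl , 4≤ 37 (s≤s z≤n) , m≤m+n 17 20 , 4≤ 17 (s≤s z≤n) , tt
    adm⁻ : Admissible t V⁻
    adm⁻ = m≤m+n 11 26 , 4≤ 11 (s≤s z≤n) , m≤m+n 26 11 , 4≤ 26 (s≤s z≤n) , m≤m+n 16 21 , 4≤ 16 (s≤s z≤n) , s≤s z≤n , 4≤ 1 (s≤s z≤n) , tt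

-- Reduction of the two size conditions for large t to numerical inequalities.

module LargeExponents where

  open Prelude
  open import Data.Integer.Base using (ℤ; ∣_∣) renaming (_-_ to _⊖_; _*_ to _⊗_)
  open VonMangoldt
  open CommonFactor
  open Padé
  open StirlingBounds
  open FactorialProducts
  open Chebyshev
  open ChebyshevBound
  open Certificates
  open LogarithmicForm
  open PadéEstimates

  V-power : ∀ V q p w v R′ t j .{{_ : NonZero q}} → V * q ^ t ≤ p ^ t → p ^ w ≤ q ^ w * 2 ^ v → j ≤ 41 →
    (2 * (4 ^ j * V)) ^ (w * R′) ≤ 2 ^ (83 * (w * R′) + v * t * R′)
  V-power V q p w v R′ t j Vq≤ pw≤ j≤ = begin
    (2 * (4 ^ j * V)) ^ R ≡⟨ cong (_^ R) (sym (*-assoc 2 (4 ^ j) V)) ⟩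
    (2 * 4 ^ j * V) ^ R ≡⟨ ^-distribʳ-* R (2 * 4 ^ j) V ⟩
    (2 * 4 ^ j) ^ R * V ^ R ≤⟨ *-mono-≤ (^-monoˡ-≤ R four) (≤-reflexive (sym (^-*-assoc V w R′))) ⟩
    (2 ^ 83) ^ R * (V ^ w) ^ R′ ≤⟨ *-monoʳ-≤ ((2 ^ 83) ^ R) (^-monoˡ-≤ R′ Vw≤) ⟩
    (2 ^ 83) ^ R * (2 ^ (v * t)) ^ R′ ≡⟨ cong₂ _*_ (^-*-assoc 2 83 R) (^-*-assoc 2 (v * t) R′) ⟩
    2 ^ (83 * R) * 2 ^ (v * t * R′) ≡⟨ ^-distribˡ-+-* 2 (83 * R) (v * t * R′) ⟨
    2 ^ (83 * R + v * t * R′) ∎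
    where
    open ≤-Reasoning
    R = w * R′
    four : 2 * 4 ^ j ≤ 2 ^ 83
    four = ≤-trans (*-monoʳ-≤ 2 (^-monoʳ-≤ 4 j≤)) (≤ᵇ⇒≤ (2 * 4 ^ 41) (2 ^ 83) _)
    Vw≤ : V ^ w ≤ 2 ^ (v * t)
    Vw≤ = *-cancelʳ-≤ _ _ ((q ^ w) ^ t) {{m^n≢0 (q ^ w) t {{m^n≢0 q w}}}} (begin
      V ^ w * (q ^ w) ^ t ≡⟨ trans (cong (V ^ w *_) (^-swap q w t)) (sym (^-distribʳ-* w V (q ^ t))) ⟩
      (V * q ^ t) ^ w ≤⟨ ^-monoˡ-≤ w Vq≤ ⟩
      (p ^ t) ^ w ≡⟨ ^-swap p t w ⟩
      (p ^ w) ^ t ≤⟨ ^-monoˡ-≤ t pw≤ ⟩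
      (q ^ w * 2 ^ v) ^ t ≡⟨ trans (^-distribʳ-* t (q ^ w) (2 ^ v)) (trans (cong ((q ^ w) ^ t *_) (^-*-assoc 2 v t)) (*-comm ((q ^ w) ^ t) _)) ⟩
      2 ^ (v * t) * (q ^ w) ^ t ∎)

  V-small : ∀ {V G Fp Fn N₁ D₁ σ Ψ p q S k W w R′ K T₀ h c z ℓ₁ ℓ₂ v l s j} .{{_ : NonZero q}} .{{_ : NonZero (S * (k * W) * T₀)}} →
    let t = s + T₀ ; αL = v * R′ + ℓ₂ * k + z * W ; αR = l * (21 * K) + ℓ₁ * k in
    w * R′ ≡ S * (k * W) → W * K ≡ S * (k * W) →
    1 ≤ Fn → Fp ≤ Fn * (G ^ S * Ψ) → Ψ ^ k ≤ 2 ^ (t * z) → Fn * N₁ ^ t ≤ Fp * D₁ ^ t * σ ^ c →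
    2 ^ ℓ₁ ≤ N₁ ^ W → D₁ ^ W ≤ 2 ^ ℓ₂ → σ ^ T₀ ≤ 2 ^ (h * T₀ + 2 * s) →
    V * q ^ t ≤ p ^ t → p ^ w ≤ q ^ w * 2 ^ v → 2 ^ l ≤ 9 ^ W → j ≤ 41 →
    T₀ * αL + 2 * (c * (k * W)) ≤ T₀ * αR →
    T₀ * (83 * (S * (k * W)) + T₀ * αL) + h * T₀ * (c * (k * W)) ≤ T₀ * (T₀ * αR) →
    2 * (4 ^ j * V) ≤ 9 ^ (21 * t) * G
  V-small {V} {G} {Fp} {Fn} {N₁} {D₁} {σ} {Ψ} {p} {q} {S} {k} {W} {w} {R′} {K} {T₀} {h} {c} {z} {ℓ₁} {ℓ₂} {v} {l} {s} {j}
    wR WK 1≤Fn cert ψ≤ ratio num≥ den≤ σ≤ Vq≤ pw≤ 9≥ j≤ slope const =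
    exponents⇒≤ {2 * (4 ^ j * V)} {9 ^ (21 * t)} {G} {σ} {R} {c′} {T₀} {ℓ₁ * (t * k)} {ℓ₂ * (t * k) + t * z * W} {83 * R + v * t * R′} {l * (21 * t * K)} {s} {h}
      (≤-trans (G-lower {G} {Fp} {Fn} {N₁} {D₁} {σ} {Ψ} {t} {c} {S} {W} {k} {z} {ℓ₁} {ℓ₂} 1≤Fn cert ψ≤ ratio num≥ den≤)
        (≤-reflexive (cong (λ x → 2 ^ (ℓ₂ * (t * k) + t * z * W) * x * G ^ R) (^-*-assoc σ c (k * W)))))
      σ≤
      (subst (λ r → (2 * (4 ^ j * V)) ^ r ≤ 2 ^ (83 * r + v * t * R′)) wR (V-power V q p w v R′ t j Vq≤ pw≤ j≤))
      nine
      (begin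
        T₀ * (83 * R + v * t * R′ + (ℓ₂ * (t * k) + t * z * W)) + (h * T₀ + 2 * s) * c′
          ≡⟨ l1 T₀ (83 * R) v s R′ ℓ₂ k z W h c′ ⟩
        T₀ * (83 * R + T₀ * αL) + h * T₀ * c′ + s * (T₀ * αL + 2 * c′)
          ≤⟨ +-mono-≤ const (*-monoʳ-≤ s slope) ⟩
        T₀ * (T₀ * αR) + s * (T₀ * αR)
          ≡⟨ l2 T₀ s l K ℓ₁ k ⟩
        T₀ * (l * (21 * t * K) + ℓ₁ * (t * k)) ∎)
    where
    open ≤-Reasoning
    t = s + T₀
    R = S * (k * W)
    c′ = c * (k * W)
    αL = v * R′ + ℓ₂ * k + z * W
    αR = l * (21 * K) + ℓ₁ * k
    nine : 2 ^ (l * (21 * t * K)) ≤ (9 ^ (21 * t)) ^ R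
    nine = begin
      2 ^ (l * (21 * t * K)) ≡⟨ ^-*-assoc 2 l (21 * t * K) ⟨
      (2 ^ l) ^ (21 * t * K) ≤⟨ ^-monoˡ-≤ (21 * t * K) 9≥ ⟩
      (9 ^ W) ^ (21 * t * K) ≡⟨ trans (^-*-assoc 9 W (21 * t * K)) (trans (cong (9 ^_) (l3 W (21 * t) K)) (sym (^-*-assoc 9 (21 * t) (W * K)))) ⟩
      (9 ^ (21 * t)) ^ (W * K) ≡⟨ cong ((9 ^ (21 * t)) ^_) WK ⟩
      (9 ^ (21 * t)) ^ R ∎
      where
      l3 : ∀ W u K → W * (u * K) ≡ u * (W * K)
      l3 = solve-∀
    l1 : ∀ T x v s R ℓ k z W h c → T * (x + v * (s + T) * R + (ℓ * ((s + T) * k) + (s + T) * z * W)) + (h * T + 2 * s) * c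
       ≡ T * (x + T * (v * R + ℓ * k + z * W)) + h * T * c + s * (T * (v * R + ℓ * k + z * W) + 2 * c)
    l1 = solve-∀
    l2 : ∀ T s l K ℓ k → T * (T * (l * (21 * K) + ℓ * k)) + s * (T * (l * (21 * K) + ℓ * k)) ≡ T * (l * (21 * (s + T) * K) + ℓ * ((s + T) * k))
    l2 = solve-∀

  polynomial<2^ : ∀ {σ c h T₀ s} .{{_ : NonZero T₀}} → σ ^ T₀ ≤ 2 ^ (h * T₀ + 2 * s) → 10 + h * (2 * c) < T₀ → 4 * c ≤ T₀ →
    (25 * σ ^ c) ^ 2 < 2 ^ (s + T₀)
  polynomial<2^ {σ} {c} {h} {T₀} {s} σ≤ h₁ h₂ = ≰⇒> λ le → <⇒≱ raised (^-monoˡ-≤ T₀ le)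
    where
    open ≤-Reasoning
    raised : ((25 * σ ^ c) ^ 2) ^ T₀ < (2 ^ (s + T₀)) ^ T₀
    raised = begin-strict
      ((25 * σ ^ c) ^ 2) ^ T₀ ≡⟨ cong (_^ T₀) (trans (^-distribʳ-* 2 25 (σ ^ c)) (cong (625 *_) (^-*-assoc σ c 2))) ⟩
      (625 * σ ^ (c * 2)) ^ T₀ ≡⟨ trans (^-distribʳ-* T₀ 625 (σ ^ (c * 2))) (cong (625 ^ T₀ *_) (^-swap σ (c * 2) T₀)) ⟩
      625 ^ T₀ * (σ ^ T₀) ^ (c * 2) ≤⟨ *-mono-≤ (^-monoˡ-≤ T₀ (≤ᵇ⇒≤ 625 (2 ^ 10) _)) (^-monoˡ-≤ (c * 2) σ≤) ⟩
      (2 ^ 10) ^ T₀ * (2 ^ (h * T₀ + 2 * s)) ^ (c * 2) ≡⟨ trans (cong₂ _*_ (^-*-assoc 2 10 T₀) (^-*-assoc 2 (h * T₀ + 2 * s) (c * 2))) (sym (^-distribˡ-+-* 2 (10 * T₀) ((h * T₀ + 2 * s) * (c * 2)))) ⟩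
      2 ^ (10 * T₀ + (h * T₀ + 2 * s) * (c * 2)) <⟨ ^-monoʳ-< 2 (s≤s (s≤s z≤n)) (begin-strict
        10 * T₀ + (h * T₀ + 2 * s) * (c * 2) ≡⟨ l1 T₀ h s c ⟩
        (10 + h * (2 * c)) * T₀ + s * (4 * c) <⟨ +-mono-<-≤ (*-monoˡ-< T₀ h₁) (*-monoʳ-≤ s h₂) ⟩
        T₀ * T₀ + s * T₀ ≡⟨ l2 T₀ s ⟩
        (s + T₀) * T₀ ∎) ⟩
      2 ^ ((s + T₀) * T₀) ≡⟨ ^-*-assoc 2 (s + T₀) T₀ ⟨
      (2 ^ (s + T₀)) ^ T₀ ∎
      where
      l1 : ∀ T h s c → 10 * T + (h * T + 2 * s) * (c * 2) ≡ (10 + h * (2 * c)) * T + s * (4 * c)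
      l1 = solve-∀
      l2 : ∀ T s → T * T + s * T ≡ (s + T) * T
      l2 = solve-∀

  -- The numerical hypothesis leaves a factor √2 for each unit of t, and 2^(t/2) outgrows the
  -- polynomial losses; the squares avoid the root.
  A<V : ∀ {A V σ c t q₂ p₂ e N D x y} → A * 17 * q₂ ^ t ≤ 25 * p₂ ^ t → e ^ t * N ^ t ≤ 17 * V * D ^ t * σ ^ c →
    (x * (p₂ * D)) ^ 2 * 2 ≤ (y * (e * N * q₂)) ^ 2 → (25 * σ ^ c) ^ 2 < 2 ^ t → .{{_ : NonZero (x * (p₂ * D))}} → x ^ t * A < y ^ t * V
  A<V {A} {V} {σ} {c} {t} {q₂} {p₂} {e} {N} {D} {x} {y} A≤ V≥ num pol = ≰⇒> λ y^V≤x^A → <⇒≱ pol (*-cancelʳ-≤ _ _ ((a₁ ^ 2) ^ t) {{m^n≢0 (a₁ ^ 2) t {{m^n≢0 a₁ 2}}}} (begin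
      2 ^ t * (a₁ ^ 2) ^ t ≡⟨ trans (*-comm (2 ^ t) _) (sym (^-distribʳ-* t (a₁ ^ 2) 2)) ⟩
      (a₁ ^ 2 * 2) ^ t ≤⟨ ^-monoˡ-≤ t num ⟩
      (a₂ ^ 2) ^ t ≡⟨ ^-swap a₂ 2 t ⟩
      (a₂ ^ t) ^ 2 ≤⟨ ^-monoˡ-≤ 2 (main y^V≤x^A) ⟩
      (25 * σ ^ c * a₁ ^ t) ^ 2 ≡⟨ trans (^-distribʳ-* 2 (25 * σ ^ c) (a₁ ^ t)) (cong ((25 * σ ^ c) ^ 2 *_) (^-swap a₁ t 2)) ⟩
      (25 * σ ^ c) ^ 2 * (a₁ ^ 2) ^ t ∎))
    where
    open ≤-Reasoning
    a₁ = x * (p₂ * D)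
    a₂ = y * (e * N * q₂)
    main : y ^ t * V ≤ x ^ t * A → a₂ ^ t ≤ 25 * σ ^ c * a₁ ^ t
    main le = begin
      (y * (e * N * q₂)) ^ t ≡⟨ trans (^-distribʳ-* t y _) (cong (y ^ t *_) (trans (^-distribʳ-* t (e * N) q₂) (cong (_* q₂ ^ t) (^-distribʳ-* t e N)))) ⟩
      y ^ t * (e ^ t * N ^ t * q₂ ^ t) ≤⟨ *-monoʳ-≤ (y ^ t) (*-monoˡ-≤ (q₂ ^ t) V≥) ⟩
      y ^ t * (17 * V * D ^ t * σ ^ c * q₂ ^ t) ≡⟨ l1 (y ^ t) V (D ^ t) (σ ^ c) (q₂ ^ t) ⟩
      y ^ t * V * (17 * q₂ ^ t * (D ^ t * σ ^ c)) ≤⟨ *-monoˡ-≤ (17 * q₂ ^ t * (D ^ t * σ ^ c)) le ⟩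
      x ^ t * A * (17 * q₂ ^ t * (D ^ t * σ ^ c)) ≡⟨ l2 (x ^ t) A (q₂ ^ t) (D ^ t) (σ ^ c) ⟩
      x ^ t * (A * 17 * q₂ ^ t) * (D ^ t * σ ^ c) ≤⟨ *-monoˡ-≤ (D ^ t * σ ^ c) (*-monoʳ-≤ (x ^ t) A≤) ⟩
      x ^ t * (25 * p₂ ^ t) * (D ^ t * σ ^ c)   ≡⟨ l3 (x ^ t) (p₂ ^ t) (D ^ t) (σ ^ c) ⟩
      25 * σ ^ c * (x ^ t * (p₂ ^ t * D ^ t))   ≡⟨ cong (25 * σ ^ c *_) (trans (cong (x ^ t *_) (sym (^-distribʳ-* t p₂ D))) (sym (^-distribʳ-* t x (p₂ * D)))) ⟩
      25 * σ ^ c * (x * (p₂ * D)) ^ t ∎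
      where
      l1 : ∀ y V D s q → y * (17 * V * D * s * q) ≡ y * V * (17 * q * (D * s))
      l1 = solve-∀
      l2 : ∀ x A q D s → x * A * (17 * q * (D * s)) ≡ x * (A * 17 * q) * (D * s)
      l2 = solve-∀
      l3 : ∀ x p D s → x * (25 * p) * (D * s) ≡ 25 * s * (x * (p * D))
      l3 = solve-∀

  ψ-total : ∀ z₀ L t → (ψ (37 * t) ^ z₀ * ψ-levels L t) ^ 30 ≤ 2 ^ (t * (49 * (37 * z₀ + cost L)))
  ψ-total z₀ L t = begin
    (ψ (37 * t) ^ z₀ * ψ-levels L t) ^ 30 ≡⟨ trans (^-distribʳ-* 30 (ψ (37 * t) ^ z₀) (ψ-levels L t)) (cong (_* ψ-levels L t ^ 30) (^-swap (ψ (37 * t)) z₀ 30)) ⟩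
    (ψ (37 * t) ^ 30) ^ z₀ * ψ-levels L t ^ 30 ≤⟨ *-mono-≤ (^-monoˡ-≤ z₀ (ψ-bound (37 * t))) (ψ-levels-bound L t) ⟩
    (2 ^ (49 * (37 * t))) ^ z₀ * 2 ^ (49 * (t * cost L))  ≡⟨ trans (cong (_* 2 ^ (49 * (t * cost L))) (^-*-assoc 2 (49 * (37 * t)) z₀)) (sym (^-distribˡ-+-* 2 (49 * (37 * t) * z₀) (49 * (t * cost L)))) ⟩
    2 ^ (49 * (37 * t) * z₀ + 49 * (t * cost L)) ≡⟨ cong (2 ^_) (l t z₀ (cost L)) ⟩
    2 ^ (t * (49 * (37 * z₀ + cost L))) ∎
    where
    open ≤-Reasoning
    l : ∀ t z c → 49 * (37 * t) * z + 49 * (t * c) ≡ t * (49 * (37 * z + c))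
    l = solve-∀

  module _ where
    open import Data.Integer.Base using (+_)

    conclude : ∀ t j (m : ℤ) → 1 ≤ t → 2 * (4 ^ j * padéV t) ≤ 9 ^ (21 * t) * padéG t → (16 ^ 21) ^ t * padéA t < (9 ^ 21) ^ t * padéV t →
      4 ^ (42 * t + j) < 3 ^ (42 * t + j) * ∣ + (4 ^ (42 * t + j)) ⊖ + (3 ^ (42 * t + j)) ⊗ m ∣
    conclude t j m 1≤t small A<V = core (∣ + (4 ^ (42 * t + j)) ⊖ + (3 ^ (42 * t + j)) ⊗ m ∣) (padé-bound t j m 1≤t small)
      where
      pow : ∀ b v {u} → b ^ v ≡ u → b ^ (v * t + j) ≡ u ^ t * b ^ j
      pow b v {u} eq = trans (^-distribˡ-+-* b (v * t) j) (cong (_* b ^ j) (trans (sym (^-*-assoc b v t)) (cong (_^ t) eq)))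
      core : ∀ r → 4 ^ j * padéV t ≤ padéA t * r → 4 ^ (42 * t + j) < 3 ^ (42 * t + j) * r
      core r V≤Ar = subst₂ (λ x y → x < y * r) (sym (pow 4 42 {16 ^ 21} refl)) (sym (pow 3 42 {9 ^ 21} refl))
        (gen ((16 ^ 21) ^ t) ((9 ^ 21) ^ t) (4 ^ j) (3 ^ j) (m^n>0 4 j) (m^n>0 3 j) A<V V≤Ar)
        where
        gen : ∀ {A V r} x y f h → 1 ≤ f → 1 ≤ h → x * A < y * V → f * V ≤ A * r → x * f < y * h * r
        gen {A} {V} {r} x y f h 1≤f 1≤h lt le = *-cancelˡ-< A _ _ (begin-strict
          A * (x * f) ≡⟨ l1 A x f ⟩
          f * (x * A) <⟨ *-monoʳ-< f {{>-nonZero 1≤f}} lt ⟩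
          f * (y * V) ≡⟨ l2 f y V ⟩
          y * (f * V) ≤⟨ *-monoʳ-≤ y le ⟩
          y * (A * r) ≤⟨ m≤n*m (y * (A * r)) h {{>-nonZero 1≤h}} ⟩
          h * (y * (A * r)) ≡⟨ l3 h y A r ⟩
          A * (y * h * r)   ∎)
          where
          open ≤-Reasoning
          l1 : ∀ A x f → A * (x * f) ≡ f * (x * A)
          l1 = solve-∀
          l2 : ∀ f y V → f * (y * V) ≡ y * (f * V)
          l2 = solve-∀
          l3 : ∀ h y A r → h * (y * (A * r)) ≡ A * (y * h * r)
          l3 = solve-∀

-- Numerical data of the certificate and their verification.

module Certificate where

  open Prelude
  open import Data.Bool.Base using (Bool; true; _∧_; T; if_then_else_)
  open import Data.Bool.Properties using (T-∧)
  open import Data.List.Base using (List; []; _∷_)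
  open import Data.Maybe.Base using (Maybe; just; nothing; zipWith; from-just)
  open import Data.Integer.Base using (ℤ; ∣_∣) renaming (_-_ to _⊖_; _*_ to _⊗_)
  open import Function.Base using (_$_)
  open import Function.Bundles using (Equivalence)
  open import Relation.Nullary.Decidable using (from-yes; _×-dec_)
  open VonMangoldt
  open CommonFactor
  open Padé
  open FactorialProducts
  open Chebyshev
  open ChebyshevBound
  open Certificates
  open LogarithmicForm
  open PadéEstimates
  open LargeExponents

  -- Square and multiply. The value is right for any fuel `f`; a fuel with e < 2^f leaves no plain
  -- power to evaluate.
  fastPow : ℕ → ℕ → ℕ → ℕ
  fastPow zero    b e = b ^ e
  fastPow (suc f) b e = fastPow f (b * b) (e / 2) * b ^ (e % 2)

  fastPow≡^ : ∀ f b e → fastPow f b e ≡ b ^ e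
  fastPow≡^ zero    b e = refl
  fastPow≡^ (suc f) b e = begin
    fastPow f (b * b) (e / 2) * b ^ (e % 2)  ≡⟨ cong (_* b ^ (e % 2)) (fastPow≡^ f (b * b) (e / 2)) ⟩
    (b * b) ^ (e / 2) * b ^ (e % 2) ≡⟨ cong (λ z → z ^ (e / 2) * b ^ (e % 2)) (cong (b *_) (sym (*-identityʳ b))) ⟩
    (b ^ 2) ^ (e / 2) * b ^ (e % 2) ≡⟨ cong (_* b ^ (e % 2)) (^-*-assoc b 2 (e / 2)) ⟩
    b ^ (2 * (e / 2)) * b ^ (e % 2) ≡⟨ ^-distribˡ-+-* b (2 * (e / 2)) (e % 2) ⟨
    b ^ (2 * (e / 2) + e % 2) ≡⟨ cong (b ^_) (trans (+-comm (2 * (e / 2)) (e % 2)) (trans (cong (e % 2 +_) (*-comm 2 (e / 2))) (sym (m≡m%n+[m/n]*n e 2)))) ⟩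
    b ^ e ∎
    where open ≡-Reasoning

  module _ (f W : ℕ) (lo : ℕ → ℕ) where
    open Logarithms W lo (λ r → suc (lo r))

    logged? : ℕ → Bool
    logged? r = (fastPow f 2 (lo r) ≤ᵇ fastPow f r W) ∧ (fastPow f r W ≤ᵇ fastPow f 2 (suc (lo r)))

    logged-sound : ∀ r → T (logged? r) → Logged r
    logged-sound r ok with Equivalence.to T-∧ ok
    ... | p , q = subst₂ _≤_ (fastPow≡^ f 2 (lo r)) (fastPow≡^ f r W) (≤ᵇ⇒≤ _ _ p)
                , subst₂ _≤_ (fastPow≡^ f r W) (fastPow≡^ f 2 (suc (lo r))) (≤ᵇ⇒≤ _ _ q)

    allLogged? : Terms → Bool
    allLogged? []             = true
    allLogged? (term q m c L) = logged? q ∧ (logged? (suc m) ∧ allLogged? L)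

    allLogged-sound : ∀ L → T (allLogged? L) → AllLogged L
    allLogged-sound []             ok = tt
    allLogged-sound (term q m c L) ok with Equivalence.to T-∧ ok
    ... | p , r with Equivalence.to T-∧ r
    ... | p′ , r′ = logged-sound q p , logged-sound (suc m) p′ , allLogged-sound L r′

  -- A missing entry yields 0, which the test `logged?` with exponent 16384 rejects for every r
  -- other than 1.
  lookupLog : List (ℕ × ℕ) → ℕ → ℕ
  lookupLog []            r = 0
  lookupLog ((s , l) ∷ L) r = if s ≡ᵇ r then l else lookupLog L r

  grid? : ∀ q → Maybe (Grid q)
  grid? q with q ≟ 37 | q ≟ 16 | q ≟ 12 | q ≟ 9
  ... | yes refl | _ | _ | _ = just q37
  ... | _ | yes refl | _ | _ = just q16
  ... | _ | _ | yes refl | _ = just q12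
  ... | _ | _ | _ | yes refl = just q9
  ... | _ | _ | _ | _        = nothing

  onGrid? : ∀ L → Maybe (OnGrid L)
  onGrid? []             = just tt
  onGrid? (term q m c L) = zipWith _,_ (grid? q) (onGrid? L)

  admissible? : ∀ t L → Dec (Admissible t L)
  admissible? t []             = yes tt
  admissible? t (term q m c L) = (q ≤? 37) ×-dec ((4 * suc m ≤? q * t) ×-dec admissible? t L)

  below? : ∀ n L → Dec (Below n L)
  below? n []            = yes tt
  below? n (level X z L) = (suc X ≤? n) ×-dec below? n L

  -- The distance of consecutive multiples of 1 / q in units of 1/5328, where 5328 = lcm (37, 16,
  -- 12, 9).
  step : ∀ {q} → Grid q → ℕ
  step q37 = 144
  step q16 = 333
  step q12 = 444
  step q9  = 592

  q*step : ∀ {q} (g : Grid q) → q * step g ≡ 5328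
  q*step q37 = refl
  q*step q16 = refl
  q*step q12 = refl
  q*step q9  = refl

  opaque
    -- An approximate solution of the linear programme that maximises the exponential growth rate of
    -- factorials cert⁺ t / factorials cert⁻ t, less the cost of the allowances, among all certificates.
    cert⁺ : Terms
    cert⁺ =
       term 37 1 5000051 $ term 37 2 3333315 $ term 16 1 4999797 $ term 16 2 3333253 $ term 37 10 909051 $
       term 12 3 2499977 $ term 9 3 2499938 $ term 37 19 499955 $ term 16 8 15 $ term 12 6 1337964 $
       term 16 11 79384 $ term 9 6 1428582 $ term 37 29 333314 $ term 12 9 546243 $ term 16 14 5 $
       term 9 9 936607 $ term 16 17 88155 $ term 37 41 215396 $ term 12 13 45278 $ term 37 43 212861 $
       term 16 19 9 $ term 37 47 6 $ term 37 48 92608 $ term 37 53 185179 $ term 16 23 18955 $ term 37 55 55900 $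
       term 37 65 293420 $ term 12 21 454519 $ term 37 69 272106 $ term 37 73 62371 $ term 37 79 9 $
       term 16 35 80982 $ term 37 83 76789 $ term 37 89 1 $ term 9 21 454535 $ term 37 95 104163 $
       term 16 41 390824 $ term 37 99 1 $ term 16 43 205635 $ term 37 109 167392 $ term 37 110 44408 $
       term 37 111 21886 $ term 16 49 12 $ term 37 119 64593 $ term 37 125 79367 $ term 16 54 169478 $
       term 16 59 196728 $ term 16 62 119949 $ term 37 146 32843 $ term 12 48 12939 $ term 16 65 18 $
       term 37 153 84094 $ term 9 39 420540 $ term 12 55 232533 $ term 37 174 32670 $ term 16 76 74031 $
       term 37 179 5288 $ term 37 184 93635 $ term 16 80 3402 $ term 37 188 58206 $ term 37 223 19726 $
       term 9 54 2 $ term 16 97 55736 $ term 9 55 161553 $ term 37 230 43285 $ term 37 239 47064 $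
       term 37 241 36384 $ term 16 104 28203 $ term 12 79 239776 $ term 37 255 3720 $ term 37 258 2997 $
       term 37 263 49627 $ term 37 295 23388 $ term 37 299 5802 $ term 16 131 36930 $ term 16 139 77993 $
       term 16 149 66662 $ term 37 349 12235 $ term 16 153 57203 $ term 37 362 6727 $ term 37 384 9312 $
       term 12 127 20630 $ term 37 399 14358 $ term 9 97 92158 $ term 16 174 31220 $ term 37 404 22931 $
       term 37 406 10705 $ term 37 419 27016 $ term 12 139 95515 $ term 37 431 4385 $ []

    cert⁻ : Terms
    cert⁻ =
       term 16 0 9999974 $ term 12 0 9999847 $ term 9 0 9999931 $ term 37 5 1666666 $ term 37 9 999954 $
       term 16 4 6 $ term 16 5 1825327 $ term 37 13 646264 $ term 37 20 476151 $ term 37 21 880245 $ term 16 9 18 $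
       term 37 27 34021 $ term 37 31 3 $ term 16 13 390147 $ term 9 7 2 $ term 37 32 606049 $ term 37 36 270266 $
       term 16 20 476189 $ term 12 15 343120 $ term 16 21 411282 $ term 37 54 65181 $ term 9 13 714283 $
       term 37 59 166647 $ term 12 19 273176 $ term 16 27 139402 $ term 16 29 301577 $ term 37 71 64106 $
       term 37 74 1 $ term 37 80 22289 $ term 9 19 878027 $ term 12 27 714270 $ term 37 87 113635 $
       term 16 39 386561 $ term 16 44 4 $ term 37 107 86719 $ term 9 27 323121 $ term 37 120 42420 $
       term 12 39 484130 $ term 16 53 11740 $ term 37 124 3 $ term 9 31 36883 $ term 37 131 61679 $
       term 37 134 6097 $ term 12 43 435822 $ term 37 139 84306 $ term 9 34 16 $ term 37 143 37392 $
       term 37 147 40871 $ term 37 159 1 $ term 37 161 78588 $ term 12 54 55784 $ term 9 43 320182 $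
       term 37 191 8789 $ term 16 83 89332 $ term 37 195 24810 $ term 37 199 11158 $ term 9 48 187265 $
       term 9 49 146055 $ term 37 209 108081 $ term 12 69 78030 $ term 37 215 27864 $ term 37 219 67399 $
       term 16 98 1 $ term 12 76 109268 $ term 37 251 22624 $ term 16 109 45014 $ term 37 269 21997 $
       term 37 279 14476 $ term 16 125 53167 $ term 16 134 41922 $ term 37 319 17071 $ term 9 79 82446 $
       term 37 329 44592 $ term 12 109 31577 $ term 37 342 13227 $ term 12 111 75757 $ term 37 369 2301 $
       term 37 377 40284 $ term 37 383 43268 $ term 37 440 12100 $ term 37 447 7750 $ term 9 111 78742 $
       term 37 461 23585 $ []

    -- The last level starts at 400, where the sampling ends; from there on the total has to cover
    -- `count cert⁻`.
    levels : Levels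
    levels = level 7 1241973 $ level 11 1385432 $ level 31 327014 $ level 63 35148 $ level 199 105572 $ level 399 1412582 $ []

    -- r ↦ ⌊16384 log₂ r⌋
    logs : List (ℕ × ℕ)
    logs =
       (1 , 0) ∷ (2 , 16384) ∷ (3 , 25968) ∷ (4 , 32768) ∷ (5 , 38042) ∷ (6 , 42352) ∷ (7 , 45995) ∷ (8 , 49152) ∷
       (9 , 51936) ∷ (10 , 54426) ∷ (11 , 56679) ∷ (12 , 58736) ∷ (14 , 62379) ∷ (15 , 64010) ∷ (16 , 65536) ∷
       (18 , 68320) ∷ (20 , 70810) ∷ (21 , 71963) ∷ (22 , 73063) ∷ (24 , 75120) ∷ (28 , 78763) ∷ (30 , 80394) ∷
       (32 , 81920) ∷ (33 , 82647) ∷ (35 , 84038) ∷ (36 , 84704) ∷ (37 , 85351) ∷ (40 , 87194) ∷ (42 , 88347) ∷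
       (44 , 89447) ∷ (45 , 89978) ∷ (48 , 91504) ∷ (49 , 91991) ∷ (50 , 92468) ∷ (54 , 94288) ∷ (55 , 94721) ∷
       (56 , 95147) ∷ (60 , 96778) ∷ (63 , 97931) ∷ (66 , 99031) ∷ (70 , 100422) ∷ (72 , 101088) ∷ (74 , 101735) ∷
       (75 , 102052) ∷ (77 , 102675) ∷ (80 , 103578) ∷ (81 , 103872) ∷ (84 , 104731) ∷ (88 , 105831) ∷
       (90 , 106362) ∷ (96 , 107888) ∷ (98 , 108375) ∷ (99 , 108615) ∷ (100 , 108852) ∷ (105 , 110006) ∷
       (108 , 110672) ∷ (110 , 111105) ∷ (111 , 111319) ∷ (112 , 111531) ∷ (120 , 113162) ∷ (121 , 113358) ∷
       (125 , 114127) ∷ (126 , 114315) ∷ (128 , 114688) ∷ (132 , 115415) ∷ (135 , 115946) ∷ (140 , 116806) ∷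
       (144 , 117472) ∷ (147 , 117959) ∷ (148 , 118119) ∷ (150 , 118436) ∷ (154 , 119059) ∷ (160 , 119962) ∷
       (162 , 120256) ∷ (175 , 122080) ∷ (180 , 122746) ∷ (185 , 123394) ∷ (189 , 123899) ∷ (192 , 124272) ∷
       (196 , 124759) ∷ (200 , 125236) ∷ (210 , 126390) ∷ (216 , 127056) ∷ (220 , 127489) ∷ (224 , 127915) ∷
       (231 , 128643) ∷ (240 , 129546) ∷ (242 , 129742) ∷ (252 , 130699) ∷ (256 , 131072) ∷ (259 , 131347) ∷
       (264 , 131799) ∷ (270 , 132330) ∷ (280 , 133190) ∷ (296 , 134503) ∷ (300 , 134820) ∷ (320 , 136346) ∷
       (330 , 137073) ∷ (343 , 137987) ∷ (350 , 138464) ∷ (363 , 139326) ∷ (370 , 139778) ∷ (378 , 140283) ∷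
       (384 , 140656) ∷ (385 , 140717) ∷ (400 , 141620) ∷ (405 , 141914) ∷ (407 , 142031) ∷ (420 , 142774) ∷
       (432 , 143440) ∷ (441 , 143927) ∷ (448 , 144299) ∷ (462 , 145027) ∷ []

    -- Divided by 16384 · 10^7, the difference `ℓnum - ℓden` is about 5.33 bits per unit of t, of
    -- which the allowances consume 0.74. Compared with the required growth of G this leaves about
    -- 0.17 bits per unit of t, and from `T₀` on they pay for the factor 2 · 4^j and for the slack.
    T₀ ℓnum ℓden : ℕ
    T₀ = 32768
    ℓnum = 84513440518551
    ℓden = 83640509148598

  lo : ℕ → ℕ
  lo = lookupLog logs

  open Logarithms 16384 lo (λ r → suc (lo r))

  opaque
    unfolding cert⁺ cert⁻ levels logs T₀ ℓnum ℓden

    cert-weight : weight cert⁺ ≡ weight cert⁻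
    cert-weight = refl

    cert-enough : count cert⁻ ≤ total levels
    cert-enough = ≤ᵇ⇒≤ 625421881 625422088 tt

    levels-below : Below 400 levels
    levels-below = from-yes (below? 400 levels)

    cert⁺-grid : OnGrid cert⁺
    cert⁺-grid = from-just (onGrid? cert⁺)

    cert⁻-grid : OnGrid cert⁻
    cert⁻-grid = from-just (onGrid? cert⁻)

    cert⁺-admissible : Admissible T₀ cert⁺
    cert⁺-admissible = from-yes (admissible? 32768 cert⁺)

    cert⁻-admissible : Admissible T₀ cert⁻
    cert⁻-admissible = from-yes (admissible? 32768 cert⁻)

    cert⁺-logged : AllLogged cert⁺
    cert⁺-logged = allLogged-sound 18 16384 lo cert⁺ tt

    cert⁻-logged : AllLogged cert⁻
    cert⁻-logged = allLogged-sound 18 16384 lo cert⁻ tt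

    nine-logged : Logged 9
    nine-logged = logged-sound 18 16384 lo 9 tt

    log-num : Σnum lo cert⁺ + Σden lo cert⁻ ≡ ℓnum
    log-num = refl

    log-den : Σnum (λ r → suc (lo r)) cert⁻ + Σden (λ r → suc (lo r)) cert⁺ ≡ ℓden
    log-den = refl

    T₀≢0 : NonZero T₀
    T₀≢0 = _

    T₀≥ : 1000 ≤ T₀
    T₀≥ = ≤ᵇ⇒≤ 1000 T₀ tt

    slack-T₀ : slack T₀ ≤ 2 ^ 23
    slack-T₀ = ≤-trans (≤-reflexive (slack-def T₀)) (≤ᵇ⇒≤ (4 * suc (37 * T₀)) (2 ^ 23) tt)

    R≢0 : NonZero (10000000 * (30 * 16384) * T₀)
    R≢0 = _

    -- Rates are in units of 1 / (10000000 · 30 · 16384) bits; 18172 / 256 is the upper bound for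
    -- log₂ (27^37 / (18^16 19^9)).
    slope-ok : T₀ * (18172 * (64 * (30 * 10000000)) + ℓden * 30 + 49 * (37 * 1100 + cost levels) * 16384) + 2 * ((count cert⁺ + count cert⁻) * (30 * 16384))
      ≤ T₀ * (lo 9 * (21 * (30 * 10000000)) + ℓnum * 30)
    slope-ok = ≤ᵇ⇒≤ _ _ tt

    const-ok : T₀ * (83 * (10000000 * (30 * 16384)) + T₀ * (18172 * (64 * (30 * 10000000)) + ℓden * 30 + 49 * (37 * 1100 + cost levels) * 16384)) + 23 * T₀ * ((count cert⁺ + count cert⁻) * (30 * 16384))
      ≤ T₀ * (T₀ * (lo 9 * (21 * (30 * 10000000)) + ℓnum * 30))
    const-ok = ≤ᵇ⇒≤ _ _ tt

    cert-checked : ∀ {q} (g : Grid q) → allMultiples (certifies? 5327 cert⁺ cert⁻ 10000000 1100 levels) (step g) (q * 400) ≡ true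
    cert-checked q37 = refl
    cert-checked q16 = refl
    cert-checked q12 = refl
    cert-checked q9  = refl

  certificate : ∀ t i → Certifies cert⁺ cert⁻ 10000000 1100 levels t i
  certificate = certified step 5327 q*step cert⁺ cert⁻ 10000000 1100 levels 400 cert⁺-grid cert⁻-grid cert-weight levels-below cert-enough cert-checked

  instance
    T₀-nonZero : NonZero T₀
    T₀-nonZero = T₀≢0

  σ-bound : ∀ s → slack (s + T₀) ^ T₀ ≤ 2 ^ (23 * T₀ + 2 * s)
  σ-bound s = begin
    slack (s + T₀) ^ T₀ ≤⟨ slack-growth T₀ s ⟩
    slack T₀ ^ T₀ * 4 ^ s ≤⟨ *-monoˡ-≤ (4 ^ s) (^-monoˡ-≤ T₀ slack-T₀) ⟩
    (2 ^ 23) ^ T₀ * (2 ^ 2) ^ s ≡⟨ cong₂ _*_ (^-*-assoc 2 23 T₀) (^-*-assoc 2 2 s) ⟩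
    2 ^ (23 * T₀) * 2 ^ (2 * s) ≡⟨ ^-distribˡ-+-* 2 (23 * T₀) (2 * s) ⟨
    2 ^ (23 * T₀ + 2 * s) ∎
    where open ≤-Reasoning

  module Large (s : ℕ) where
    t = s + T₀

    T₀≤t : T₀ ≤ t
    T₀≤t = m≤n+m T₀ s

    instance
      t≢0 : NonZero t
      t≢0 = >-nonZero (≤-trans (>-nonZero⁻¹ T₀) T₀≤t)

    adm⁺ : Admissible t cert⁺
    adm⁺ = Admissible-mono cert⁺ T₀≤t cert⁺-admissible

    adm⁻ : Admissible t cert⁻
    adm⁻ = Admissible-mono cert⁻ T₀≤t cert⁻-admissible

    num≥ : 2 ^ ℓnum ≤ (∏num cert⁺ * ∏den cert⁻) ^ 16384
    num≥ = logs-mult {16384} {Σnum lo cert⁺} {Σden lo cert⁻} {∏num cert⁺} {∏den cert⁻} (∏num-lower cert⁺ cert⁺-logged) (∏den-lower cert⁻ cert⁻-logged) log-num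
      where
      logs-mult : ∀ {W a b x y l} → 2 ^ a ≤ x ^ W → 2 ^ b ≤ y ^ W → a + b ≡ l → 2 ^ l ≤ (x * y) ^ W
      logs-mult {W} {a} {b} {x} {y} p q refl = ≤-trans (≤-reflexive (^-distribˡ-+-* 2 a b)) (≤-trans (*-mono-≤ p q) (≤-reflexive (sym (^-distribʳ-* W x y))))

    den≤ : (∏num cert⁻ * ∏den cert⁺) ^ 16384 ≤ 2 ^ ℓden
    den≤ = logs-mult {16384} {Σnum (λ r → suc (lo r)) cert⁻} {Σden (λ r → suc (lo r)) cert⁺} {∏num cert⁻} {∏den cert⁺} (∏num-upper cert⁻ cert⁻-logged) (∏den-upper cert⁺ cert⁺-logged) log-den
      where
      logs-mult : ∀ {W a b x y l} → x ^ W ≤ 2 ^ a → y ^ W ≤ 2 ^ b → a + b ≡ l → (x * y) ^ W ≤ 2 ^ l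
      logs-mult {W} {a} {b} {x} {y} p q refl = ≤-trans (≤-reflexive (^-distribʳ-* W x y)) (≤-trans (*-mono-≤ p q) (≤-reflexive (sym (^-distribˡ-+-* 2 a b))))

    V-bound : padéV t * (18 ^ 16 * 19 ^ 9) ^ t ≤ (27 ^ 37) ^ t
    V-bound = ≤-trans (*-monoˡ-≤ ((18 ^ 16 * 19 ^ 9) ^ t) (m≤m*n (padéV t) 18)) (V-upper t (>-nonZero⁻¹ t))

    small : ∀ j → j ≤ 41 → 2 * (4 ^ j * padéV t) ≤ 9 ^ (21 * t) * padéG t
    small j j≤ = V-small {padéV t} {padéG t} {factorials cert⁺ t} {factorials cert⁻ t} {∏num cert⁺ * ∏den cert⁻} {∏num cert⁻ * ∏den cert⁺}
      {slack t} {ψ (37 * t) ^ 1100 * ψ-levels levels t} {27 ^ 37} {18 ^ 16 * 19 ^ 9} {10000000} {30} {16384} {256} {64 * (30 * 10000000)} {30 * 10000000}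
      {T₀} {23} {count cert⁺ + count cert⁻} {49 * (37 * 1100 + cost levels)} {ℓnum} {ℓden} {18172} {lo 9} {s} {j} {{_}} {{R≢0}}
      refl refl (factorials≥1 cert⁻ t) (certificate-bound cert⁺ cert⁻ 10000000 1100 levels t adm⁺ adm⁻ (certificate t))
      (ψ-total 1100 levels t) (factorials-ratio t cert⁺ cert⁻ adm⁺ adm⁻ cert-weight) num≥ den≤ (σ-bound s) V-bound
      (≤ᵇ⇒≤ ((27 ^ 37) ^ 256) ((18 ^ 16 * 19 ^ 9) ^ 256 * 2 ^ 18172) tt) (proj₁ nine-logged) j≤ slope-ok const-ok

    A<9V : (16 ^ 21) ^ t * padéA t < (9 ^ 21) ^ t * padéV t
    A<9V = A<V {padéA t} {padéV t} {slack t} {count V⁺ + count V⁻} {t} {17 ^ 16 * 25 ^ 12} {26 ^ 37} {8 ^ 11} {∏num V⁺ * ∏den V⁻} {∏num V⁻ * ∏den V⁺} {16 ^ 21} {9 ^ 21}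
      (A-upper t) (V-lower t (≤-trans (m≤m+n 4 996) (≤-trans T₀≥ T₀≤t)))
      (≤ᵇ⇒≤ ((16 ^ 21 * (26 ^ 37 * (∏num V⁻ * ∏den V⁺))) ^ 2 * 2) ((9 ^ 21 * (8 ^ 11 * (∏num V⁺ * ∏den V⁻) * (17 ^ 16 * 25 ^ 12))) ^ 2) tt)
      (polynomial<2^ {slack t} {count V⁺ + count V⁻} {23} {T₀} {s} (σ-bound s) (≤-trans (m≤m+n 287 713) T₀≥) (≤-trans (m≤m+n 24 976) T₀≥))

  module _ where
    open import Data.Integer.Base using (+_)

    Far : ℕ → Set
    Far k = ∀ (m : ℤ) → 4 ^ k < 3 ^ k * ∣ + (4 ^ k) ⊖ + (3 ^ k) ⊗ m ∣

    far-large : ∀ s j → j ≤ 41 → Far (42 * (s + T₀) + j)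
    far-large s j j≤ m = conclude t j m (>-nonZero⁻¹ t) (small j j≤) A<9V
      where open Large s

-- The finite range by remainders modulo 3^w, and its union with the infinite range.

module AllExponents where

  open Prelude
  open import Agda.Builtin.Nat using (mod-helper)
  open import Data.Bool.Base using (Bool; _∧_; T)
  open import Data.Bool.Properties using (T-∧)
  open import Data.List.Base using (List; []; _∷_)
  open import Data.Integer.Base using (ℤ; ∣_∣; -[1+_]; -_) renaming (_+_ to _⊕_; _-_ to _⊖_; _*_ to _⊗_)
  import Data.Integer.Properties as ℤ
  import Data.Integer.Tactic.RingSolver as ℤR
  open import Function.Bundles using (Equivalence)
  open VonMangoldt
  open Padé
  open Certificate

  module _ where
    open import Data.Integer.Base using (+_)

    residue-abs : ∀ x b d → x ≤ ∣ + x ⊕ + b ⊗ d ∣ ⊎ b ∸ x ≤ ∣ + x ⊕ + b ⊗ d ∣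
    residue-abs x b (+ n) = inj₁ (subst (λ z → x ≤ ∣ + x ⊕ z ∣) (ℤ.pos-* b n) (m≤m+n x (b * n)))
    residue-abs x b d@(-[1+ n ]) = inj₂ (m≤n+o⇒m∸n≤o b x (begin
      b ≤⟨ m≤m*n b (suc n) ⟩
      b * suc n ≡⟨ ℤ.abs-* (+ b) d ⟨
      ∣ + b ⊗ d ∣ ≡⟨ cong ∣_∣ (l (+ x) (+ b ⊗ d)) ⟩
      ∣ - (+ x) ⊕ (+ x ⊕ + b ⊗ d) ∣ ≤⟨ ℤ.∣i+j∣≤∣i∣+∣j∣ (- (+ x)) (+ x ⊕ + b ⊗ d) ⟩
      ∣ - (+ x) ∣ + ∣ + x ⊕ + b ⊗ d ∣ ≡⟨ cong (_+ ∣ + x ⊕ + b ⊗ d ∣) (ℤ.∣-i∣≡∣i∣ (+ x)) ⟩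
      x + ∣ + x ⊕ + b ⊗ d ∣ ∎))
      where
      open ≤-Reasoning
      l : ∀ x y → y ≡ - x ⊕ (x ⊕ y)
      l = ℤR.solve-∀

    -- 4^(K - k) (4^k - 3^k m) ≡ 4^K modulo 3^w, so a single remainder takes care of all k between w and K.
    far-block : ∀ K w x q → 4 ^ K ≡ x + q * 3 ^ w → 4 ^ K < 3 ^ w * x → 4 ^ K < 3 ^ w * (3 ^ w ∸ x) →
      ∀ k → w ≤ k → k ≤ K → Far k
    far-block K w x q 4^K≡ lo hi k w≤k k≤K m = *-cancelˡ-< (4 ^ (K ∸ k)) _ _ (begin-strict
      4 ^ (K ∸ k) * 4 ^ k ≡⟨ 4^K ⟩
      4 ^ K <⟨ big (residue-abs x (3 ^ w) (+ q ⊖ e)) ⟩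
      3 ^ w * ∣ + x ⊕ + (3 ^ w) ⊗ (+ q ⊖ e) ∣ ≡⟨ cong (λ z → 3 ^ w * ∣ z ∣) (sym r≡) ⟩
      3 ^ w * ∣ + (4 ^ (K ∸ k)) ⊗ r ∣ ≤⟨ *-monoˡ-≤ _ (^-monoʳ-≤ 3 w≤k) ⟩
      3 ^ k * ∣ + (4 ^ (K ∸ k)) ⊗ r ∣ ≡⟨ cong (3 ^ k *_) (ℤ.abs-* (+ (4 ^ (K ∸ k))) r) ⟩
      3 ^ k * (4 ^ (K ∸ k) * ∣ r ∣) ≡⟨ l₁ (3 ^ k) (4 ^ (K ∸ k)) ∣ r ∣ ⟩
      4 ^ (K ∸ k) * (3 ^ k * ∣ r ∣) ∎)
      where
      open ≤-Reasoning
      r = + (4 ^ k) ⊖ + (3 ^ k) ⊗ m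
      e = + (3 ^ (k ∸ w)) ⊗ + (4 ^ (K ∸ k)) ⊗ m
      4^K : 4 ^ (K ∸ k) * 4 ^ k ≡ 4 ^ K
      4^K = trans (sym (^-distribˡ-+-* 4 (K ∸ k) k)) (cong (4 ^_) (m∸n+n≡m k≤K))
      3^k : 3 ^ (k ∸ w) * 3 ^ w ≡ 3 ^ k
      3^k = trans (sym (^-distribˡ-+-* 3 (k ∸ w) w)) (cong (3 ^_) (m∸n+n≡m w≤k))
      l₁ : ∀ a b c → a * (b * c) ≡ b * (a * c)
      l₁ = solve-∀
      big : x ≤ ∣ + x ⊕ + (3 ^ w) ⊗ (+ q ⊖ e) ∣ ⊎ 3 ^ w ∸ x ≤ ∣ + x ⊕ + (3 ^ w) ⊗ (+ q ⊖ e) ∣ → 4 ^ K < 3 ^ w * ∣ + x ⊕ + (3 ^ w) ⊗ (+ q ⊖ e) ∣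
      big (inj₁ x≤) = <-≤-trans lo (*-monoʳ-≤ (3 ^ w) x≤)
      big (inj₂ x≤) = <-≤-trans hi (*-monoʳ-≤ (3 ^ w) x≤)
      r≡ : + (4 ^ (K ∸ k)) ⊗ r ≡ + x ⊕ + (3 ^ w) ⊗ (+ q ⊖ e)
      r≡ = trans (cong (λ z → + (4 ^ (K ∸ k)) ⊗ (+ (4 ^ k) ⊖ z ⊗ m)) (trans (cong +_ (sym 3^k)) (ℤ.pos-* (3 ^ (k ∸ w)) (3 ^ w))))
        (trans (l₂ (+ (4 ^ (K ∸ k))) (+ (4 ^ k)) (+ (3 ^ (k ∸ w))) (+ (3 ^ w)) m)
          (trans (cong (_⊖ (+ (3 ^ w) ⊗ e)) (trans (sym (ℤ.pos-* (4 ^ (K ∸ k)) (4 ^ k))) (trans (cong +_ (trans 4^K 4^K≡)) (cong (_⊕_ (+ x)) (ℤ.pos-* q (3 ^ w))))))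
            (l₃ (+ x) (+ q) (+ (3 ^ w)) e)))
        where
        l₂ : ∀ a b c d m → a ⊗ (b ⊖ c ⊗ d ⊗ m) ≡ a ⊗ b ⊖ d ⊗ (c ⊗ a ⊗ m)
        l₂ = ℤR.solve-∀
        l₃ : ∀ x q b e → x ⊕ q ⊗ b ⊖ b ⊗ e ≡ x ⊕ b ⊗ (q ⊖ e)
        l₃ = ℤR.solve-∀

  remainder? : ℕ → ℕ → ℕ → Bool
  remainder? a b x = (a <ᵇ b * x) ∧ (a <ᵇ b * (b ∸ x))

  -- The modulus is suc b.
  block? : ℕ → ℕ → Bool
  block? a b = remainder? a (suc b) (mod-helper 0 b a b)

  blocks? : ℕ → ℕ → List (ℕ × ℕ) → ℕ → Bool
  blocks? f lo []             hi = hi ≤ᵇ lo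
  blocks? f lo ((w , K) ∷ bs) hi = (w ≤ᵇ lo) ∧ (block? (fastPow f 4 K) (fastPow f 3 w ∸ 1) ∧ blocks? f (suc K) bs hi)

  block-sound : ∀ f K w → T (block? (fastPow f 4 K) (fastPow f 3 w ∸ 1)) → ∀ k → w ≤ k → k ≤ K → Far k
  block-sound f K w ok = sound (subst₂ (λ a b → T (block? a (b ∸ 1))) (fastPow≡^ f 4 K) (fastPow≡^ f 3 w) ok)
    where
    -- Stated for variables, so that the modulus `3 ^ w` can be matched as a successor.
    gen : ∀ a b → 1 ≤ b → T (block? a (b ∸ 1)) → ∀ {P : Set} → (∀ x q → a ≡ x + q * b → a < b * x → a < b * (b ∸ x) → P) → P
    gen a (suc b) _ ok f with Equivalence.to T-∧ ok
    ... | p , q = f (a % suc b) (a / suc b) (m≡m%n+[m/n]*n a (suc b)) (<ᵇ⇒< a _ p) (<ᵇ⇒< a _ q)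
    sound : T (block? (4 ^ K) (3 ^ w ∸ 1)) → ∀ k → w ≤ k → k ≤ K → Far k
    sound ok = gen (4 ^ K) (3 ^ w) (m^n>0 3 w) ok (far-block K w)

  blocks-sound : ∀ f lo bs hi → T (blocks? f lo bs hi) → ∀ k → lo ≤ k → k < hi → Far k
  blocks-sound f lo []             hi ok k lo≤k k<hi = contradiction (≤-trans (≤ᵇ⇒≤ hi lo ok) lo≤k) (<⇒≱ k<hi)
  blocks-sound f lo ((w , K) ∷ bs) hi ok k lo≤k k<hi with Equivalence.to T-∧ ok
  ... | w≤lo , rest with Equivalence.to T-∧ rest | k ≤? K
  ... | here , _  | yes k≤K = block-sound f K w here k (≤-trans (≤ᵇ⇒≤ w lo w≤lo) lo≤k) k≤K
  ... | _ , there | no  k≰K = blocks-sound f (suc K) bs hi there k (≰⇒> k≰K) k<hi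

  opaque
    -- The condition on a block forces K / w < log 9 / log 4 ≈ 1.585, which the long blocks nearly
    -- attain; hence their number is only logarithmic in the bound. The last K is 42 T₀ - 1.
    blocks : List (ℕ × ℕ)
    blocks =
       (5 , 6) ∷ (7 , 10) ∷ (11 , 14) ∷ (15 , 22) ∷ (23 , 34) ∷ (35 , 54) ∷ (55 , 86) ∷ (87 , 137) ∷
       (138 , 218) ∷ (219 , 346) ∷ (347 , 549) ∷ (550 , 869) ∷ (870 , 1377) ∷ (1378 , 2181) ∷
       (2182 , 3455) ∷ (3456 , 5476) ∷ (5477 , 8680) ∷ (8681 , 13757) ∷ (13758 , 21805) ∷
       (21806 , 34559) ∷ (34560 , 54774) ∷ (54775 , 86814) ∷ (86815 , 137596) ∷ (137597 , 218084) ∷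
       (218085 , 345655) ∷ (345656 , 547850) ∷ (547851 , 868320) ∷ (868321 , 1376255) ∷ []

  opaque
    unfolding blocks T₀

    far-small : ∀ k → 6 ≤ k → k < 42 * T₀ → Far k
    far-small = blocks-sound 21 6 blocks (42 * T₀) tt

  far : ∀ k → 6 ≤ k → Far k
  far k 6≤k with k <? 42 * T₀
  ... | yes k<  = far-small k 6≤k k<
  ... | no  k≮ = subst Far (sym k≡) (far-large (k / 42 ∸ T₀) (k % 42) (≤-pred (m%n<n k 42)))
    where
    T₀≤ : T₀ ≤ k / 42
    T₀≤ = ≤-trans (≤-reflexive (sym (trans (/-congˡ (*-comm 42 T₀)) (m*n/n≡m T₀ 42)))) (/-monoˡ-≤ 42 (≮⇒≥ k≮))
    k≡ : k ≡ 42 * (k / 42 ∸ T₀ + T₀) + k % 42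
    k≡ = trans (m≡m%n+[m/n]*n k 42) (trans (+-comm (k % 42) _) (cong (_+ k % 42) (trans (*-comm (k / 42) 42) (cong (42 *_) (sym (m∸n+n≡m T₀≤))))))

-- Passage from integers to rational numbers.

open import Algebra.Bundles using (CommutativeMonoid)
open import Defs using (‖_‖; _^_; dist; nearestInteger)
open import Data.Nat.Base using (ℕ; _≥_; zero; suc)
import Data.Nat.Base as ℕ
import Data.Nat.Properties as ℕ
open import Data.Integer.Base using (ℤ; +_; ∣_∣; -_)
import Data.Integer.Base as ℤ
import Data.Integer.Properties as ℤ
import Data.Integer.Tactic.RingSolver as ℤR
open import Data.Product.Base using (proj₁)
open import Data.Rational.Base using (ℚ; _/_; _>_; toℚᵘ)
import Data.Rational.Base as ℚ
import Data.Rational.Properties as ℚ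
open import Data.Rational.Unnormalised.Base as ℚᵘ using (mkℚᵘ; *≡*; *<*)
import Data.Rational.Unnormalised.Properties as ℚᵘ
open import Relation.Binary.PropositionalEquality

open Certificate using (Far)
open AllExponents using (far)

/1-≃ : ∀ i → toℚᵘ (i / 1) ℚᵘ.≃ mkℚᵘ i 0
/1-≃ i = ℚ.toℚᵘ-fromℚᵘ (mkℚᵘ i 0)

/1-* : ∀ i j → (i ℤ.* j) / 1 ≡ (i / 1) ℚ.* (j / 1)
/1-* i j = ℚ.toℚᵘ-injective (ℚᵘ.≃-trans (/1-≃ (i ℤ.* j))
  (ℚᵘ.≃-sym (ℚᵘ.≃-trans (ℚ.toℚᵘ-homo-* (i / 1) (j / 1)) (ℚᵘ.*-cong (/1-≃ i) (/1-≃ j)))))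

/1-- : ∀ i j → (i ℤ.- j) / 1 ≡ (i / 1) ℚ.- (j / 1)
/1-- i j = ℚ.toℚᵘ-injective (ℚᵘ.≃-trans (/1-≃ (i ℤ.- j)) (ℚᵘ.≃-trans (*≡* (lem i j))
  (ℚᵘ.≃-sym (ℚᵘ.≃-trans (ℚ.toℚᵘ-homo-+ (i / 1) (ℚ.- (j / 1))) (ℚᵘ.+-cong (/1-≃ i) (ℚᵘ.≃-trans (ℚ.toℚᵘ-homo‿- (j / 1)) (ℚᵘ.-‿cong (/1-≃ j))))))))
  where
  lem : ∀ i j → (i ℤ.- j) ℤ.* + 1 ≡ (i ℤ.* + 1 ℤ.+ (- j) ℤ.* + 1) ℤ.* + 1
  lem = ℤR.solve-∀

/1-∣∣ : ∀ i → ℚ.∣ i / 1 ∣ ≡ (+ ∣ i ∣) / 1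
/1-∣∣ i = ℚ.toℚᵘ-injective (ℚᵘ.≃-trans (ℚ.toℚᵘ-homo-∣-∣ (i / 1)) (ℚᵘ.≃-trans (ℚᵘ.∣-∣-cong (/1-≃ i)) (ℚᵘ.≃-sym (/1-≃ (+ ∣ i ∣)))))

/1-< : ∀ {m n} → m ℕ.< n → (+ m) / 1 ℚ.< (+ n) / 1
/1-< {m} {n} m<n = ℚ.toℚᵘ-cancel-< (ℚᵘ.<-respˡ-≃ (ℚᵘ.≃-sym (/1-≃ (+ m))) (ℚᵘ.<-respʳ-≃ (ℚᵘ.≃-sym (/1-≃ (+ n)))
  (*<* (subst₂ ℤ._<_ (sym (ℤ.*-identityʳ (+ m))) (sym (ℤ.*-identityʳ (+ n))) (ℤ.+<+ m<n)))))

power-clear : ∀ (x : ℚ) a b → x ℚ.* ((+ b) / 1) ≡ (+ a) / 1 → ∀ k → x ^ k ℚ.* ((+ (b ℕ.^ k)) / 1) ≡ (+ (a ℕ.^ k)) / 1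
power-clear x a b eq zero    = refl
power-clear x a b eq (suc k) = begin
  x ℚ.* x ^ k ℚ.* ((+ (b ℕ.* b ℕ.^ k)) / 1) ≡⟨ cong (λ z → x ℚ.* x ^ k ℚ.* (z / 1)) (ℤ.pos-* b (b ℕ.^ k)) ⟩
  x ℚ.* x ^ k ℚ.* ((+ b ℤ.* + (b ℕ.^ k)) / 1) ≡⟨ cong (x ℚ.* x ^ k ℚ.*_) (/1-* (+ b) (+ (b ℕ.^ k))) ⟩
  x ℚ.* x ^ k ℚ.* (((+ b) / 1) ℚ.* ((+ (b ℕ.^ k)) / 1)) ≡⟨ interchange x (x ^ k) ((+ b) / 1) ((+ (b ℕ.^ k)) / 1) ⟩
  x ℚ.* ((+ b) / 1) ℚ.* (x ^ k ℚ.* ((+ (b ℕ.^ k)) / 1)) ≡⟨ cong₂ ℚ._*_ eq (power-clear x a b eq k) ⟩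
  ((+ a) / 1) ℚ.* ((+ (a ℕ.^ k)) / 1) ≡⟨ /1-* (+ a) (+ (a ℕ.^ k)) ⟨
  (+ a ℤ.* + (a ℕ.^ k)) / 1 ≡⟨ cong (_/ 1) (ℤ.pos-* a (a ℕ.^ k)) ⟨
  (+ (a ℕ.* a ℕ.^ k)) / 1 ∎
  where
  open ≡-Reasoning
  open import Algebra.Properties.CommutativeSemigroup (CommutativeMonoid.commutativeSemigroup ℚ.*-1-commutativeMonoid) using (interchange)

-- Both sides are multiplied by 9^k = 3^k · 3^k: one factor clears the denominator of (4/3)^k, the
-- other is the factor 3^k in `Far`, and (4/9)^k becomes 4^k.
Far⇒dist : ∀ k → Far k → ∀ n → dist ((+ 4 / 3) ^ k) n > (+ 4 / 9) ^ k
Far⇒dist k far-k n = ℚ.*-cancelʳ-<-nonNeg N {{ℚ.normalize-nonNeg (9 ℕ.^ k) 1}} (subst₂ ℚ._<_ (sym (power-clear (+ 4 / 9) 4 9 refl k)) (sym rhs) (/1-< (far-k n)))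
  where
  open ≡-Reasoning
  t N : ℚ
  t = (+ (3 ℕ.^ k)) / 1
  N = (+ (9 ℕ.^ k)) / 1
  y = (+ 4 / 3) ^ k
  r = + (4 ℕ.^ k) ℤ.- + (3 ℕ.^ k) ℤ.* n
  9^k : ∀ k → 9 ℕ.^ k ≡ 3 ℕ.^ k ℕ.* 3 ℕ.^ k
  9^k k = trans (ℕ.^-*-assoc 3 2 k) (trans (cong (3 ℕ.^_) (cong (k ℕ.+_) (ℕ.+-identityʳ k))) (ℕ.^-distribˡ-+-* 3 k k))
  N≡ : N ≡ t ℚ.* t
  N≡ = trans (cong (λ z → (+ z) / 1) (9^k k)) (trans (cong (_/ 1) (ℤ.pos-* (3 ℕ.^ k) (3 ℕ.^ k))) (/1-* (+ (3 ℕ.^ k)) (+ (3 ℕ.^ k))))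
  clear : (y ℚ.- n / 1) ℚ.* t ≡ r / 1
  clear = begin
    (y ℚ.- n / 1) ℚ.* t ≡⟨ ℚ.*-distribʳ-+ t y (ℚ.- (n / 1)) ⟩
    y ℚ.* t ℚ.+ ℚ.- (n / 1) ℚ.* t ≡⟨ cong₂ ℚ._+_ (power-clear (+ 4 / 3) 4 3 refl k) (trans (sym (ℚ.neg-distribˡ-* (n / 1) t)) (cong ℚ.-_ (trans (ℚ.*-comm (n / 1) t) (sym (/1-* (+ (3 ℕ.^ k)) n))))) ⟩
    (+ (4 ℕ.^ k)) / 1 ℚ.- (+ (3 ℕ.^ k) ℤ.* n) / 1 ≡⟨ /1-- (+ (4 ℕ.^ k)) (+ (3 ℕ.^ k) ℤ.* n) ⟨
    r / 1 ∎
  rhs : dist y n ℚ.* N ≡ (+ (3 ℕ.^ k ℕ.* ∣ r ∣)) / 1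
  rhs = begin
    ℚ.∣ y ℚ.- n / 1 ∣ ℚ.* N ≡⟨ cong (ℚ.∣ y ℚ.- n / 1 ∣ ℚ.*_) N≡ ⟩
    ℚ.∣ y ℚ.- n / 1 ∣ ℚ.* (t ℚ.* t) ≡⟨ ℚ.*-assoc ℚ.∣ y ℚ.- n / 1 ∣ t t ⟨
    ℚ.∣ y ℚ.- n / 1 ∣ ℚ.* t ℚ.* t ≡⟨ cong (λ z → ℚ.∣ y ℚ.- n / 1 ∣ ℚ.* z ℚ.* t) (/1-∣∣ (+ (3 ℕ.^ k))) ⟨
    ℚ.∣ y ℚ.- n / 1 ∣ ℚ.* ℚ.∣ t ∣ ℚ.* t ≡⟨ cong (ℚ._* t) (trans (sym (ℚ.∣p*q∣≡∣p∣*∣q∣ (y ℚ.- n / 1) t)) (cong ℚ.∣_∣ clear)) ⟩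
    ℚ.∣ r / 1 ∣ ℚ.* t ≡⟨ cong (ℚ._* t) (/1-∣∣ r) ⟩
    (+ ∣ r ∣) / 1 ℚ.* t ≡⟨ ℚ.*-comm ((+ ∣ r ∣) / 1) t ⟩
    t ℚ.* ((+ ∣ r ∣) / 1) ≡⟨ trans (sym (/1-* (+ (3 ℕ.^ k)) (+ ∣ r ∣))) (cong (_/ 1) (sym (ℤ.pos-* (3 ℕ.^ k) ∣ r ∣))) ⟩
    (+ (3 ℕ.^ k ℕ.* ∣ r ∣)) / 1 ∎

theorem1 : ∀ (k : ℕ) → k ≥ 6 → ‖ (+ 4 / 3) ^ k ‖ > (+ 4 / 9) ^ k
theorem1 k k≥6 = Far⇒dist k (far k k≥6) (proj₁ (nearestInteger ((+ 4 / 3) ^ k)))
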